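{- Let $k\ge2$, let $\mathbb{S}$ be a marked surface, and let $\mathcal{M}$ be either $\mathcal{A}_{{\rm SL}_k,\mathbb{S}}$ or $\mathcal{A}'_{{\rm SL}_k,\mathbb{S}}$. Let $\mathcal{C}$ and $\mathcal{C}'$ be mutation-adjacent $P$-clusters in the good part $\mathbb{E}_{\rm good}$ of the exchange graph of $\mathscr{A}(\mathcal{M})$, and let $p\in\mathbb{M}_\circ$ be a puncture. Then the corresponding decorated ordered set partitions $(\Pi_p(\mathcal{C}),\varepsilon_p(\mathcal{C}))$ and $(\Pi_p(\mathcal{C}'),\varepsilon_p(\mathcal{C}'))$ either coincide or are related by a dosp mutation.
   Context: **Marked surfaces.** $\mathbb{S}=(\mathbf{S},\mathbb{M})$ is an oriented marked surface (Fomin–Shapiro–Thurston); $\mathbb{M}_\circ$ is the set of interior marked points (punctures). Excluded throughout: spheres with at most $2$ punctures, the unpunctured monogon and digon, the once-punctured monogon. A boundary interval is a piece of $\partial\mathbf S$ connecting adjacent boundary points. A triangulation is a maximal set of noncrossing arcs. It is regular if it has no loop enclosing a single puncture, and taut if it is regular and each triangle has at most one side which is a boundary interval. Taut triangulations exist unless $\mathbb S$ is an unpunctured polygon (in which case there are no punctures). **Cluster algebras, combinatorially.** $\mathcal{A}_{{\rm SL}_k,\mathbb{S}}$ is the Fock–Goncharov moduli space of (twisted, for $k$ even) ${\rm SL}_k$-local systems with an affine flag at each marked point, invariant under the monodromy at punctures; in $\mathcal{A}'_{{\rm SL}_k,\mathbb{S}}$ the boundary points carry vectors instead of affine flags. $\mathscr{A}(\mathcal{M})$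 is the cluster algebra with the following initial quiver; the $P$-cluster data below depend only on this quiver and the stated weights. Let $Q_k$ be the quiver with vertices $(a,b,c)\in\mathbb{N}^3$, $a+b+c=k$, excluding $(k,0,0),(0,k,0),(0,0,k)$, and, for every $(i,j,l)\in\mathbb{N}^3$ with $i+j+l=k-2$, arrows $(i{+}1,j{+}1,l)\to(i{+}1,j,l{+}1)\to(i,j{+}1,l{+}1)\to(i{+}1,j{+}1,l)$. For a triangle $\delta$ place a copy of $Q_k$ in $\delta$, with $(k,0,0),(0,k,0),(0,0,k)$ at its corners in clockwise order. For $\mathcal{M}=\mathcal{A}_{{\rm SL}_k,\mathbb{S}}$ and a regular triangulation $\Delta$, $Q_k(\Delta)$ is obtained by gluing these along the $k-1$ vertices of each common side and cancelling oriented $2$-cycles; vertices on boundary intervals are frozen. For $\mathcal{M}=\mathcal{A}'_{{\rm SL}_k,\mathbb{S}}$ and a taut triangulation $\Delta$, $Q'_k(\Delta)$ is obtained in the same way except that a triangle with a boundary-interval side (drawn as its bottom side) receives instead the quiver $Q_k^1$ with vertices $L_1,\dots,L_{k-1}$ (on the left side), $R_1,\dots,R_{k-1}$ (on the right side; index $k-1$ nearest the top corner), a frozen vertex $M$ on the bottom side, and arrows $R_a\to L_a$ $(1\le a\le k-1)$, $L_a\to R_{a-1}\to R_a$ $(2\le a\le k-1)$, $L_1\to M\to R_1$. Different triangulations give mutation-equivalent seeds. **Weights and $P$-seeds.** $P=\mathbb{Z}^k/{\rm span}(1,\dots,1)$, $e_i$ = image of the $i$th standard basis vector, $\omega_a=e_1+\cdots+e_a$.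 A $P$-seed is a quiver $Q$ without frozen vertices with weights ${\rm wt}(v)\in P^{\oplus\mathbb{M}_\circ}$ satisfying $\sum_{u\to v}{\rm wt}(u)=\sum_{v\to u}{\rm wt}(u)$ at every $v$; its $P$-cluster is the multiset of weights; mutation at $v$ mutates the quiver and replaces ${\rm wt}(v)$ by $-{\rm wt}(v)+\sum_{u\to v}{\rm wt}(u)$. The initial $P$-seed is obtained from the initial quiver by deleting frozen vertices; the vertex $(a,b,c)$ of a triangle with corners $q_1,q_2,q_3$ has as weight the sum of $\omega_a$ in the copy of $P$ at $q_1$, $\omega_b$ at $q_2$, $\omega_c$ at $q_3$, where corners that are boundary points contribute $0$; in a copy of $Q^1_k$ the vertices $L_a,R_a$ have weight $\omega_a$ at the top corner (or $0$ if this is a boundary point). Performing mutations, every seed of $\mathscr{A}(\mathcal{M})$ has an underlying $P$-seed. $\pi_p:P^{\oplus\mathbb{M}_\circ}\to P$ is the projection to the copy at $p$. **Compatibility.** $\lambda,\mu\in P$ are $W$-sortable if for some permutation $w$ of $[k]$ both $\lambda_{w(1)}\ge\cdots\ge\lambda_{w(k)}$ and $\mu_{w(1)}\ge\cdots\ge\mu_{w(k)}$; they are root-conjugate if $\lambda-\mu=e_a-e_b$ for some $a\ne b$ and $\mu$ is obtained from $\lambda$ by swapping the coordinates $a$ and $b$; they are compatible if $W$-sortable or root-conjugate. A multiset of pairwise compatible vectors is basic if every element that is root-conjugate to another element has multiplicity one. $\mathbb{E}_{\rm good}$ is the maximal connected subgraph of the exchange graph of $\mathscr{A}(\mathcal{M})$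 containing the initial seed and consisting of seeds for which $\pi_p(\mathcal{C})$ is a basic multiset of pairwise compatible vectors for every puncture $p$ ($\mathcal{C}$ the $P$-cluster). Mutation-adjacent $P$-clusters in the good part are the $P$-clusters of two adjacent seeds of $\mathbb{E}_{\rm good}$. **From $P$-clusters to dosps.** An ordered set partition (osp) of $[k]$ is a sequence $B_1|\cdots|B_\ell$ of nonempty disjoint blocks with union $[k]$. For $\lambda\in P$, $\Pi(\lambda)$ is the osp with $a,b$ in the same block iff $\lambda_a=\lambda_b$ and $a$ in an earlier block than $b$ iff $\lambda_a>\lambda_b$. $\Pi$ refines $\Pi'$ if each block of $\Pi'$ is a union of consecutive blocks of $\Pi$; $\bigvee$ is the least upper bound in the order in which finer osps are larger. For a basic multiset $\mathcal{C}$ of pairwise compatible vectors, being root-conjugate generates an equivalence relation on $\mathcal{C}$ (vectors not root-conjugate to any other, each copy separately, form singleton classes), and $\Pi(\mathcal{C}):=\bigvee_{\mathcal{O}}\Pi(\sum_{\lambda\in\mathcal{O}}\lambda)$ over the classes $\mathcal{O}$. The ground set of a class $\mathcal{O}$ is $\{a:\exists\lambda,\mu\in\mathcal{O},b\in[k],\ \lambda-\mu=e_a-e_b\}$. For a class of size at least three with ground set $B$, there are a unique $\nu\in P$ with constant $B$-coordinates and unique sign $\varepsilon$ with $\mathcal{O}=\{\nu+\varepsilon e_a:a\in B\}$. A decorated osp (dosp) is an osp with a sign for each block of size at least three. For a $P$-cluster in $\mathbb{E}_{\rm good}$, $\Pi_p(\mathcal{C}):=\Pi(\pi_p(\mathcal{C}))$;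 each block $B$ with $|B|\ge3$ is the ground set of a class of $\pi_p(\mathcal{C})$ and $\varepsilon_p(\mathcal{C})(B)$ is the sign of that class. **Dosp mutation.** A mutation of dosps replaces adjacent blocks $(L\cup\{a\})^+\,|\,R^-$ by $L^+\,|\,(\{a\}\cup R)^-$ or vice versa, where $L,R,\{a\}$ are disjoint, $L$ or $R$ may be empty (empty blocks are omitted), and blocks of size at most two may be regarded as having either sign. -}

module Defs where

open import Data.Bool using (Bool; true; false; if_then_else_; _∨_)
open import Data.Fin as Fin using (Fin; toℕ)
open import Data.Fin.Patterns using (0F; 1F; 2F)
import Data.Fin.Properties as Finₚ
open import Data.Fin.Permutation using (Permutation′; _⟨$⟩ʳ_)
open import Data.Fin.Permutation.Components using (transpose)
open import Data.Fin.Subset using (Subset; _∈_; _∉_; _∪_; _∩_; ⁅_⁆; ∣_∣; ⋃; Nonempty; Empty)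
open import Data.Fin.Subset.Properties using (_∈?_)
open import Data.Integer as ℤ using (ℤ; +_; 0ℤ; 1ℤ)
import Data.Integer.Properties as ℤₚ
open import Algebra.Properties.CommutativeMonoid.Sum ℤₚ.+-0-commutativeMonoid using (sum)
open import Data.List using (List; []; _∷_; _++_; map; concat; concatMap; upTo; allFin; length; lookup; filter; findᵇ)
open import Data.List.Relation.Unary.All using (All)
open import Data.List.Relation.Unary.Any using (Any)
open import Data.List.Relation.Unary.AllPairs using (AllPairs)
open import Data.Maybe using (Maybe; just; nothing; is-nothing)
open import Data.Nat as ℕ using (ℕ; zero; suc; _∸_)
import Data.Nat.Properties as ℕₚ
open import Data.Product using (∃; ∃₂; _×_; _,_; proj₁; proj₂)
open import Data.Product.Properties using (≡-dec)
open import Data.Sign using (Sign)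
open import Data.Sum using (_⊎_; inj₁; inj₂)
open import Data.Vec.Functional using (updateAt)
open import Function using (_⇔_; _∘_)
open import Relation.Binary.Construct.Closure.Equivalence using (EqClosure)
open import Relation.Binary.Definitions using (DecidableEquality)
open import Relation.Binary.PropositionalEquality using (_≡_; _≢_; refl)
open import Relation.Nullary using (does; yes; no; map′; _×-dec_)

private
  variable
    k m n : ℕ

------------------------------------------------------------------------
-- Triangulated marked surfaces

-- The corners of a triangle are numbered 0, 1, 2 clockwise; side i runs
-- clockwise from corner i to corner next i.
next : Fin 3 → Fin 3
next 0F = 1F
next 1F = 2F
next 2F = 0F

-- A connected oriented marked surface presented by a triangulation, i.e. by
-- clockwise oriented triangles glued along the two sides of each arc.
-- Every arc e carries an auxiliary direction: sideOf e true is the triangle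
-- side whose clockwise direction agrees with it, sideOf e false the other one.
record Triangulation : Set where
  field
    triangles arcs punctures boundaryPoints : ℕ

  MarkedPoint : Set
  MarkedPoint = Fin punctures ⊎ Fin boundaryPoints

  Corner : Set
  Corner = Fin triangles × Fin 3

  field
    -- nothing: the side is a boundary interval.
    side   : Fin triangles → Fin 3 → Maybe (Fin arcs × Bool)
    sideOf : Fin arcs → Bool → Fin triangles × Fin 3
    corner : Corner → MarkedPoint

  -- Sides are glued head to tail, as the surface is oriented.
  Glued : Corner → Corner → Set
  Glued x y = ∃ λ e →
    let (t , i) = sideOf e true ; (t′ , i′) = sideOf e false in
    (x ≡ (t , i) × y ≡ (t′ , next i′)) ⊎ (x ≡ (t , next i) × y ≡ (t′ , i′))

  Neighbours : Fin triangles → Fin triangles → Set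
  Neighbours t t′ = ∃ λ e → proj₁ (sideOf e true) ≡ t × proj₁ (sideOf e false) ≡ t′

  field
    side-sideOf : ∀ {t i e d} → (side t i ≡ just (e , d)) ⇔ (sideOf e d ≡ (t , i))

    -- Marked points are the classes of corners under gluing, and the boundary
    -- points are those at the ends of boundary intervals.
    corner-glued : ∀ {x y} → (corner x ≡ corner y) ⇔ EqClosure Glued x y
    corner-surjective : ∀ q → ∃ λ x → corner x ≡ q
    boundary-ends : ∀ {t i} → side t i ≡ nothing →
      (∃ λ q → corner (t , i) ≡ inj₂ q) × (∃ λ q → corner (t , next i) ≡ inj₂ q)
    boundary-point : ∀ q → ∃₂ λ t i → side t i ≡ nothing × corner (t , i) ≡ inj₂ q

    nonempty  : 1 ℕ.≤ triangles
    connected : ∀ t t′ → EqClosure Neighbours t t′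

open Triangulation

-- A loop enclosing a single puncture is the outer side of a self-folded
-- triangle, and a triangle is self-folded iff two of its sides are glued.
-- In particular the excluded surfaces have no regular triangulation.
Regular : Triangulation → Set
Regular Δ = ∀ e → proj₁ (sideOf Δ e true) ≢ proj₁ (sideOf Δ e false)

Taut : Triangulation → Set
Taut Δ = Regular Δ × (∀ {t i j} → side Δ t i ≡ nothing → side Δ t j ≡ nothing → i ≡ j)

-- 𝒜 stands for affine flags at the boundary points, 𝒜′ for vectors.
data ModuliSpace : Set where
  𝒜 𝒜′ : ModuliSpace

Admissible : ModuliSpace → Triangulation → Set
Admissible 𝒜  = Regular
Admissible 𝒜′ = Taut

------------------------------------------------------------------------
-- The weights

-- Representatives in ℤᵏ of P = ℤᵏ / span(1,…,1), to be compared by _≈_.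
P : ℕ → Set
P k = Fin k → ℤ

infix 4 _≈_
infixl 6 _⊕_ _⊖_

_≈_ : P k → P k → Set
λ₁ ≈ μ = ∃ λ c → ∀ i → λ₁ i ≡ μ i ℤ.+ c

𝟎 : P k
𝟎 _ = 0ℤ

_⊕_ _⊖_ : P k → P k → P k
(λ₁ ⊕ μ) i = λ₁ i ℤ.+ μ i
(λ₁ ⊖ μ) i = λ₁ i ℤ.- μ i

basis : Fin k → P k
basis a i = if does (a Finₚ.≟ i) then 1ℤ else 0ℤ

ω : ℕ → P k
ω a i = if does (toℕ i ℕₚ.<? a) then 1ℤ else 0ℤ

------------------------------------------------------------------------
-- P-seeds

-- arrows u v is the number of arrows u → v. The balancing condition on the
-- weights is not stored: it holds for the initial P-seeds below and is
-- preserved by mutation, and only P-seeds so obtained are considered.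
record PSeed (n k m : ℕ) : Set where
  field
    arrows : Fin n → Fin n → ℕ
    weight : Fin n → (Fin m → P k)

open PSeed public

-- Reverse the arrows at v, add an arrow u → w for each path u → v → w, and
-- cancel oriented 2-cycles.
mutateArrows : Fin n → (Fin n → Fin n → ℕ) → (Fin n → Fin n → ℕ)
mutateArrows v q u w =
  if does (u Finₚ.≟ v) ∨ does (w Finₚ.≟ v)
  then q w u
  else (q u w ℕ.+ q u v ℕ.* q v w) ∸ (q w u ℕ.+ q w v ℕ.* q v u)

mutate : Fin n → PSeed n k m → PSeed n k m
mutate v s = record
  { arrows = mutateArrows v (arrows s)
  ; weight = updateAt (weight s) v λ λ₁ p i →
      ℤ.- λ₁ p i ℤ.+ sum (λ u → + arrows s u v ℤ.* weight s u p i)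
  }

-- The P-cluster at a puncture; multisets are families indexed by the vertices.
π[_] : Fin m → PSeed n k m → Fin n → P k
π[ p ] s v = weight s v p

------------------------------------------------------------------------
-- The initial P-seeds

-- All pairs, respectively triples, of naturals with sum d.
pairs : ℕ → List (ℕ × ℕ)
pairs d = map (λ a → a , d ∸ a) (upTo (suc d))

triples : ℕ → List (ℕ × ℕ × ℕ)
triples d = concatMap (λ (a , r) → map (a ,_) (pairs r)) (pairs d)

positivePairs : ℕ → List (ℕ × ℕ)
positivePairs (suc (suc d)) = map (λ (x , y) → suc x , suc y) (pairs d)
positivePairs _ = []

positiveTriples : ℕ → List (ℕ × ℕ × ℕ)
positiveTriples (suc (suc (suc d))) = map (λ (a , b , c) → suc a , suc b , suc c) (triples d)
positiveTriples _ = []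

module _ (Δ : Triangulation) where

  -- inner t a b c has coordinates a, b, c at the corners 0, 1, 2 of t.
  -- onArc e x y has coordinate x at the source and y at the target of e, and
  -- onBoundary t i x y likewise for the boundary interval which is side i of t.
  -- base t is the frozen vertex M on the boundary interval of t.
  data Vertex : Set where
    inner      : Fin (triangles Δ) → ℕ → ℕ → ℕ → Vertex
    onArc      : Fin (arcs Δ) → ℕ → ℕ → Vertex
    onBoundary : Fin (triangles Δ) → Fin 3 → ℕ → ℕ → Vertex
    base       : Fin (triangles Δ) → Vertex

  infix 4 _≟_
  _≟_ : DecidableEquality Vertex
  inner t a b c ≟ inner t′ a′ b′ c′ =
    map′ (λ { (refl , refl , refl , refl) → refl }) (λ { refl → refl , refl , refl , refl })
      (t Finₚ.≟ t′ ×-dec a ℕₚ.≟ a′ ×-dec b ℕₚ.≟ b′ ×-dec c ℕₚ.≟ c′)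
  onArc e x y ≟ onArc e′ x′ y′ =
    map′ (λ { (refl , refl , refl) → refl }) (λ { refl → refl , refl , refl })
      (e Finₚ.≟ e′ ×-dec x ℕₚ.≟ x′ ×-dec y ℕₚ.≟ y′)
  onBoundary t i x y ≟ onBoundary t′ i′ x′ y′ =
    map′ (λ { (refl , refl , refl , refl) → refl }) (λ { refl → refl , refl , refl , refl })
      (t Finₚ.≟ t′ ×-dec i Finₚ.≟ i′ ×-dec x ℕₚ.≟ x′ ×-dec y ℕₚ.≟ y′)
  base t ≟ base t′ = map′ (λ { refl → refl }) (λ { refl → refl }) (t Finₚ.≟ t′)
  inner _ _ _ _ ≟ onArc _ _ _ = no λ ()
  inner _ _ _ _ ≟ onBoundary _ _ _ _ = no λ ()
  inner _ _ _ _ ≟ base _ = no λ ()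
  onArc _ _ _ ≟ inner _ _ _ _ = no λ ()
  onArc _ _ _ ≟ onBoundary _ _ _ _ = no λ ()
  onArc _ _ _ ≟ base _ = no λ ()
  onBoundary _ _ _ _ ≟ inner _ _ _ _ = no λ ()
  onBoundary _ _ _ _ ≟ onArc _ _ _ = no λ ()
  onBoundary _ _ _ _ ≟ base _ = no λ ()
  base _ ≟ inner _ _ _ _ = no λ ()
  base _ ≟ onArc _ _ _ = no λ ()
  base _ ≟ onBoundary _ _ _ _ = no λ ()

  -- The vertex of side i of t with coordinate x at corner i and y at corner
  -- next i, as a vertex of the glued quiver.
  onSide : Fin (triangles Δ) → Fin 3 → ℕ → ℕ → Vertex
  onSide t i x y with side Δ t i
  ... | just (e , true)  = onArc e x y
  ... | just (e , false) = onArc e y x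
  ... | nothing          = onBoundary t i x y

  -- The vertex (a , b , c) of the triangle t, not one of its corners.
  place : Fin (triangles Δ) → ℕ × ℕ × ℕ → Vertex
  place t (a , b , zero)              = onSide t 0F a b
  place t (zero , b , c@(suc _))      = onSide t 1F b c
  place t (a@(suc _) , zero , c@(suc _)) = onSide t 2F c a
  place t (a@(suc _) , b@(suc _) , c@(suc _)) = inner t a b c

  module _ (k : ℕ) where

    Arrow : Set
    Arrow = Vertex × Vertex

    -- The arrows of Qₖ, placed in t.
    Q : Fin (triangles Δ) → List Arrow
    Q t = concatMap small (triples (k ∸ 2))
      where
      small : ℕ × ℕ × ℕ → List Arrow
      small (i , j , l) =
        let x = place t (suc i , suc j , l)
            y = place t (suc i , j , suc l)
            z = place t (i , suc j , suc l)
        in (x , y) ∷ (y , z) ∷ (z , x) ∷ []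

    -- The arrows of Qₖ¹, placed in t with side i at the bottom: clockwise, the
    -- sides are i, next i (the left one) and next (next i) (the right one), and
    -- the top corner is next (next i).
    Q¹ : Fin (triangles Δ) → Fin 3 → List Arrow
    Q¹ t i =
      map (λ (a , _) → R a , L a) (positivePairs k) ++
      concatMap (λ (a , _) → (L (suc a) , R a) ∷ (R a , R (suc a)) ∷ []) (positivePairs (k ∸ 1)) ++
      (L 1 , base t) ∷ (base t , R 1) ∷ []
      where
      L R : ℕ → Vertex
      L a = onSide t (next i) (k ∸ a) a
      R a = onSide t (next (next i)) a (k ∸ a)

    bottomSide : Fin (triangles Δ) → Maybe (Fin 3)
    bottomSide t = findᵇ (is-nothing ∘ side Δ t) (allFin 3)

    piece : ModuliSpace → Fin (triangles Δ) → List Arrow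
    piece 𝒜 t = Q t
    piece 𝒜′ t with bottomSide t
    ... | nothing = Q t
    ... | just i  = Q¹ t i

    innerVertices : ModuliSpace → Fin (triangles Δ) → List Vertex
    innerVertices M t = filling M (bottomSide t)
      where
      filling : ModuliSpace → Maybe (Fin 3) → List Vertex
      filling 𝒜′ (just _) = []
      filling _  _        = map (λ (a , b , c) → inner t a b c) (positiveTriples k)

    mutableVertices : ModuliSpace → List Vertex
    mutableVertices M =
      concatMap (innerVertices M) (allFin (triangles Δ)) ++
      concatMap (λ e → map (λ (x , y) → onArc e x y) (positivePairs k)) (allFin (arcs Δ))

    allArrows : ModuliSpace → List Arrow
    allArrows M = concatMap (piece M) (allFin (triangles Δ))

    multiplicity : ModuliSpace → Vertex → Vertex → ℕ
    multiplicity M u v = length (filter (λ f → ≡-dec _≟_ _≟_ f (u , v)) (allArrows M))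

    at : MarkedPoint Δ → ℕ → (Fin (punctures Δ) → P k)
    at (inj₁ q) a p = if does (q Finₚ.≟ p) then ω a else 𝟎
    at (inj₂ _) a p = 𝟎

    vertexWeight : Vertex → (Fin (punctures Δ) → P k)
    vertexWeight (inner t a b c) p =
      at (corner Δ (t , 0F)) a p ⊕ at (corner Δ (t , 1F)) b p ⊕ at (corner Δ (t , 2F)) c p
    vertexWeight (onArc e x y) p =
      let (t , i) = sideOf Δ e true
      in at (corner Δ (t , i)) x p ⊕ at (corner Δ (t , next i)) y p
    vertexWeight (onBoundary t i x y) p =
      at (corner Δ (t , i)) x p ⊕ at (corner Δ (t , next i)) y p
    vertexWeight (base t) p = 𝟎

    initialPSeed : (M : ModuliSpace) → PSeed (length (mutableVertices M)) k (punctures Δ)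
    initialPSeed M = record
      { arrows = λ u v → multiplicity M (vertex u) (vertex v) ∸ multiplicity M (vertex v) (vertex u)
      ; weight = λ v → vertexWeight (vertex v)
      }
      where
      vertex : Fin (length (mutableVertices M)) → Vertex
      vertex = lookup (mutableVertices M)

------------------------------------------------------------------------
-- Compatibility and the good part of the exchange graph

WSortable : P k → P k → Set
WSortable {k} λ₁ μ = ∃ λ (w : Permutation′ k) → ∀ {i j} → i Fin.≤ j →
  λ₁ (w ⟨$⟩ʳ i) ℤ.≥ λ₁ (w ⟨$⟩ʳ j) × μ (w ⟨$⟩ʳ i) ℤ.≥ μ (w ⟨$⟩ʳ j)

RootConjugate : P k → P k → Set
RootConjugate λ₁ μ = ∃₂ λ a b → a ≢ b ×
  (λ₁ ⊖ μ ≈ basis a ⊖ basis b) × (μ ≈ λ₁ ∘ transpose a b)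

Compatible : P k → P k → Set
Compatible λ₁ μ = WSortable λ₁ μ ⊎ RootConjugate λ₁ μ

PairwiseCompatible : (Fin n → P k) → Set
PairwiseCompatible C = ∀ {u v} → u ≢ v → Compatible (C u) (C v)

Basic : (Fin n → P k) → Set
Basic C = ∀ {u v w} → RootConjugate (C u) (C v) → C u ≈ C w → u ≡ w

Good : PSeed n k m → Set
Good s = ∀ p → PairwiseCompatible (π[ p ] s) × Basic (π[ p ] s)

-- The good seeds joined to the initial seed by a path of good seeds in the
-- exchange graph, each represented by its underlying P-seed; s₀ is the P-seed of
-- the initial seed.
data _∈𝔼-good[_] : PSeed n k m → PSeed n k m → Set where
  initial : {s₀ : PSeed n k m} → Good s₀ → s₀ ∈𝔼-good[ s₀ ]
  step    : {s s₀ : PSeed n k m} → s ∈𝔼-good[ s₀ ] → ∀ v → Good (mutate v s) →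
            mutate v s ∈𝔼-good[ s₀ ]

MutationAdjacent : PSeed n k m → PSeed n k m → PSeed n k m → Set
MutationAdjacent s₀ s s′ = s ∈𝔼-good[ s₀ ] × s′ ∈𝔼-good[ s₀ ] × ∃ λ v → s′ ≡ mutate v s

------------------------------------------------------------------------
-- Ordered set partitions

Blocks : ℕ → Set
Blocks k = List (Subset k)

record IsOSP (Π : Blocks k) : Set where
  field
    blocks-nonempty : All Nonempty Π
    blocks-disjoint : AllPairs (λ B B′ → Empty (B ∩ B′)) Π
    blocks-cover    : ∀ a → Any (a ∈_) Π

SameBlock Earlier : Blocks k → Fin k → Fin k → Set
SameBlock Π a b = ∃ λ x → a ∈ lookup Π x × b ∈ lookup Π x
Earlier   Π a b = ∃₂ λ x y → x Fin.< y × a ∈ lookup Π x × b ∈ lookup Π y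

-- Π = Π(λ)
record IsOSPOf (λ₁ : P k) (Π : Blocks k) : Set where
  field
    isOSP     : IsOSP Π
    sameBlock : ∀ a b → SameBlock Π a b ⇔ (λ₁ a ≡ λ₁ b)
    earlier   : ∀ a b → Earlier Π a b ⇔ (λ₁ a ℤ.> λ₁ b)

-- Merging runs of consecutive blocks of Π gives the sequence Π′.
Refines : Blocks k → Blocks k → Set
Refines Π Π′ = ∃ λ runs → concat runs ≡ Π × map ⋃ runs ≡ Π′

record IsJoin (F : Blocks k → Set) (Π : Blocks k) : Set where
  field
    isOSP : IsOSP Π
    upper : ∀ {Σ} → F Σ → Refines Π Σ
    least : ∀ {Π′} → IsOSP Π′ → (∀ {Σ} → F Σ → Refines Π′ Σ) → Refines Π′ Π

------------------------------------------------------------------------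
-- Root-conjugacy classes

module _ (C : Fin n → P k) where

  -- A class is a set of indices, so that equal vectors which are not
  -- root-conjugate to any other vector lie in different classes.
  IsClass : Subset n → Set
  IsClass O = Nonempty O ×
    (∀ {u v} → u ∈ O → (v ∈ O) ⇔ EqClosure (λ u v → RootConjugate (C u) (C v)) u v)

  classSum : Subset n → P k
  classSum O i = sum (λ v → if does (v ∈? O) then C v i else 0ℤ)

  -- Π = Π(C)
  IsOSPOfCluster : Blocks k → Set
  IsOSPOfCluster = IsJoin (λ Σ → ∃ λ O → IsClass O × IsOSPOf (classSum O) Σ)

  IsGroundSet : Subset n → Subset k → Set
  IsGroundSet O B = ∀ a → (a ∈ B) ⇔
    (∃₂ λ u v → u ∈ O × v ∈ O × ∃ λ b → a ≢ b × (C u ⊖ C v ≈ basis a ⊖ basis b))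

  signed : Sign → P k → P k
  signed Sign.+ λ₁ = λ₁
  signed Sign.- λ₁ = 𝟎 ⊖ λ₁

  -- O = { ν + ε e_a : a ∈ B } for some ν with constant B-coordinates.
  HasSign : Subset n → Subset k → Sign → Set
  HasSign O B ε = ∃ λ ν →
    (∀ {a b} → a ∈ B → b ∈ B → ν a ≡ ν b) ×
    (∀ {v} → v ∈ O → ∃ λ a → a ∈ B × (C v ≈ ν ⊕ signed ε (basis a))) ×
    (∀ {a} → a ∈ B → ∃ λ v → v ∈ O × (C v ≈ ν ⊕ signed ε (basis a)))

------------------------------------------------------------------------
-- Decorated ordered set partitions

Dosp : ℕ → Set
Dosp k = List (Subset k × Maybe Sign)

data Decorated (C : Fin n → P k) : Subset k × Maybe Sign → Set where
  small : ∀ {B} → ∣ B ∣ ℕ.≤ 2 → Decorated C (B , nothing)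
  large : ∀ {B ε} O → 3 ℕ.≤ ∣ B ∣ → IsClass C O → IsGroundSet C O B → HasSign C O B ε →
          Decorated C (B , just ε)

-- D = (Π(C) , ε(C)), where a sign is recorded exactly for the blocks with at
-- least three elements. For a basic family C of pairwise compatible vectors there
-- is at most one such D: joins are unique, distinct classes have disjoint ground
-- sets, and the sign of a class of size at least three is unique.
record IsDospOf (C : Fin n → P k) (D : Dosp k) : Set where
  field
    partition : IsOSPOfCluster C (map proj₁ D)
    signs     : All (Decorated C) D

-- The block B with sign ε, omitted if empty, with the sign forgotten if
-- B has at most two elements.
block : Subset k → Sign → Dosp k
block B ε with ∣ B ∣
... | 0 = []
... | 1 = (B , nothing) ∷ []
... | 2 = (B , nothing) ∷ []
... | suc (suc (suc _)) = (B , just ε) ∷ []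

data Move {k} : Dosp k → Dosp k → Set where
  move : ∀ Φ Ψ {L R a} → a ∉ L → a ∉ R → Empty (L ∩ R) →
         Move (Φ ++ (block (L ∪ ⁅ a ⁆) Sign.+ ++ block R Sign.-) ++ Ψ)
              (Φ ++ (block L Sign.+ ++ block (⁅ a ⁆ ∪ R) Sign.-) ++ Ψ)

DospMutation : Dosp k → Dosp k → Set
DospMutation D D′ = Move D D′ ⊎ Move D′ D

{-# OPTIONS --safe #-}
module Submission where

-- If two vectors of a compatible family disagree on the order of coordinates a
-- and b, they are root-conjugate through a and b, and as the family is basic all
-- its other vectors agree on a and b. If moreover any two coordinates are told
-- apart by some vector, then Π(C) is the osp of the sum of the whole family, the
-- blocks of size at least two being the ground sets of the nontrivial classes.
--
-- For a mutation at v, both osps are compared with that of the sum of the vectors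
-- other than v, which refines them. Two of its blocks, say the ones of a and b,
-- are merged in Π(C) only if v is root-conjugate to another vector w through a
-- and b. Then balance at v leaves no arrow between v and w, so the mutation
-- reverses the order of a and b at v and the blocks are not merged in Π(C′).
-- Balance at the other vertices shows that merged pairs of C and of C′ share a
-- coordinate, unless v and w are isolated in the quiver. But isolated vertices are
-- isolated in the initial quiver too, where too many vertices tell coordinates
-- apart: every puncture is the end of two different sides of a triangle.

open import Defs
import Data.Integer.Properties as ℤₚ
open import Algebra.Properties.CommutativeMonoid.Sum ℤₚ.+-0-commutativeMonoid
  using (sum; sum-cong-≗; sum-remove; sum-replicate-zero; ∑-distrib-+; ∑-comm)
open import Algebra.Properties.Semiring.Sum ℤₚ.+-*-semiring using (*-distribˡ-sum; *-distribʳ-sum)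
open import Data.Bool using (Bool; true; false; if_then_else_)
open import Data.Empty using (⊥; ⊥-elim)
open import Data.Fin as Fin using (Fin; toℕ; punchIn; punchOut)
open import Data.Fin.Patterns using (0F; 1F; 2F)
open import Data.Fin.Permutation using (_⟨$⟩ˡ_; inverseʳ)
open import Data.Fin.Permutation.Components using (transpose)
import Data.Fin.Properties as Finₚ
open import Data.Fin.Subset as Subset
  using (Subset; _∈_; _∉_; _⊆_; _∪_; _∩_; ⁅_⁆; ∣_∣; ⋃; Nonempty; Empty)
open import Data.Fin.Subset.Properties
  using (_∈?_; _⊆?_; nonempty?; ⊆-antisym; ∉⊥; ∣⊥∣≡0; x∈⁅x⁆; x∈⁅y⁆⇒x≡y; ∣⁅x⁆∣≡1; p⊆q⇒∣p∣≤∣q∣;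
         x∈p∪q⁻; p⊆p∪q; q⊆p∪q; ∪-identityˡ; ∪-identityʳ; x∈p∩q⁻)
open import Data.Integer as ℤ
  using (ℤ; 0ℤ; 1ℤ; -1ℤ; _+_; _-_; -_; _*_; _<_; _≤_; +≤+; +<+; -<+)
open import Data.Integer.Tactic.RingSolver using (solve-∀)
open import Data.List
  using (List; []; _∷_; _++_; map; concat; concatMap; filter; length; lookup; tabulate; upTo;
         applyDownFrom; allFin; initLast; _∷ʳ′_)
import Data.List.Membership.Propositional as List
import Data.List.Membership.Propositional.Properties as Listₘ
import Data.List.Properties as Listₚ
open import Data.List.Relation.Unary.All as All using (All; []; _∷_)
import Data.List.Relation.Unary.All.Properties as Allₚ
open import Data.List.Relation.Unary.AllPairs as AllPairs using (AllPairs; []; _∷_)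
import Data.List.Relation.Unary.AllPairs.Properties as AllPairsₚ
open import Data.List.Relation.Unary.Any as Any using (Any; here; there)
import Data.List.Relation.Unary.Any.Properties as Anyₚ
import Data.List.Relation.Unary.Unique.Propositional.Properties as Uniqueₚ
open import Data.Maybe using (Maybe; just; nothing)
open import Data.Nat as ℕ using (ℕ; zero; suc; s≤s; z≤n; _∸_)
import Data.Nat.Properties as ℕₚ
open import Data.Product using (∃; ∃₂; _×_; _,_; proj₁; proj₂)
open import Data.Product.Properties using (≡-dec; ,-injectiveʳ)
open import Data.Sign using (Sign)
open import Data.Sum using (_⊎_; inj₁; inj₂)
open import Data.Vec as Vec using ([]; _∷_)
open import Data.Vec.Functional.Properties using (updateAt-updates; updateAt-minimal)
import Data.Vec.Properties as Vecₚ
open import Function using (_∘_; _⇔_; mk⇔; Equivalence)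
open import Relation.Binary.Construct.Closure.Equivalence as EqClosure using (EqClosure)
open import Relation.Binary.Construct.Closure.ReflexiveTransitive as Star using (_◅_)
open import Relation.Binary.Construct.Closure.Symmetric using (fwd; bwd)
open import Relation.Binary.Definitions using (tri<; tri≈; tri>)
open import Relation.Binary.PropositionalEquality
open import Relation.Nullary using (Dec; does; yes; no; ¬_; contradiction; map′; _×-dec_; _⊎-dec_; _→-dec_; ¬?)
open import Relation.Nullary.Decidable using (dec-true; dec-false; decidable-stable)
open import Relation.Unary using (Decidable)

-- The signs in a dosp mutation come from the vector at the mutated vertex. Suppose, up to
-- exchanging the two families, that C merges a with L and that C′ merges a with R. On L ∪ {a} ∪ R
-- this vector is constant except for an excess of 1 at a in C and a deficit of 1 at a in C′. So it
-- has the form ν + e_a in the class of L ∪ {a} and ν - e_a in the class of {a} ∪ R. The signs of L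
-- and R are witnessed by vectors that both families share. The obstacle is nondegeneracy, which is
-- not propagated forward from the initial seed. Instead, a pair of coordinates that is equal
-- outside a set of isolated vertices stays so when mutations are run backwards, so a failure would
-- be visible initially. The exceptional set has at most one vertex for a pair not separated by the
-- vectors other than v, and two vertices for disjoint merged pairs. Two vertices per level exceed
-- the former, and those of two levels the latter. P-seeds do not carry the balance condition.
-- Initially it follows from summation by parts in each triangle, which leaves only terms on the
-- sides; these cancel across arcs.

private
  variable
    k m n d : ℕ
    a b c : Fin k
    λ₁ μ : P k
    A B : Set

-- Differences of coordinates and root-conjugacy

-- Vectors of P are given by representatives up to a constant; differences of coordinates are
-- exactly what does not depend on the choice, so the arguments below are phrased with them.
diff : P k → Fin k → Fin k → ℤ
diff λ₁ a b = λ₁ a - λ₁ b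

diff-self : (λ₁ : P k) → ∀ a → diff λ₁ a a ≡ 0ℤ
diff-self λ₁ a = ℤₚ.+-inverseʳ (λ₁ a)

diff-flip : (λ₁ : P k) → ∀ a b → diff λ₁ b a ≡ - diff λ₁ a b
diff-flip λ₁ a b = lemma (λ₁ a) (λ₁ b)
  where
  lemma : ∀ i j → j - i ≡ - (i - j)
  lemma = solve-∀

diff-split : (λ₁ : P k) → ∀ a b c → diff λ₁ a c ≡ diff λ₁ a b + diff λ₁ b c
diff-split λ₁ a b c = lemma (λ₁ a) (λ₁ b) (λ₁ c)
  where
  lemma : ∀ i j l → i - l ≡ (i - j) + (j - l)
  lemma = solve-∀

diff-from : (λ₁ : P k) → ∀ a b c → diff λ₁ b c ≡ diff λ₁ a c - diff λ₁ a b
diff-from λ₁ a b c = lemma (λ₁ a) (λ₁ b) (λ₁ c)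
  where
  lemma : ∀ i j l → j - l ≡ (i - l) - (i - j)
  lemma = solve-∀

diff-⊕ : (λ₁ μ : P k) → ∀ a b → diff (λ₁ ⊕ μ) a b ≡ diff λ₁ a b + diff μ a b
diff-⊕ λ₁ μ a b = lemma (λ₁ a) (λ₁ b) (μ a) (μ b)
  where
  lemma : ∀ i j l m → (i + l) - (j + m) ≡ (i - j) + (l - m)
  lemma = solve-∀

diff-⊖ : (λ₁ μ : P k) → ∀ a b → diff (λ₁ ⊖ μ) a b ≡ diff λ₁ a b - diff μ a b
diff-⊖ λ₁ μ a b = lemma (λ₁ a) (λ₁ b) (μ a) (μ b)
  where
  lemma : ∀ i j l m → (i - l) - (j - m) ≡ (i - j) - (l - m)
  lemma = solve-∀

≈⇒diff≡ : (λ₁ μ : P k) → λ₁ ≈ μ → ∀ a b → diff λ₁ a b ≡ diff μ a b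
≈⇒diff≡ λ₁ μ (c , eq) a b rewrite eq a | eq b = lemma (μ a) (μ b) c
  where
  lemma : ∀ i j l → (i + l) - (j + l) ≡ i - j
  lemma = solve-∀

diff≡⇒≈ : (λ₁ μ : P k) → ∀ a → (∀ x → diff λ₁ x a ≡ diff μ x a) → λ₁ ≈ μ
diff≡⇒≈ λ₁ μ a eq = λ₁ a - μ a , λ x →
  trans (lemma₁ (λ₁ x) (λ₁ a)) (trans (cong (_+ λ₁ a) (eq x)) (lemma₂ (μ x) (μ a) (λ₁ a)))
  where
  lemma₁ : ∀ i j → i ≡ (i - j) + j
  lemma₁ = solve-∀
  lemma₂ : ∀ i j l → (i - j) + l ≡ i + (l - j)
  lemma₂ = solve-∀

basis-≡ : (a : Fin k) → basis a a ≡ 1ℤ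
basis-≡ a with a Finₚ.≟ a
... | yes _  = refl
... | no a≢a = contradiction refl a≢a

basis-≢ : a ≢ b → basis a b ≡ 0ℤ
basis-≢ {a = a} {b = b} a≢b with a Finₚ.≟ b
... | yes a≡b = contradiction a≡b a≢b
... | no _    = refl

root : Fin k → Fin k → P k
root a b = basis a ⊖ basis b

transpose-left : (a b : Fin k) → transpose a b a ≡ b
transpose-left a b with a Finₚ.≟ a
... | yes _  = refl
... | no a≢a = contradiction refl a≢a

transpose-right : (a b : Fin k) → transpose a b b ≡ a
transpose-right a b with b Finₚ.≟ a
... | yes b≡a = b≡a
... | no _ with b Finₚ.≟ b
...   | yes _  = refl
...   | no b≢b = contradiction refl b≢b

root-left : a ≢ b → root a b a ≡ 1ℤ
root-left {a = a} a≢b = cong₂ _-_ (basis-≡ a) (basis-≢ (a≢b ∘ sym))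

root-right : a ≢ b → root a b b ≡ -1ℤ
root-right {b = b} a≢b = cong₂ _-_ (basis-≢ a≢b) (basis-≡ b)

root-other : c ≢ a → c ≢ b → root a b c ≡ 0ℤ
root-other c≢a c≢b = cong₂ _-_ (basis-≢ (c≢a ∘ sym)) (basis-≢ (c≢b ∘ sym))

-- Root-conjugacy of λ₁ and μ through the coordinates a and b, expressed by
-- differences of coordinates and thus independently of the representatives.
record Root (λ₁ μ : P k) (a b : Fin k) : Set where
  constructor mkRoot
  field
    up    : diff λ₁ a b ≡ 1ℤ
    shift : ∀ x y → diff λ₁ x y ≡ diff μ x y + diff (root a b) x y

  a≢b : a ≢ b
  a≢b refl = contradiction (trans (sym up) (diff-self λ₁ a)) λ ()

  down : diff μ a b ≡ -1ℤ
  down = trans (cancel (diff μ a b) (diff (root a b) a b))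
    (cong₂ _-_ (trans (sym (shift a b)) up) (cong₂ _-_ (root-left a≢b) (root-right a≢b)))
    where
    cancel : ∀ i j → i ≡ i + j - j
    cancel = solve-∀

open Root using (up; shift; down) public

root-shift : Root λ₁ μ a b → ∀ x y → diff (root a b) x y ≡ diff λ₁ x y - diff μ x y
root-shift {λ₁ = λ₁} {μ = μ} {a = a} {b = b} r x y =
  trans (cancel (diff μ x y) (diff (root a b) x y)) (cong (_- diff μ x y) (sym (shift r x y)))
  where
  cancel : ∀ i j → j ≡ (i + j) - i
  cancel = solve-∀

Root-difference : Root λ₁ μ a b → λ₁ ⊖ μ ≈ root a b
Root-difference {λ₁ = λ₁} {μ = μ} {a = a} {b = b} r = diff≡⇒≈ (λ₁ ⊖ μ) (root a b) a λ x →
  trans (diff-⊖ λ₁ μ x a) (sym (root-shift r x a))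

root-flip : (a b x y : Fin k) → diff (root b a) x y ≡ - diff (root a b) x y
root-flip a b x y = lemma (basis a x) (basis b x) (basis a y) (basis b y)
  where
  lemma : ∀ i j l m → (j - i) - (m - l) ≡ - ((i - j) - (l - m))
  lemma = solve-∀

Root-sym : Root λ₁ μ a b → Root μ λ₁ b a
Root-sym {λ₁ = λ₁} {μ = μ} {a = a} {b = b} r = mkRoot
  (trans (diff-flip μ a b) (cong -_ (down r)))
  λ x y → trans (lemma (diff μ x y) (diff (root a b) x y))
    (cong₂ _+_ (sym (shift r x y)) (sym (root-flip a b x y)))
  where
  lemma : ∀ i j → i ≡ (i + j) + - j
  lemma = solve-∀

Root⇒RootConjugate : Root λ₁ μ a b → RootConjugate λ₁ μ
Root⇒RootConjugate {λ₁ = λ₁} {μ = μ} {a = a} {b = b} r =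
  -- The constant compares coordinate `a` of `μ` with coordinate `b` of `λ₁`, to which the
  -- transposition sends it.
  a , b , Root.a≢b r , Root-difference r , (μ a - λ₁ b , swapped)
  where
  a≢b = Root.a≢b r
  lemma₂ : ∀ i j → i ≡ j + (i - j)
  lemma₂ = solve-∀
  lemma₃ : ∀ p q i j → p ≡ q + (i - j) + ((p - i) - (q - j))
  lemma₃ = solve-∀
  lemma₄ : ∀ i j → i + j - j ≡ i
  lemma₄ = solve-∀
  translate : ∀ x y → diff μ x a ≡ diff λ₁ y b → μ x ≡ λ₁ y + (μ a - λ₁ b)
  translate x y eq = trans (lemma₃ (μ x) (λ₁ y) (μ a) (λ₁ b))
    (trans (cong (λ z → λ₁ y + (μ a - λ₁ b) + z) (ℤₚ.i≡j⇒i-j≡0 eq)) (ℤₚ.+-identityʳ _))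
  swapped : ∀ x → μ x ≡ λ₁ (transpose a b x) + (μ a - λ₁ b)
  swapped x with x Finₚ.≟ a
  ... | yes refl = lemma₂ (μ x) (λ₁ b)
  ... | no x≢a with x Finₚ.≟ b
  ...   | yes refl = translate x a (trans (diff-flip μ a x) (trans (cong -_ (down r)) (sym (up r))))
  ...   | no x≢b = translate x x (begin
    diff μ x a                             ≡⟨ lemma₄ (diff μ x a) -1ℤ ⟨
    diff μ x a + -1ℤ + 1ℤ
      ≡⟨ cong (λ z → diff μ x a + z + 1ℤ) (cong₂ _-_ (root-other x≢a x≢b) (root-left a≢b)) ⟨
    diff μ x a + diff (root a b) x a + 1ℤ  ≡⟨ cong₂ _+_ (sym (shift r x a)) (sym (up r)) ⟩
    diff λ₁ x a + diff λ₁ a b              ≡⟨ diff-split λ₁ x a b ⟨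
    diff λ₁ x b                            ∎)
    where open ≡-Reasoning

-- The swap negates the difference at `a`, `b`, while subtracting the root lowers it by 2. So this
-- difference x satisfies x = -x + 2, which is `up`.
RootConjugate⇒Root : RootConjugate λ₁ μ → ∃₂ (Root λ₁ μ)
RootConjugate⇒Root {λ₁ = λ₁} {μ = μ} (a , b , a≢b , difference , swapped) = a , b , mkRoot
  (half (diff λ₁ a b) (trans (shift′ a b) (cong₂ _+_ flipped (cong₂ _-_ (root-left a≢b) (root-right a≢b)))))
  shift′
  where
  lemma : ∀ i j → i ≡ j + (i - j)
  lemma = solve-∀
  shift′ : ∀ x y → diff λ₁ x y ≡ diff μ x y + diff (root a b) x y
  shift′ x y = trans (lemma (diff λ₁ x y) (diff μ x y))
    (cong (λ z → diff μ x y + z) (trans (sym (diff-⊖ λ₁ μ x y)) (≈⇒diff≡ (λ₁ ⊖ μ) (root a b) difference x y)))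
  flipped : diff μ a b ≡ - diff λ₁ a b
  flipped = trans (≈⇒diff≡ μ (λ₁ ∘ transpose a b) swapped a b)
    (trans (cong₂ (diff λ₁) (transpose-left a b) (transpose-right a b)) (diff-flip λ₁ a b))
  double : ∀ i → i + i ≡ ℤ.+ 2 * i
  double = solve-∀
  half : ∀ i → i ≡ - i + ℤ.+ 2 → i ≡ 1ℤ
  half i eq = ℤₚ.*-cancelˡ-≡ (ℤ.+ 2) i 1ℤ (trans (sym (double i)) (trans (cong (λ z → i + z) eq) (cancel i)))
    where
    cancel : ∀ i → i + (- i + ℤ.+ 2) ≡ ℤ.+ 2
    cancel = solve-∀

-- The entries of a root lie between -1 and 1, so a difference of 2 needs the entry 1 at `a` and -1
-- at `b`. The clauses run through the possible coincidences of the four indices.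
root-difference≥2 : (a b c d : Fin k) → ℤ.+ 2 ≤ diff (root c d) a b → c ≡ a × d ≡ b
root-difference≥2 a b c d 2≤ with c Finₚ.≟ a | d Finₚ.≟ a | c Finₚ.≟ b | d Finₚ.≟ b
root-difference≥2 a b c d 2≤                 | yes p | _     | _     | yes q = p , q
root-difference≥2 a b c d ()                 | yes _ | yes _ | yes _ | no _
root-difference≥2 a b c d (+≤+ ())           | yes _ | yes _ | no _  | no _
root-difference≥2 a b c d (+≤+ ())           | yes _ | no _  | yes _ | no _
root-difference≥2 a b c d (+≤+ (s≤s ()))     | yes _ | no _  | no _  | no _
root-difference≥2 a b c d ()                 | no _  | yes _ | yes _ | yes _
root-difference≥2 a b c d ()                 | no _  | yes _ | yes _ | no _
root-difference≥2 a b c d (+≤+ ())           | no _  | yes _ | no _  | yes _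
root-difference≥2 a b c d ()                 | no _  | yes _ | no _  | no _
root-difference≥2 a b c d (+≤+ ())           | no _  | no _  | yes _ | yes _
root-difference≥2 a b c d ()                 | no _  | no _  | yes _ | no _
root-difference≥2 a b c d (+≤+ (s≤s ()))     | no _  | no _  | no _  | yes _
root-difference≥2 a b c d (+≤+ ())           | no _  | no _  | no _  | no _

root-difference-large : ∀ {i j} (a b c d : Fin k) → 0ℤ < i → j < 0ℤ →
  i ≡ j + diff (root c d) a b → c ≡ a × d ≡ b
root-difference-large {i = i} {j} a b c d 0<i j<0 eq =
  root-difference≥2 a b c d (subst (ℤ.+ 2 ≤_) (trans (cong (_- j) eq) (cancel j (diff (root c d) a b))) 2≤i-j)
  where
  cancel : ∀ i j → i + j - i ≡ j
  cancel = solve-∀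
  2≤i-j : ℤ.+ 2 ≤ i - j
  2≤i-j = ℤₚ.+-mono-≤ (ℤₚ.i<j⇒suc[i]≤j 0<i) (ℤₚ.i<j⇒suc[i]≤j (ℤₚ.neg-mono-< j<0))

-- W-sortable vectors never disagree strictly, so only root-conjugacy remains. Passing from a
-- negative to a positive integer costs at least 2, which determines the root.
disagree⇒Root′ : Compatible λ₁ μ → ∀ a b → 0ℤ < diff λ₁ a b → diff μ a b < 0ℤ → Root λ₁ μ a b
disagree⇒Root′ {λ₁ = λ₁} {μ = μ} (inj₂ rc) a b 0<d d<0 with RootConjugate⇒Root rc
... | c , d , r with root-difference-large a b c d 0<d d<0 (shift r a b)
...   | refl , refl = r
disagree⇒Root′ {λ₁ = λ₁} {μ = μ} (inj₁ (w , sorted)) a b 0<d d<0 with Finₚ.≤-total (w ⟨$⟩ˡ a) (w ⟨$⟩ˡ b)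
... | inj₁ i≤j with sorted i≤j
...   | _ , μb≤μa rewrite inverseʳ w {a} | inverseʳ w {b} =
  contradiction (ℤₚ.i≤j⇒0≤j-i μb≤μa) (ℤₚ.<⇒≱ d<0)
disagree⇒Root′ {λ₁ = λ₁} {μ = μ} (inj₁ (w , sorted)) a b 0<d d<0 | inj₂ j≤i with sorted j≤i
...   | λa≤λb , _ rewrite inverseʳ w {a} | inverseʳ w {b} =
  contradiction (ℤₚ.i≤j⇒i-j≤0 λa≤λb) (ℤₚ.<⇒≱ 0<d)

-- Tidy families: what compatibility and basicness give

-- Good families enter the later arguments only through these two fields. The second is multiplicity
-- one, with equality in P expressed by differences.
record Tidy (C : Fin n → P k) : Set where
  field
    disagree⇒Root : ∀ u w a b → 0ℤ < diff (C u) a b → diff (C w) a b < 0ℤ → Root (C u) (C w) a b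
    unique : ∀ {u w x a b} → Root (C u) (C w) a b →
      (∀ i j → diff (C u) i j ≡ diff (C x) i j) → u ≡ x

  -- If `x` had a nonzero difference at `a`, `b`, it would be root-conjugate to `w` or to `u`
  -- through the same root. It would then equal the other of these two in P, against multiplicity
  -- one.
  others-vanish : ∀ {u w x a b} → Root (C u) (C w) a b → x ≢ u → x ≢ w → diff (C x) a b ≡ 0ℤ
  others-vanish {u} {w} {x} {a} {b} r x≢u x≢w with ℤₚ.<-cmp 0ℤ (diff (C x) a b)
  ... | tri≈ _ 0≡d _ = sym 0≡d
  ... | tri< 0<d _ _ = contradiction (sym (unique r λ i j →
    trans (shift r i j) (sym (shift (disagree⇒Root x w a b 0<d (subst (_< 0ℤ) (sym (down r)) -<+)) i j)))) x≢u
  ... | tri> _ _ d<0 = contradiction (sym (unique (Root-sym r) λ i j →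
    trans (shift (Root-sym r) i j)
      (sym (shift (Root-sym (disagree⇒Root u x a b (subst (0ℤ <_) (sym (up r)) (+<+ (s≤s z≤n))) d<0)) i j)))) x≢w

good⇒Tidy : (C : Fin n → P k) → PairwiseCompatible C → Basic C → Tidy C
good⇒Tidy C compatible basic = record
  { disagree⇒Root = λ u w a b 0<d d<0 → disagree⇒Root′
      (compatible λ { refl → ℤₚ.<-asym 0<d d<0 }) a b 0<d d<0
  ; unique = λ {u} {_} {x} {a} r eq →
      basic (Root⇒RootConjugate r) (diff≡⇒≈ (C u) (C x) a λ i → eq i a)
  }

-- Negation interchanges the two signs of classes, so that arguments about signs are made for +
-- only.
negate : (Fin n → P k) → Fin n → P k
negate C u a = - C u a

diff-negate : (C : Fin n → P k) → ∀ u a b → diff (negate C u) a b ≡ diff (C u) b a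
diff-negate C u a b = lemma (C u a) (C u b)
  where
  lemma : ∀ i j → - i - - j ≡ j - i
  lemma = solve-∀

root-reverse : (a b x y : Fin k) → diff (root a b) y x ≡ diff (root b a) x y
root-reverse a b x y = lemma (basis a x) (basis b x) (basis a y) (basis b y)
  where
  lemma : ∀ i j l m → (l - m) - (i - j) ≡ (j - i) - (m - l)
  lemma = solve-∀

Root-negate : (C : Fin n → P k) → ∀ {u w a b} → Root (C u) (C w) a b → Root (negate C u) (negate C w) b a
Root-negate C {u} {w} {a} {b} r = mkRoot (trans (diff-negate C u b a) (up r)) λ x y →
  trans (diff-negate C u x y) (trans (shift r y x)
    (cong₂ _+_ (sym (diff-negate C w x y)) (root-reverse a b x y)))

Root-unnegate : (C : Fin n → P k) → ∀ {u w a b} → Root (negate C u) (negate C w) b a → Root (C u) (C w) a b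
Root-unnegate C {u} {w} {a} {b} r = mkRoot (trans (sym (diff-negate C u b a)) (up r)) λ x y →
  trans (sym (diff-negate C u y x)) (trans (shift r y x)
    (cong₂ _+_ (diff-negate C w y x) (root-reverse b a x y)))

Tidy-negate : {C : Fin n → P k} → Tidy C → Tidy (negate C)
Tidy-negate {C = C} tidy = record
  { disagree⇒Root = λ u w a b 0<d d<0 → Root-negate C (disagree⇒Root u w b a
      (subst (0ℤ <_) (diff-negate C u a b) 0<d) (subst (_< 0ℤ) (diff-negate C w a b) d<0))
  ; unique = λ {u} {w} {x} r eq → unique (Root-unnegate C r) λ i j →
      trans (sym (diff-negate C u j i)) (trans (eq j i) (diff-negate C x j i))
  }
  where open Tidy tidy

Root⇒u≢w : {C : Fin n → P k} → ∀ {u w a b} → Root (C u) (C w) a b → u ≢ w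
Root⇒u≢w r refl = contradiction (trans (sym (up r)) (down r)) λ ()

root-difference<0 : (a b c d : Fin k) → diff (root c d) a b < 0ℤ → a ≡ d ⊎ b ≡ c
root-difference<0 a b c d lt with a Finₚ.≟ d | b Finₚ.≟ c
... | yes p | _     = inj₁ p
... | no _  | yes q = inj₂ q
... | no a≢d | no b≢c rewrite basis-≢ (a≢d ∘ sym) | basis-≢ (b≢c ∘ sym) with c Finₚ.≟ a | d Finₚ.≟ b
root-difference<0 a b c d (+<+ ()) | no _ | no _ | yes _ | yes _
root-difference<0 a b c d (+<+ ()) | no _ | no _ | yes _ | no _
root-difference<0 a b c d (+<+ ()) | no _ | no _ | no _  | yes _
root-difference<0 a b c d (+<+ ()) | no _ | no _ | no _  | no _

root-+ : (a b c x y : Fin k) → diff (root a b) x y + diff (root b c) x y ≡ diff (root a c) x y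
root-+ a b c x y = lemma (basis a x) (basis b x) (basis c x) (basis a y) (basis b y) (basis c y)
  where
  lemma : ∀ i j l i′ j′ l′ → ((i - j) - (i′ - j′)) + ((j - l) - (j′ - l′)) ≡ (i - l) - (i′ - l′)
  lemma = solve-∀

0<diff⁺ : (λ₁ : P k) → ∀ a b → λ₁ b < λ₁ a → 0ℤ < diff λ₁ a b
0<diff⁺ λ₁ a b lt = subst (_< diff λ₁ a b) (ℤₚ.+-inverseʳ (λ₁ b)) (ℤₚ.+-monoˡ-< (- λ₁ b) lt)

0<diff⁻ : (λ₁ : P k) → ∀ a b → 0ℤ < diff λ₁ a b → λ₁ b < λ₁ a
0<diff⁻ λ₁ a b 0<d = ℤₚ.≰⇒> λ a≤b → ℤₚ.<⇒≱ 0<d (ℤₚ.i≤j⇒i-j≤0 a≤b)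

diff<0⁺ : (λ₁ : P k) → ∀ a b → λ₁ a < λ₁ b → diff λ₁ a b < 0ℤ
diff<0⁺ λ₁ a b lt = subst (diff λ₁ a b <_) (ℤₚ.+-inverseʳ (λ₁ b)) (ℤₚ.+-monoˡ-< (- λ₁ b) lt)

-- Auxiliary facts on lists and subsets

AllPairs-lookup⁺ : {R : A → A → Set} (xs : List A) →
  (∀ {i j} → i Fin.< j → R (lookup xs i) (lookup xs j)) → AllPairs R xs
AllPairs-lookup⁺ {R = R} xs r = subst (AllPairs R) (Listₚ.tabulate-lookup xs) (AllPairsₚ.tabulate⁺-< r)

AllPairs-lookup⁻ : {R : A → A → Set} {xs : List A} → AllPairs R xs →
  ∀ {i j} → i Fin.< j → R (lookup xs i) (lookup xs j)
AllPairs-lookup⁻ (r ∷ _)  {Fin.zero}  {Fin.suc j} _         = All.lookup r (Listₘ.∈-lookup j)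
AllPairs-lookup⁻ (_ ∷ rs) {Fin.suc i} {Fin.suc j} (s≤s i<j) = AllPairs-lookup⁻ rs i<j

AllPairs-universal : {R : A → A → Set} (xs : List A) →
  (∀ {x y} → x List.∈ xs → y List.∈ xs → R x y) → AllPairs R xs
AllPairs-universal []       r = []
AllPairs-universal (x ∷ xs) r =
  All.tabulate (λ y∈xs → r (here refl) (there y∈xs)) ∷
  AllPairs-universal xs λ x∈xs y∈xs → r (there x∈xs) (there y∈xs)

module _ {P : A → Set} (P? : Decidable P) where

  -- The hypothesis makes the elements satisfying `P` an initial segment, so separating them from
  -- the others does not change the order.
  filter-++-complement : ∀ {xs} → AllPairs (λ x y → P y → P x) xs →
    filter P? xs ++ filter (¬? ∘ P?) xs ≡ xs
  filter-++-complement [] = refl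
  filter-++-complement {x ∷ xs} (h ∷ hs) with P? x
  ... | yes _ = cong (x ∷_) (filter-++-complement hs)
  ... | no ¬p = begin
    filter P? xs ++ x ∷ filter (¬? ∘ P?) xs
      ≡⟨ cong₂ (λ ys zs → ys ++ x ∷ zs)
           (Listₚ.filter-none P? ¬ps) (Listₚ.filter-all (¬? ∘ P?) ¬ps) ⟩
    x ∷ xs ∎
    where
    open ≡-Reasoning
    ¬ps = All.map (λ g p → ¬p (g p)) h

  filter-filter : {Q : A → Set} (Q? : Decidable Q) → ∀ {xs} → All (λ x → Q x → P x) xs →
    filter Q? (filter P? xs) ≡ filter Q? xs
  filter-filter Q? [] = refl
  filter-filter Q? {x ∷ xs} (h ∷ hs) with P? x
  ... | yes p with Q? x
  ...   | yes q = cong (x ∷_) (filter-filter Q? hs)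
  ...   | no ¬q = filter-filter Q? hs
  filter-filter Q? {x ∷ xs} (h ∷ hs) | no ¬p with Q? x
  ...   | yes q = contradiction (h q) ¬p
  ...   | no ¬q = filter-filter Q? hs

comprehension : {P : Fin k → Set} → Decidable P → Subset k
comprehension P? = Vec.tabulate (does ∘ P?)

∈-comprehension⁺ : {P : Fin k → Set} (P? : Decidable P) → ∀ {a} → P a → a ∈ comprehension P?
∈-comprehension⁺ P? {a} p = Vecₚ.lookup⇒[]= a _ (trans (Vecₚ.lookup∘tabulate _ a) (dec-true (P? a) p))

∈-comprehension⁻ : {P : Fin k → Set} (P? : Decidable P) → ∀ {a} → a ∈ comprehension P? → P a
∈-comprehension⁻ P? {a} a∈ with P? a | trans (sym (Vecₚ.lookup∘tabulate (does ∘ P?) a)) (Vecₚ.[]=⇒lookup a∈)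
... | yes p | _ = p

∈-⋃⁺ : ∀ {a : Fin k} {Bs} → Any (a ∈_) Bs → a ∈ ⋃ Bs
∈-⋃⁺ {Bs = B ∷ Bs} (here a∈B)   = p⊆p∪q (⋃ Bs) a∈B
∈-⋃⁺ {Bs = B ∷ Bs} (there a∈Bs) = q⊆p∪q B (⋃ Bs) (∈-⋃⁺ a∈Bs)

∈-⋃⁻ : ∀ {a : Fin k} Bs → a ∈ ⋃ Bs → Any (a ∈_) Bs
∈-⋃⁻ []       a∈ = contradiction a∈ ∉⊥
∈-⋃⁻ (B ∷ Bs) a∈ with x∈p∪q⁻ B (⋃ Bs) a∈
... | inj₁ a∈B  = here a∈B
... | inj₂ a∈Bs = there (∈-⋃⁻ Bs a∈Bs)

-- Ordered set partitions by the level sets of an integer-valued function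

Level : (Fin k → ℤ) → Subset k → Set
Level f B = ∀ a b → a ∈ B → b ∈ B → f a ≡ f b

Above WeaklyAbove : (Fin k → ℤ) → Subset k → Subset k → Set
Above       f B B′ = ∀ a b → a ∈ B → b ∈ B′ → f b < f a
WeaklyAbove f B B′ = ∀ a b → a ∈ B → b ∈ B′ → f b ≤ f a

record Sorted (f : Fin k → ℤ) (Π : Blocks k) : Set where
  field
    nonempty   : All Nonempty Π
    level      : All (Level f) Π
    descending : AllPairs (Above f) Π
    cover      : ∀ a → Any (a ∈_) Π

-- For an osp this means that it refines Π(f), as `refines⁻` and `refines⁺` show. Through these two
-- lemmas refinements become inequalities and the runs of `Refines` disappear.
WeaklySorted : (Fin k → ℤ) → Blocks k → Set
WeaklySorted f Π = All (Level f) Π × AllPairs (WeaklyAbove f) Π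

module _ {f : Fin k → ℤ} where

  Sorted⇒IsOSP : ∀ {Π} → Sorted f Π → IsOSP Π
  Sorted⇒IsOSP {Π} s = record
    { blocks-nonempty = nonempty
    ; blocks-disjoint = AllPairs.map
        (λ above (a , a∈) → let (a∈B , a∈B′) = x∈p∩q⁻ _ _ a∈ in ℤₚ.<-irrefl refl (above a a a∈B a∈B′)) descending
    ; blocks-cover    = cover
    }
    where open Sorted s

  Sorted⇒IsOSPOf : ∀ {Π} → Sorted f Π → IsOSPOf f Π
  Sorted⇒IsOSPOf {Π} s = record
    { isOSP     = Sorted⇒IsOSP s
    ; sameBlock = λ a b → mk⇔ (λ (x , a∈ , b∈) → All.lookup level (Listₘ.∈-lookup x) _ _ a∈ b∈) same
    ; earlier   = λ a b → mk⇔ (λ (x , y , x<y , a∈ , b∈) → AllPairs-lookup⁻ descending x<y _ _ a∈ b∈) before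
    }
    where
    open Sorted s
    locate : ∀ a → ∃ λ x → a ∈ lookup Π x
    locate a = Any.index (cover a) , Anyₚ.lookup-index (cover a)
    same : ∀ {a b} → f a ≡ f b → SameBlock Π a b
    same {a} {b} eq with locate a | locate b
    ... | x , a∈ | y , b∈ with Finₚ.<-cmp x y
    ...   | tri< x<y _ _  = contradiction (sym eq) (ℤₚ.<⇒≢ (AllPairs-lookup⁻ descending x<y _ _ a∈ b∈))
    ...   | tri≈ _ refl _ = x , a∈ , b∈
    ...   | tri> _ _ y<x  = contradiction eq (ℤₚ.<⇒≢ (AllPairs-lookup⁻ descending y<x _ _ b∈ a∈))
    before : ∀ {a b} → f b < f a → Earlier Π a b
    before {a} {b} lt with locate a | locate b
    ... | x , a∈ | y , b∈ with Finₚ.<-cmp x y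
    ...   | tri< x<y _ _  = x , y , x<y , a∈ , b∈
    ...   | tri≈ _ refl _ =
      contradiction (sym (All.lookup level (Listₘ.∈-lookup x) _ _ a∈ b∈)) (ℤₚ.<⇒≢ lt)
    ...   | tri> _ _ y<x  = contradiction lt (ℤₚ.<-asym (AllPairs-lookup⁻ descending y<x _ _ b∈ a∈))

  IsOSPOf⇒Sorted : ∀ {Π} → IsOSPOf f Π → Sorted f Π
  IsOSPOf⇒Sorted {Π} o = record
    { nonempty   = blocks-nonempty
    ; level      = All.tabulate λ B∈Π a b a∈B b∈B → Equivalence.to (sameBlock _ _)
        (Any.index B∈Π , subst (_ ∈_) (Anyₚ.lookup-index B∈Π) a∈B , subst (_ ∈_) (Anyₚ.lookup-index B∈Π) b∈B)
    ; descending = AllPairs-lookup⁺ Π λ {x} {y} x<y a b a∈ b∈ → Equivalence.to (earlier _ _) (x , y , x<y , a∈ , b∈)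
    ; cover      = blocks-cover
    }
    where
    open IsOSPOf o
    open IsOSP isOSP

  sorted-maximal : ∀ {Π B a b} → Sorted f Π → B List.∈ Π → a ∈ B → f b ≡ f a → b ∈ B
  sorted-maximal {Π} {B} {a} {b} s B∈ a∈ eq = subst (b ∈_) (sym (Anyₚ.lookup-index B∈)) (help (cover b))
    where
    open Sorted s
    x = Any.index B∈
    a∈x = subst (a ∈_) (Anyₚ.lookup-index B∈) a∈
    help : Any (b ∈_) Π → b ∈ lookup Π x
    help b∈ with Finₚ.<-cmp (Any.index b∈) x
    ... | tri< y<x _ _ = contradiction (sym eq) (ℤₚ.<⇒≢ (AllPairs-lookup⁻ descending y<x _ _ (Anyₚ.lookup-index b∈) a∈x))
    ... | tri≈ _ y≡x _ = subst (λ z → b ∈ lookup Π z) y≡x (Anyₚ.lookup-index b∈)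
    ... | tri> _ _ x<y = contradiction eq (ℤₚ.<⇒≢ (AllPairs-lookup⁻ descending x<y _ _ a∈x (Anyₚ.lookup-index b∈)))

  refines⁻ : ∀ {Π Π′} → Refines Π Π′ → Sorted f Π′ → WeaklySorted f Π
  refines⁻ (runs , refl , refl) s =
    Allₚ.concat⁺ (All.map (λ {run} h → All.tabulate λ B∈ a b a∈ b∈ → h _ _ (inRun B∈ a∈) (inRun B∈ b∈)) levels) ,
    AllPairsₚ.concat⁺
      (All.map (λ {run} h → AllPairs-universal run λ B∈ B′∈ a b a∈ b∈ →
        ℤₚ.≤-reflexive (h _ _ (inRun B′∈ b∈) (inRun B∈ a∈))) levels)
      (AllPairs.map (λ {run} {run′} h → All.tabulate λ B∈ → All.tabulate λ B′∈ a b a∈ b∈ →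
        ℤₚ.<⇒≤ (h _ _ (inRun B∈ a∈) (inRun B′∈ b∈))) (AllPairsₚ.map⁻ descending))
    where
    open Sorted s
    levels = Allₚ.map⁻ level
    inRun : ∀ {run B a} → B List.∈ run → a ∈ B → a ∈ ⋃ run
    inRun B∈ a∈ = ∈-⋃⁺ (Any.map (λ { refl → a∈ }) B∈)

  private
    -- The run belonging to a block of `Π′` consists of the blocks of `Π` inside it. Those inside
    -- the first block B′ form an initial segment, since B′ is strictly above the rest while `Π` is
    -- weakly descending. Removing them does not affect the later runs, because a nonempty block
    -- cannot lie both in B′ and in a block below B′.
    concat-runs : ∀ {Π} Π′ → All Nonempty Π → AllPairs (WeaklyAbove f) Π → AllPairs (Above f) Π′ →
      All (λ B → Any (B ⊆_) Π′) Π → concat (map (λ B′ → filter (_⊆? B′) Π) Π′) ≡ Π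
    concat-runs {[]}    []        _ _ _ _ = refl
    concat-runs {_ ∷ _} []        _ _ _ (() ∷ _)
    concat-runs {Π}     (B′ ∷ Π′) ne wa (above ∷ a) inside = begin
      filter (_⊆? B′) Π ++ concat (map (λ B″ → filter (_⊆? B″) Π) Π′)
        ≡⟨ cong (λ Σ → filter (_⊆? B′) Π ++ concat Σ) (Listₚ.map-cong-local (All.map later above)) ⟨
      filter (_⊆? B′) Π ++ concat (map (λ B″ → filter (_⊆? B″) (filter (¬? ∘ (_⊆? B′)) Π)) Π′)
        ≡⟨ cong (filter (_⊆? B′) Π ++_) (concat-runs Π′
             (Allₚ.filter⁺ (¬? ∘ (_⊆? B′)) ne) (AllPairsₚ.filter⁺ (¬? ∘ (_⊆? B′)) wa) a
             (remaining (Allₚ.filter⁺ (¬? ∘ (_⊆? B′)) inside) (Allₚ.all-filter (¬? ∘ (_⊆? B′)) Π))) ⟩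
      filter (_⊆? B′) Π ++ filter (¬? ∘ (_⊆? B′)) Π
        ≡⟨ filter-++-complement (_⊆? B′) front ⟩
      Π ∎
      where
      open ≡-Reasoning
      remaining : ∀ {Σ} → All (λ B → Any (B ⊆_) (B′ ∷ Π′)) Σ → All (λ B → ¬ B ⊆ B′) Σ →
        All (λ B → Any (B ⊆_) Π′) Σ
      remaining [] [] = []
      remaining (here B⊆ ∷ _) (B⊈ ∷ _)        = ⊥-elim (B⊈ B⊆)
      remaining (there B⊆ ∷ is) (_ ∷ B⊈s) = B⊆ ∷ remaining is B⊈s
      disjoint : ∀ {B B″} → Above f B′ B″ → Nonempty B → B ⊆ B″ → ¬ B ⊆ B′
      disjoint h (b , b∈) B⊆B″ B⊆B′ = ℤₚ.<-irrefl refl (h _ _ (B⊆B′ b∈) (B⊆B″ b∈))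
      later : ∀ {B″} → Above f B′ B″ →
        filter (_⊆? B″) (filter (¬? ∘ (_⊆? B′)) Π) ≡ filter (_⊆? B″) Π
      later h = filter-filter (¬? ∘ (_⊆? B′)) (_⊆? _) (All.map (disjoint h) ne)
      first : ∀ {B B₁} → Nonempty B → Nonempty B₁ → WeaklyAbove f B B₁ → Any (B ⊆_) (B′ ∷ Π′) →
        B₁ ⊆ B′ → B ⊆ B′
      first _ _ _ (here B⊆B′) _ = B⊆B′
      first (b , b∈) (b₁ , b₁∈) w (there B⊆) B₁⊆B′ =
        let (h , B⊆B″) = All.lookupAny above B⊆
        in contradiction (h _ _ (B₁⊆B′ b₁∈) (B⊆B″ b∈)) (ℤₚ.≤⇒≯ (w _ _ b∈ b₁∈))
      fronts : ∀ {Π} → All Nonempty Π → AllPairs (WeaklyAbove f) Π → All (λ B → Any (B ⊆_) (B′ ∷ Π′)) Π →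
        AllPairs (λ B B₁ → B₁ ⊆ B′ → B ⊆ B′) Π
      fronts [] [] [] = []
      fronts (n ∷ ns) (w ∷ ws) (i ∷ is) =
        All.zipWith (λ (n₁ , w₁) → first n n₁ w₁ i) (ns , w) ∷ fronts ns ws is
      front = fronts ne wa inside

  refines⁺ : ∀ {Π Π′} → IsOSP Π → WeaklySorted f Π → Sorted f Π′ → Refines Π Π′
  refines⁺ {Π} {Π′} o (levels , above) s =
    map (λ B′ → filter (_⊆? B′) Π) Π′ ,
    concat-runs Π′ blocks-nonempty above descending
      (All.zipWith (λ (n , l) → insideOf n l) (blocks-nonempty , levels)) ,
    trans (sym (Listₚ.map-∘ Π′)) (trans (Listₚ.map-cong-local (All.tabulate union)) (Listₚ.map-id Π′))
    where
    open Sorted s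
    open IsOSP o
    insideOf : ∀ {B} → Nonempty B → Level f B → Any (B ⊆_) Π′
    insideOf {B} (b , b∈) l with List.find (cover b)
    ... | B′ , B′∈ , b∈B′ = List.lose B′∈ λ a∈ →
      sorted-maximal s B′∈ b∈B′ (l _ _ a∈ b∈)
    union : ∀ {B′} → B′ List.∈ Π′ → ⋃ (filter (_⊆? B′) Π) ≡ B′
    union {B′} B′∈ = ⊆-antisym
      (λ a∈ → let (B , B∈ , a∈B) = List.find (∈-⋃⁻ _ a∈)
              in proj₂ (Listₘ.∈-filter⁻ (_⊆? B′) {xs = Π} B∈) a∈B)
      (λ a∈ → let (B , B∈ , a∈B) = List.find (blocks-cover _)
              in ∈-⋃⁺ (List.lose (Listₘ.∈-filter⁺ (_⊆? B′) B∈
                   λ b∈ → sorted-maximal s B′∈ a∈ (All.lookup levels B∈ _ _ b∈ a∈B)) a∈B))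

∣_∣-bounded : (f : Fin k → ℤ) → ∃ λ m → ∀ a → ℤ.∣ f a ∣ ℕ.≤ m
∣_∣-bounded {zero}  f = 0 , λ ()
∣_∣-bounded {suc k} f with ∣_∣-bounded (f ∘ Fin.suc)
... | m , bound = ℤ.∣ f Fin.zero ∣ ℕ.⊔ m , λ
  { Fin.zero    → ℕₚ.m≤m⊔n _ m
  ; (Fin.suc a) → ℕₚ.≤-trans (bound a) (ℕₚ.m≤n⊔m ℤ.∣ f Fin.zero ∣ m)
  }

-- With m a bound for the absolute values, the blocks are the nonempty level sets for the 2m + 1
-- values from m down to -m, which `applyDownFrom` lists in descending order.
sorted-exists : (f : Fin k → ℤ) → ∃ (Sorted f)
sorted-exists {k} f with ∣_∣-bounded f
... | m , bound = filter nonempty? levels , record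
  { nonempty   = Allₚ.all-filter nonempty? levels
  ; level      = Allₚ.filter⁺ nonempty? (Allₚ.map⁺ (All.universal (λ c a b a∈ b∈ →
      trans (∈-comprehension⁻ (λ a → f a ℤₚ.≟ c) a∈) (sym (∈-comprehension⁻ (λ a → f a ℤₚ.≟ c) b∈))) values))
  ; descending = AllPairsₚ.filter⁺ nonempty? (AllPairsₚ.map⁺ (AllPairsₚ.applyDownFrom⁺₁ value _
      λ {i} {j} j<i _ a b a∈ b∈ → subst₂ _<_ (sym (∈-comprehension⁻ (λ a → f a ℤₚ.≟ value j) b∈))
        (sym (∈-comprehension⁻ (λ a → f a ℤₚ.≟ value i) a∈))
        (ℤₚ.+-monoˡ-< (- (ℤ.+ m)) (ℤ.+<+ j<i))))
  ; cover      = λ a → List.lose (Listₘ.∈-filter⁺ nonempty? (Listₘ.∈-map⁺ levelSet (attained a))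
      (a , ∈-comprehension⁺ (λ b → f b ℤₚ.≟ f a) refl)) (∈-comprehension⁺ (λ b → f b ℤₚ.≟ f a) refl)
  }
  where
  value : ℕ → ℤ
  value j = ℤ.+ j - ℤ.+ m
  values : List ℤ
  values = applyDownFrom value (suc (m ℕ.+ m))
  levelSet : ℤ → Subset k
  levelSet c = comprehension (λ a → f a ℤₚ.≟ c)
  levels : Blocks k
  levels = map levelSet values
  shifted-nonNegative : ∀ i → ℤ.∣ i ∣ ℕ.≤ m → 0ℤ ≤ i + ℤ.+ m
  shifted-nonNegative (ℤ.+ n)      _   = ℤ.+≤+ z≤n
  shifted-nonNegative ℤ.-[1+ n ] n≤m = subst (0ℤ ≤_) (sym (ℤₚ.⊖-≥ n≤m)) (ℤ.+≤+ z≤n)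
  cancel : ∀ i j → i + j - j ≡ i
  cancel = solve-∀
  attained : ∀ a → f a List.∈ values
  attained a = subst (List._∈ values)
    (trans (cong (_- ℤ.+ m) (ℤₚ.0≤i⇒+∣i∣≡i (shifted-nonNegative (f a) (bound a)))) (cancel (f a) (ℤ.+ m)))
    (Listₘ.∈-applyDownFrom⁺ value
      (s≤s (ℕₚ.≤-trans (ℤₚ.∣i+j∣≤∣i∣+∣j∣ (f a) (ℤ.+ m)) (ℕₚ.+-monoˡ-≤ m (bound a)))))

-- Sums of vectors, root-conjugacy classes and the osp of a family

sum-zero : (f : Fin n → ℤ) → (∀ u → f u ≡ 0ℤ) → sum f ≡ 0ℤ
sum-zero {n} f f≡0 = trans (sum-cong-≗ f≡0) (sum-replicate-zero n)

sum-single : (f : Fin n → ℤ) → ∀ u → (∀ x → x ≢ u → f x ≡ 0ℤ) → sum f ≡ f u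
sum-single {suc n} f u f≡0 = trans (sum-remove {i = u} f)
  (trans (cong (f u +_) (sum-zero (f ∘ punchIn u) λ x → f≡0 (punchIn u x) (Finₚ.punchInᵢ≢i u x)))
    (ℤₚ.+-identityʳ (f u)))

sum-pair : (f : Fin n → ℤ) → ∀ {u w} → u ≢ w → (∀ x → x ≢ u → x ≢ w → f x ≡ 0ℤ) → sum f ≡ f u + f w
sum-pair {suc n} f {u} {w} u≢w f≡0 = trans (sum-remove {i = u} f) (cong (f u +_)
  (trans (sum-single (f ∘ punchIn u) (punchOut u≢w) λ x x≢ → f≡0 (punchIn u x) (Finₚ.punchInᵢ≢i u x)
    λ eq → x≢ (Finₚ.punchIn-injective u x (punchOut u≢w) (trans eq (sym (Finₚ.punchIn-punchOut u≢w)))))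
   (cong f (Finₚ.punchIn-punchOut u≢w))))

sum-difference : (f g : Fin n → ℤ) → sum (λ u → f u - g u) ≡ sum f - sum g
sum-difference {zero}  f g = refl
sum-difference {suc n} f g = trans
  (cong (f Fin.zero - g Fin.zero +_) (sum-difference (f ∘ Fin.suc) (g ∘ Fin.suc)))
  (lemma (f Fin.zero) (g Fin.zero) (sum (f ∘ Fin.suc)) (sum (g ∘ Fin.suc)))
  where
  lemma : ∀ i j l m → i - j + (l - m) ≡ i + l - (j + m)
  lemma = solve-∀

sum-mono-≤ : {f g : Fin n → ℤ} → (∀ u → f u ≤ g u) → sum f ≤ sum g
sum-mono-≤ {zero}  f≤g = ℤₚ.≤-refl
sum-mono-≤ {suc n} f≤g = ℤₚ.+-mono-≤ (f≤g Fin.zero) (sum-mono-≤ (f≤g ∘ Fin.suc))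

sum-mono-< : {f g : Fin n → ℤ} → (∀ u → f u ≤ g u) → ∀ u → f u < g u → sum f < sum g
sum-mono-< f≤g Fin.zero    f<g = ℤₚ.+-mono-<-≤ f<g (sum-mono-≤ (f≤g ∘ Fin.suc))
sum-mono-< f≤g (Fin.suc u) f<g = ℤₚ.+-mono-≤-< (f≤g Fin.zero) (sum-mono-< (f≤g ∘ Fin.suc) u f<g)

total : (Fin n → P k) → P k
total C a = sum λ u → C u a

Separating : (Fin n → P k) → Set
Separating C = ∀ a b → a ≢ b → ∃ λ u → diff (C u) a b ≢ 0ℤ

module _ {C : Fin n → P k} (tidy : Tidy C) (separating : Separating C) where
  open Tidy tidy

  -- Unless some pair of vectors disagrees on `a` and `b`, all vectors compare them in the same weak
  -- sense, and separation makes one comparison strict. Hence the sum of the family shows which case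
  -- occurs.
  data Comparison (a b : Fin k) : Set where
    conjugate : ∀ {u w} → Root (C u) (C w) a b → Comparison a b
    above  : (∀ u → C u b ≤ C u a) → (∃ λ u → C u b < C u a) → Comparison a b
    below  : (∀ u → C u a ≤ C u b) → (∃ λ u → C u a < C u b) → Comparison a b

  compare : ∀ a b → a ≢ b → Comparison a b
  compare a b a≢b with Finₚ.any? (λ u → C u b ℤₚ.<? C u a) | Finₚ.any? (λ u → C u a ℤₚ.<? C u b)
  ... | yes (u , lt) | yes (w , gt) = conjugate (disagree⇒Root u w a b (0<diff⁺ (C u) a b lt) (diff<0⁺ (C w) a b gt))
  ... | yes up       | no ¬gt = above (λ u → ℤₚ.≮⇒≥ λ gt → ¬gt (u , gt)) up
  ... | no ¬lt       | yes dn = below (λ u → ℤₚ.≮⇒≥ λ lt → ¬lt (u , lt)) dn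
  ... | no ¬lt       | no ¬gt = let (u , d≢0) = separating a b a≢b in contradiction
    (ℤₚ.i≡j⇒i-j≡0 (ℤₚ.≤-antisym (ℤₚ.≮⇒≥ λ lt → ¬lt (u , lt)) (ℤₚ.≮⇒≥ λ gt → ¬gt (u , gt)))) d≢0

module _ {C : Fin n → P k} (tidy : Tidy C) where
  open Tidy tidy

  -- Only `u` and `w` have a nonzero difference at `a`, `b`, and these are 1 and -1.
  total-joined : ∀ {u w a b} → Root (C u) (C w) a b → total C a ≡ total C b
  total-joined {u} {w} {a} {b} r = ℤₚ.i-j≡0⇒i≡j _ _ (trans (sym (sum-difference (λ x → C x a) (λ x → C x b)))
    (trans (sum-pair (λ x → diff (C x) a b) (Root⇒u≢w {C = C} r) λ x → others-vanish r)
      (cong₂ _+_ (up r) (down r))))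

  infix 4 _~_
  -- Already transitive by `~-trans`, so the equivalence relation generated by root-conjugacy needs
  -- at most one step and is decidable.
  _~_ : Fin n → Fin n → Set
  u ~ w = u ≡ w ⊎ ∃₂ (Root (C u) (C w))

  Root? : (u w : Fin n) → ∀ a b → Dec (Root (C u) (C w) a b)
  Root? u w a b = map′ (λ (e , s) → mkRoot e s) (λ r → up r , shift r)
    (diff (C u) a b ℤₚ.≟ 1ℤ ×-dec Finₚ.all? λ x → Finₚ.all? λ y →
      diff (C u) x y ℤₚ.≟ diff (C w) x y + diff (root a b) x y)

  _~?_ : (u w : Fin n) → Dec (u ~ w)
  u ~? w = u Finₚ.≟ w ⊎-dec Finₚ.any? λ a → Finₚ.any? λ b → Root? u w a b

  ~-sym : ∀ {u w} → u ~ w → w ~ u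
  ~-sym (inj₁ eq)          = inj₁ (sym eq)
  ~-sym (inj₂ (a , b , r)) = inj₂ (b , a , Root-sym r)

  -- If `u` and `w` differ, `w` does not tell `a` and `b` apart, whereas `v` has difference -1
  -- there. So the root c, d between `v` and `w` has difference -1 at `a`, `b`, that is a = d or b =
  -- c, and the two roots add up to a root.
  ~-trans : ∀ {u v w} → u ~ v → v ~ w → u ~ w
  ~-trans (inj₁ refl) v~w         = v~w
  ~-trans (inj₂ r)    (inj₁ refl) = inj₂ r
  ~-trans {u} {v} {w} (inj₂ (a , b , r)) (inj₂ (c , d , r′)) with u Finₚ.≟ w
  ... | yes u≡w = inj₁ u≡w
  ... | no u≢w = inj₂ (composite (root-difference<0 a b c d (subst (_< 0ℤ) root-difference -<+)))
    where
    vanish : diff (C w) a b ≡ 0ℤ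
    vanish = others-vanish r (u≢w ∘ sym) (Root⇒u≢w {C = C} r′ ∘ sym)
    root-difference : -1ℤ ≡ diff (root c d) a b
    root-difference = trans (sym (down r))
      (trans (shift r′ a b) (trans (cong (_+ diff (root c d) a b) vanish) (ℤₚ.+-identityˡ _)))
    shifts : ∀ x y → diff (C u) x y ≡ diff (C w) x y + (diff (root c d) x y + diff (root a b) x y)
    shifts x y = trans (shift r x y)
      (trans (cong (_+ diff (root a b) x y) (shift r′ x y)) (ℤₚ.+-assoc (diff (C w) x y) _ _))
    composite : a ≡ d ⊎ b ≡ c → ∃₂ (Root (C u) (C w))
    composite (inj₁ refl) = c , b , mkRoot
      (trans (shift r c b) (cong₂ _+_ (trans (diff-split (C v) c a b) (cong₂ _+_ (up r′) (down r)))
        (cong₂ _-_ (root-other (Root.a≢b r′) c≢b) (root-right (Root.a≢b r)))))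
      λ x y → trans (shifts x y) (cong (diff (C w) x y +_) (root-+ c a b x y))
      where
      c≢b : c ≢ b
      c≢b refl = contradiction (trans (sym vanish) (trans (diff-flip (C w) c a) (cong -_ (down r′)))) λ ()
    composite (inj₂ refl) = a , d , mkRoot
      (trans (shift r a d) (cong₂ _+_ (trans (diff-split (C v) a b d) (cong₂ _+_ (down r) (up r′)))
        (cong₂ _-_ (root-left (Root.a≢b r)) (root-other d≢a (Root.a≢b r′ ∘ sym)))))
      λ x y → trans (shifts x y) (cong (diff (C w) x y +_)
        (trans (ℤₚ.+-comm (diff (root b d) x y) (diff (root a b) x y)) (root-+ a b d x y)))
      where
      d≢a : d ≢ a
      d≢a refl = contradiction (trans (sym vanish) (trans (diff-flip (C w) b d) (cong -_ (down r′)))) λ ()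

  classOf : Fin n → Subset n
  classOf u = comprehension (u ~?_)

  conjugate⇔~ : ∀ {u w} → EqClosure (λ u w → RootConjugate (C u) (C w)) u w ⇔ u ~ w
  conjugate⇔~ = mk⇔ to λ { (inj₁ refl) → Star.ε ; (inj₂ (_ , _ , r)) → fwd (Root⇒RootConjugate r) ◅ Star.ε }
    where
    to : ∀ {u w} → EqClosure (λ u w → RootConjugate (C u) (C w)) u w → u ~ w
    to Star.ε             = inj₁ refl
    to (fwd rc ◅ cs) = ~-trans (inj₂ (RootConjugate⇒Root rc)) (to cs)
    to (bwd rc ◅ cs) = ~-trans (~-sym (inj₂ (RootConjugate⇒Root rc))) (to cs)

  classOf-isClass : ∀ u → IsClass C (classOf u)
  classOf-isClass u = (u , ∈-comprehension⁺ (u ~?_) (inj₁ refl)) , λ {v} {w} v∈ → mk⇔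
    (λ w∈ → Equivalence.from conjugate⇔~
      (~-trans (~-sym (∈-comprehension⁻ (u ~?_) v∈)) (∈-comprehension⁻ (u ~?_) w∈)))
    (λ c → ∈-comprehension⁺ (u ~?_) (~-trans (∈-comprehension⁻ (u ~?_) v∈) (Equivalence.to conjugate⇔~ c)))

  class-closed : ∀ {O u w} → IsClass C O → u ∈ O → u ~ w → w ∈ O
  class-closed (_ , closed) u∈O u~w = Equivalence.from (closed u∈O) (Equivalence.from conjugate⇔~ u~w)

  private
    part : Subset n → Fin k → Fin n → ℤ
    part O a v = if does (v ∈? O) then C v a else 0ℤ

    part-∈ : ∀ {O} a {v} → v ∈ O → part O a v ≡ C v a
    part-∈ {O} a {v} v∈ with v ∈? O
    ... | yes _  = refl
    ... | no v∉O = contradiction v∈ v∉O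

    part-≤ : ∀ O a b v → C v a ≤ C v b → part O a v ≤ part O b v
    part-≤ O a b v le with v ∈? O
    ... | yes _ = le
    ... | no _  = ℤₚ.≤-refl

  -- The two vectors that tell `a` and `b` apart are both in the class, where they cancel, or both
  -- outside.
  classSum-joined : ∀ {O u w a b} → IsClass C O → Root (C u) (C w) a b → classSum C O a ≡ classSum C O b
  classSum-joined {O} {u} {w} {a} {b} class r = ℤₚ.i-j≡0⇒i≡j _ _
    (trans (sym (sum-difference (part O a) (part O b)))
      (trans (sum-pair (λ x → part O a x - part O b x) (Root⇒u≢w {C = C} r) others) both))
    where
    others : ∀ x → x ≢ u → x ≢ w → part O a x - part O b x ≡ 0ℤ
    others x x≢u x≢w with x ∈? O
    ... | yes _ = others-vanish r x≢u x≢w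
    ... | no _  = refl
    both : part O a u - part O b u + (part O a w - part O b w) ≡ 0ℤ
    both with u ∈? O | w ∈? O
    ... | yes _  | yes _  = cong₂ _+_ (up r) (down r)
    ... | no _   | no _   = refl
    ... | yes u∈ | no w∉  = contradiction (class-closed class u∈ (inj₂ (_ , _ , r))) w∉
    ... | no u∉  | yes w∈ = contradiction (class-closed class w∈ (~-sym (inj₂ (_ , _ , r)))) u∉

  classSum-≤ : ∀ O a b → (∀ u → C u a ≤ C u b) → classSum C O a ≤ classSum C O b
  classSum-≤ O a b le = sum-mono-≤ λ v → part-≤ O a b v (le v)

  classSum-< : ∀ {O} a b → (∀ u → C u a ≤ C u b) → ∀ {u} → u ∈ O → C u a < C u b →
    classSum C O a < classSum C O b
  classSum-< {O} a b le {u} u∈O lt = sum-mono-< (λ v → part-≤ O a b v (le v)) u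
    (subst₂ _<_ (sym (part-∈ a u∈O)) (sym (part-∈ b u∈O)) lt)

  module _ (separating : Separating C) where

    -- Together with `total-mono`: the weak order of coordinates by the total is the intersection of
    -- the weak orders by the class sums. This is why Π of the total is the join of the osps of the
    -- classes.
    classSum-mono : ∀ {O} → IsClass C O → ∀ a b → total C a ≤ total C b → classSum C O a ≤ classSum C O b
    classSum-mono {O} class a b le with a Finₚ.≟ b
    ... | yes refl = ℤₚ.≤-refl
    ... | no a≢b with compare tidy separating a b a≢b
    ...   | conjugate r          = ℤₚ.≤-reflexive (classSum-joined class r)
    ...   | above ≥ (u , lt)  = contradiction le (ℤₚ.<⇒≱ (sum-mono-< ≥ u lt))
    ...   | below ≤′ _        = classSum-≤ O a b ≤′

    total-mono : ∀ a b → (∀ {O} → IsClass C O → classSum C O a ≤ classSum C O b) → total C a ≤ total C b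
    total-mono a b le with a Finₚ.≟ b
    ... | yes refl = ℤₚ.≤-refl
    ... | no a≢b with compare tidy separating a b a≢b
    ...   | conjugate r         = ℤₚ.≤-reflexive (total-joined r)
    ...   | below ≤′ _       = sum-mono-≤ ≤′
    ...   | above ≥ (u , lt) = contradiction (le (classOf-isClass u))
      (ℤₚ.<⇒≱ (classSum-< b a ≥ (∈-comprehension⁺ (u ~?_) (inj₁ refl)) lt))

    sorted⇒isOSPOfCluster : ∀ {Π} → Sorted (total C) Π → IsOSPOfCluster C Π
    sorted⇒isOSPOfCluster {Π} s = record
      { isOSP = Sorted⇒IsOSP s
      ; upper = λ { (O , class , o) → refines⁺ (Sorted⇒IsOSP s)
          ( All.map (λ l a b a∈ b∈ → ℤₚ.≤-antisym
              (classSum-mono class a b (ℤₚ.≤-reflexive (l a b a∈ b∈)))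
              (classSum-mono class b a (ℤₚ.≤-reflexive (l b a b∈ a∈)))) level
          , AllPairs.map (λ h a b a∈ b∈ → classSum-mono class b a (ℤₚ.<⇒≤ (h a b a∈ b∈))) descending)
          (IsOSPOf⇒Sorted o) }
      ; least = λ {Π′} isOSP refines → refines⁺ isOSP
          ( All.tabulate (λ B∈ a b a∈ b∈ → ℤₚ.≤-antisym
              (total-mono a b λ class → ℤₚ.≤-reflexive
                (All.lookup (proj₁ (weakly refines class)) B∈ a b a∈ b∈))
              (total-mono b a λ class → ℤₚ.≤-reflexive
                (All.lookup (proj₁ (weakly refines class)) B∈ b a b∈ a∈)))
          , AllPairs-lookup⁺ Π′ (λ i<j a b a∈ b∈ →
              total-mono b a λ class → AllPairs-lookup⁻ (proj₂ (weakly refines class)) i<j a b a∈ b∈))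
          s
      }
      where
      open Sorted s
      weakly : ∀ {Π′ O} → (∀ {Σ} → (∃ λ O → IsClass C O × IsOSPOf (classSum C O) Σ) → Refines Π′ Σ) →
        IsClass C O → WeaklySorted (classSum C O) Π′
      weakly {O = O} refines class = let (Σ , t) = sorted-exists (classSum C O) in
        refines⁻ (refines (O , class , Sorted⇒IsOSPOf t)) t

-- Peaks, valleys and the signs of classes

Peak : (Fin n → P k) → Subset k → Fin n → Fin k → Set
Peak C B u a = a ∈ B × ∀ b → b ∈ B → b ≢ a → diff (C u) a b ≡ 1ℤ

-- The vectors of a class of sign + are peaks, those of a class of sign − are
-- peaks of the negated family, called valleys.
HasPeak : (Fin n → P k) → Subset k → Set
HasPeak C B = ∃₂ (Peak C B)

hasPeak? : (C : Fin n → P k) (B : Subset k) → Dec (HasPeak C B)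
hasPeak? C B = Finₚ.any? λ u → Finₚ.any? λ a → a ∈? B ×-dec Finₚ.all? λ b →
  b ∈? B →-dec (¬? (b Finₚ.≟ a) →-dec diff (C u) a b ℤₚ.≟ 1ℤ)

-- The blocks of Π(C) satisfy the stronger `Joined`. The present half of it passes to subsets, and
-- is applied to the parts L and R of merged blocks.
Conjugated : (Fin n → P k) → Subset k → Set
Conjugated C B = ∀ {a b} → a ∈ B → b ∈ B → a ≢ b → ∃₂ λ u w → Root (C u) (C w) a b

record Joined (C : Fin n → P k) (B : Subset k) : Set where
  field
    join    : Conjugated C B
    maximal : ∀ {u w a b} → Root (C u) (C w) a b → a ∈ B → b ∈ B

Conjugated-negate : {C : Fin n → P k} {B : Subset k} → Conjugated C B → Conjugated (negate C) B
Conjugated-negate {C = C} join a∈ b∈ a≢b = let (u , w , r) = join b∈ a∈ (a≢b ∘ sym) in u , w , Root-negate C r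

Joined-negate : {C : Fin n → P k} {B : Subset k} → Joined C B → Joined (negate C) B
Joined-negate {C = C} j = record
  { join    = Conjugated-negate {C = C} join
  ; maximal = λ r → maximal (Root-sym (Root-unnegate C r))
  }
  where open Joined j

two-elements : (B : Subset k) → 2 ℕ.≤ ∣ B ∣ → ∀ a → ∃ λ b → b ∈ B × b ≢ a
two-elements B 2≤ a with Finₚ.any? (λ b → b ∈? B ×-dec ¬? (b Finₚ.≟ a))
... | yes b   = b
... | no none = contradiction (ℕₚ.≤-trans 2≤ (subst (∣ B ∣ ℕ.≤_) (∣⁅x⁆∣≡1 a) (p⊆q⇒∣p∣≤∣q∣ B⊆a))) λ { (s≤s ()) }
  where
  B⊆a : B ⊆ ⁅ a ⁆
  B⊆a {b} b∈ with b Finₚ.≟ a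
  ... | yes refl = x∈⁅x⁆ b
  ... | no b≢a   = contradiction (b , b∈ , b≢a) none

∣p∪q∣≤∣p∣+∣q∣ : (p q : Subset k) → ∣ p ∪ q ∣ ℕ.≤ ∣ p ∣ ℕ.+ ∣ q ∣
∣p∪q∣≤∣p∣+∣q∣ []            []            = z≤n
∣p∪q∣≤∣p∣+∣q∣ (Subset.outside ∷ p) (Subset.outside ∷ q) = ∣p∪q∣≤∣p∣+∣q∣ p q
∣p∪q∣≤∣p∣+∣q∣ (Subset.outside ∷ p) (Subset.inside ∷ q)  =
  subst (suc ∣ p ∪ q ∣ ℕ.≤_) (sym (ℕₚ.+-suc ∣ p ∣ ∣ q ∣)) (s≤s (∣p∪q∣≤∣p∣+∣q∣ p q))
∣p∪q∣≤∣p∣+∣q∣ (Subset.inside ∷ p)  (Subset.outside ∷ q) = s≤s (∣p∪q∣≤∣p∣+∣q∣ p q)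
∣p∪q∣≤∣p∣+∣q∣ (Subset.inside ∷ p)  (Subset.inside ∷ q)  =
  s≤s (ℕₚ.≤-trans (∣p∪q∣≤∣p∣+∣q∣ p q) (ℕₚ.+-monoʳ-≤ ∣ p ∣ (ℕₚ.n≤1+n ∣ q ∣)))

third-element : (B : Subset k) → 3 ℕ.≤ ∣ B ∣ → ∀ a b → ∃ λ c → c ∈ B × c ≢ a × c ≢ b
third-element B 3≤ a b with Finₚ.any? (λ c → c ∈? B ×-dec ¬? (c Finₚ.≟ a) ×-dec ¬? (c Finₚ.≟ b))
... | yes c   = c
... | no none = contradiction (ℕₚ.≤-trans 3≤ (ℕₚ.≤-trans (p⊆q⇒∣p∣≤∣q∣ B⊆ab) (ℕₚ.≤-trans (∣p∪q∣≤∣p∣+∣q∣ ⁅ a ⁆ ⁅ b ⁆)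
  (ℕₚ.≤-reflexive (cong₂ ℕ._+_ (∣⁅x⁆∣≡1 a) (∣⁅x⁆∣≡1 b)))))) λ { (s≤s (s≤s ())) }
  where
  B⊆ab : B ⊆ ⁅ a ⁆ ∪ ⁅ b ⁆
  B⊆ab {c} c∈ with c Finₚ.≟ a | c Finₚ.≟ b
  ... | yes refl | _        = p⊆p∪q ⁅ b ⁆ (x∈⁅x⁆ c)
  ... | no _     | yes refl = q⊆p∪q ⁅ a ⁆ ⁅ c ⁆ (x∈⁅x⁆ c)
  ... | no c≢a   | no c≢b   = contradiction (c , c∈ , c≢a , c≢b) none

module Conjugacy {C : Fin n → P k} (tidy : Tidy C) {B : Subset k} (join : Conjugated C B) where
  open Tidy tidy

  only-up : ∀ {u w x a b} → Root (C u) (C w) a b → diff (C x) a b ≡ 1ℤ → x ≡ u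
  only-up {u} {w} {x} r d≡1 with x Finₚ.≟ u | x Finₚ.≟ w
  ... | yes x≡u | _ = x≡u
  ... | _ | yes refl = contradiction (trans (sym d≡1) (down r)) λ ()
  ... | no x≢u | no x≢w = contradiction (trans (sym d≡1) (others-vanish r x≢u x≢w)) λ ()

  only-down : ∀ {u w x a b} → Root (C u) (C w) a b → diff (C x) a b ≡ -1ℤ → x ≡ w
  only-down {x = x} {a} {b} r d≡-1 = only-up (Root-sym r) (trans (diff-flip (C x) a b) (cong -_ d≡-1))

  -- The difference of `u` at `c`, `a` is -1, which only the lower vector of the pair joining `c`
  -- and `a` attains.
  peak-root : ∀ {u a c} → Peak C B u a → c ∈ B → c ≢ a → ∃ λ x → Root (C x) (C u) c a
  peak-root {u} {a} {c} (a∈ , top) c∈ c≢a with join c∈ a∈ c≢a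
  ... | x , y , r with only-down {x = u} r (trans (diff-flip (C u) a c) (cong -_ (top c c∈ c≢a)))
  ...   | refl = x , r

  peak-flat : ∀ {u a b c} → Peak C B u a → b ∈ B → b ≢ a → c ∈ B → c ≢ a → diff (C u) b c ≡ 0ℤ
  peak-flat {u} {a} {b} {c} (_ , top) b∈ b≢a c∈ c≢a =
    trans (diff-from (C u) a b c) (cong₂ _-_ (top c c∈ c≢a) (top b b∈ b≢a))

  -- Adding the root e_c - e_a to `u` moves the excess of 1 from `a` to `c`.
  peak-spread : ∀ {u a x c} → Peak C B u a → c ∈ B → Root (C x) (C u) c a → Peak C B x c
  peak-spread {u} {a} {x} {c} peak c∈ r = c∈ , top
    where
    top : ∀ b → b ∈ B → b ≢ c → diff (C x) c b ≡ 1ℤ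
    top b b∈ b≢c with b Finₚ.≟ a
    ... | yes refl = up r
    ... | no b≢a   = trans (shift r c b) (cong₂ _+_ (peak-flat peak c∈ (Root.a≢b r) b∈ b≢a)
      (cong₂ _-_ (root-left (Root.a≢b r)) (root-other b≢c b≢a)))

  -- Differences on `B` are 0, 1 or -1, so a third element splits the difference 1 of `u` at `a`,
  -- `b` as 1 + 0 or as 0 + 1. If all split it as 1 + 0, then `u` is a peak at `a`; if all as 0 + 1,
  -- it is a valley at `b`. If `c` and `d` split it in different ways, `u` has difference 1 at `c`,
  -- `d`, and so has `w`, since the root through `a` and `b` does not involve `c` and `d`; but only
  -- one vector can.
  no-peak⇒valley : ¬ HasPeak C B → ∀ {a b} → a ∈ B → b ∈ B → a ≢ b → HasPeak (negate C) B
  no-peak⇒valley ¬peak {a} {b} a∈ b∈ a≢b with join a∈ b∈ a≢b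
  ... | u , w , r with Finₚ.any? (λ c → c ∈? B ×-dec ¬? (c Finₚ.≟ a) ×-dec ¬? (diff (C u) a c ℤₚ.≟ 1ℤ))
  ...   | no none = contradiction (u , a , a∈ , λ c c∈ c≢a → top c c∈ c≢a) ¬peak
    where
    top : ∀ c → c ∈ B → c ≢ a → diff (C u) a c ≡ 1ℤ
    top c c∈ c≢a with diff (C u) a c ℤₚ.≟ 1ℤ
    ... | yes eq = eq
    ... | no neq = contradiction (c , c∈ , c≢a , neq) none
  ...   | yes (c , c∈ , c≢a , d≢1) = u , b , b∈ , bottom
    where
    Trit : ℤ → Set
    Trit i = i ≡ 0ℤ ⊎ i ≡ 1ℤ ⊎ i ≡ -1ℤ
    trit : ∀ x {i j} → i ∈ B → j ∈ B → i ≢ j → Trit (diff (C x) i j)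
    trit x i∈ j∈ i≢j with join i∈ j∈ i≢j
    ... | y , z , s with x Finₚ.≟ y | x Finₚ.≟ z
    ...   | yes refl | _ = inj₂ (inj₁ (up s))
    ...   | _ | yes refl = inj₂ (inj₂ (down s))
    ...   | no x≢y | no x≢z = inj₁ (others-vanish s x≢y x≢z)
    split : ∀ c → c ∈ B → c ≢ a → c ≢ b →
      (diff (C u) a c ≡ 1ℤ × diff (C u) c b ≡ 0ℤ) ⊎ (diff (C u) a c ≡ 0ℤ × diff (C u) c b ≡ 1ℤ)
    split c c∈ c≢a c≢b with trit u a∈ c∈ (c≢a ∘ sym) | trit u c∈ b∈ c≢b
      | trans (sym (up r)) (diff-split (C u) a c b)
    ... | inj₁ p        | inj₂ (inj₁ q) | _ = inj₂ (p , q)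
    ... | inj₂ (inj₁ p) | inj₁ q        | _ = inj₁ (p , q)
    ... | inj₁ p        | inj₁ q        | e = contradiction (trans e (cong₂ _+_ p q)) λ ()
    ... | inj₁ p        | inj₂ (inj₂ q) | e = contradiction (trans e (cong₂ _+_ p q)) λ ()
    ... | inj₂ (inj₁ p) | inj₂ (inj₁ q) | e = contradiction (trans e (cong₂ _+_ p q)) λ ()
    ... | inj₂ (inj₁ p) | inj₂ (inj₂ q) | e = contradiction (trans e (cong₂ _+_ p q)) λ ()
    ... | inj₂ (inj₂ p) | inj₁ q        | e = contradiction (trans e (cong₂ _+_ p q)) λ ()
    ... | inj₂ (inj₂ p) | inj₂ (inj₁ q) | e = contradiction (trans e (cong₂ _+_ p q)) λ ()
    ... | inj₂ (inj₂ p) | inj₂ (inj₂ q) | e = contradiction (trans e (cong₂ _+_ p q)) λ ()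
    c≢b : c ≢ b
    c≢b refl = d≢1 (up r)
    a-c : diff (C u) a c ≡ 0ℤ
    a-c with split c c∈ c≢a c≢b
    ... | inj₁ (p , _) = contradiction p d≢1
    ... | inj₂ (p , _) = p
    bottom : ∀ d → d ∈ B → d ≢ b → diff (negate C u) b d ≡ 1ℤ
    bottom d d∈ d≢b = trans (diff-negate C u b d) (below-d (d Finₚ.≟ a))
      where
      below-d : Dec (d ≡ a) → diff (C u) d b ≡ 1ℤ
      below-d (yes refl) = up r
      below-d (no d≢a) with split d d∈ d≢a d≢b
      ... | inj₂ (_ , q) = q
      ... | inj₁ (p , _) = contradiction (trans (only-up r₂ u-c-d) (sym (only-up r₂ w-c-d))) (Root⇒u≢w {C = C} r)
        where
        c≢d : c ≢ d
        c≢d refl = d≢1 p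
        r₂ = proj₂ (proj₂ (join c∈ d∈ c≢d))
        u-c-d : diff (C u) c d ≡ 1ℤ
        u-c-d = trans (diff-from (C u) a c d) (cong₂ _-_ p a-c)
        w-c-d : diff (C w) c d ≡ 1ℤ
        w-c-d = trans (shift (Root-sym r) c d) (cong₂ _+_ u-c-d
          (cong₂ _-_ (root-other c≢b c≢a) (root-other d≢b d≢a)))

  -- A peak and a valley at b would be root-conjugate through b and any other element of B.
  peak-at⇒¬valley : ∀ {u w b} → 3 ℕ.≤ ∣ B ∣ → Peak C B u b → ¬ Peak (negate C) B w b
  peak-at⇒¬valley {u} {w} {b} 3≤ (_ , top) (_ , bottom) with third-element B 3≤ b b
  ... | c , c∈ , c≢b , _ with third-element B 3≤ b c
  ...   | c′ , c′∈ , c′≢b , c′≢c = contradiction (trans (sym (up (pair c c∈ c≢b)))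
    (trans (shift (pair c′ c′∈ c′≢b) b c) (cong₂ _+_ (down (pair c c∈ c≢b))
      (cong₂ _-_ (root-left (c′≢b ∘ sym)) (root-other c≢b (c′≢c ∘ sym)))))) λ ()
    where
    pair : ∀ c → c ∈ B → c ≢ b → Root (C u) (C w) b c
    pair c c∈ c≢b = disagree⇒Root u w b c (subst (0ℤ <_) (sym (top c c∈ c≢b)) (+<+ (s≤s z≤n)))
      (subst (_< 0ℤ) (sym (trans (diff-flip (C w) c b) (cong -_
        (trans (sym (diff-negate C w b c)) (bottom c c∈ c≢b))))) -<+)

  -- Peaks spread over the whole of `B`, so one may be taken at the element of the valley.
  peak⇒¬valley : 3 ℕ.≤ ∣ B ∣ → HasPeak C B → ¬ HasPeak (negate C) B
  peak⇒¬valley 3≤ (u , a , peak) (w , b , valley) with b Finₚ.≟ a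
  ... | yes refl = peak-at⇒¬valley 3≤ peak valley
  ... | no b≢a   = let (x , r) = peak-root peak (proj₁ valley) b≢a in
    peak-at⇒¬valley 3≤ (peak-spread peak (proj₁ valley) r) valley

module _ {C : Fin n → P k} (tidy : Tidy C) {B : Subset k} (joined : Joined C B) where
  open Tidy tidy
  open Joined joined
  open Conjugacy tidy join

  module _ {u a} (peak : Peak C B u a) {a′} (a′∈ : a′ ∈ B) (a′≢a : a′ ≢ a) where

    private
      O = classOf tidy u
      ν = C u ⊖ basis a
      a∈ = proj₁ peak

      ν-shift : ∀ i j → diff ν i j ≡ diff (C u) i j - diff (basis a) i j
      ν-shift = diff-⊖ (C u) (basis a)

    private
      on-ray : ∀ {v c} → Root (C v) (C u) c a → C v ≈ ν ⊕ basis c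
      on-ray {v} {c} r = diff≡⇒≈ (C v) (ν ⊕ basis c) a λ i → trans (shift r i a)
        (trans (lemma (diff (C u) i a) (basis c i) (basis a i) (basis c a) (basis a a))
          (sym (trans (diff-⊕ ν (basis c) i a) (cong (_+ diff (basis c) i a) (ν-shift i a)))))
        where
        lemma : ∀ d p q r s → d + ((p - q) - (r - s)) ≡ d - (q - s) + (p - r)
        lemma = solve-∀

      on-ray-self : C u ≈ ν ⊕ basis a
      on-ray-self = diff≡⇒≈ (C u) (ν ⊕ basis a) a λ i →
        sym (trans (diff-⊕ ν (basis a) i a) (trans (cong (_+ diff (basis a) i a) (ν-shift i a))
          (lemma (diff (C u) i a) (diff (basis a) i a))))
        where
        lemma : ∀ i j → i - j + j ≡ i
        lemma = solve-∀

    -- Let `x` be the member with its excess at `a′`. A member `v` other than `u` and `x` does not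
    -- tell `a` and `a′` apart, whereas `u` has difference 1. So the root leading from `u` to `v`
    -- removes 1 at `a` or adds 1 at `a′`. Adding at `a′` and removing at some `d` in `B` other than
    -- `a` is impossible, as `u` is constant on `B` off `a`.
    peak-members : ∀ {v} → v ∈ O → ∃ λ c → c ∈ B × (C v ≈ ν ⊕ basis c)
    peak-members {v} v∈ with ∈-comprehension⁻ (_~?_ tidy u) v∈
    ... | inj₁ refl = a , a∈ , on-ray-self
    ... | inj₂ (d , c , r) with peak-root peak a′∈ a′≢a
    ...   | x , rₓ with v Finₚ.≟ x
    ...     | yes refl = a′ , a′∈ , on-ray rₓ
    ...     | no v≢x = cases (root-difference<0 a a′ c d (subst (_< 0ℤ) (sym root≡) -<+))
      where
      r′ : Root (C v) (C u) c d
      r′ = Root-sym r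
      v≢u : v ≢ u
      v≢u = Root⇒u≢w {C = C} r′
      root≡ : diff (root c d) a a′ ≡ -1ℤ
      root≡ = trans (root-shift r′ a a′) (cong₂ _-_
        (trans (diff-flip (C v) a′ a) (cong -_ (others-vanish rₓ v≢x v≢u))) (proj₂ peak a′ a′∈ a′≢a))
      cases : a ≡ d ⊎ a′ ≡ c → ∃ λ c → c ∈ B × (C v ≈ ν ⊕ basis c)
      cases (inj₁ refl) = c , maximal r a∈ , on-ray r′
      cases (inj₂ refl) with d Finₚ.≟ a
      ... | yes refl = c , a′∈ , on-ray r′
      ... | no d≢a   = contradiction (trans (sym (down r′))
        (peak-flat peak a′∈ a′≢a (maximal r′ a′∈) d≢a)) λ ()

    peak-attained : ∀ {c} → c ∈ B → ∃ λ v → v ∈ O × (C v ≈ ν ⊕ basis c)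
    peak-attained {c} c∈ with c Finₚ.≟ a
    ... | yes refl = u , ∈-comprehension⁺ (_~?_ tidy u) (inj₁ refl) , on-ray-self
    ... | no c≢a   = let (x , r) = peak-root peak c∈ c≢a in
      x , ∈-comprehension⁺ (_~?_ tidy u) (inj₂ (a , c , Root-sym r)) , on-ray r

    peak-hasSign : HasSign C O B Sign.+
    peak-hasSign = ν , flat , peak-members , peak-attained
      where
      flat : ∀ {b c} → b ∈ B → c ∈ B → ν b ≡ ν c
      flat {b} {c} b∈ c∈ = ℤₚ.i-j≡0⇒i≡j _ _ (trans (diff-split ν b a c)
        (cong₂ _+_ (trans (diff-flip ν a b) (cong -_ (level b∈))) (level c∈)))
        where
        level : ∀ {b} → b ∈ B → diff ν a b ≡ 0ℤ
        level {b} b∈ with b Finₚ.≟ a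
        ... | yes refl = diff-self ν b
        ... | no b≢a   = trans (ν-shift a b) (cong₂ _-_ (proj₂ peak b b∈ b≢a)
          (cong₂ _-_ (basis-≡ a) (basis-≢ (b≢a ∘ sym))))

    peak-groundSet : IsGroundSet C O B
    peak-groundSet b = mk⇔ to from
      where
      member : ∀ {x c} → Root (C x) (C u) c a → x ∈ O
      member r = ∈-comprehension⁺ (_~?_ tidy u) (inj₂ (_ , _ , Root-sym r))
      u∈ : u ∈ O
      u∈ = ∈-comprehension⁺ (_~?_ tidy u) (inj₁ refl)
      to : b ∈ B → ∃₂ λ v w → v ∈ O × w ∈ O × ∃ λ c → b ≢ c × (C v ⊖ C w ≈ basis b ⊖ basis c)
      to b∈ with b Finₚ.≟ a
      ... | yes refl = let (x , r) = peak-root peak a′∈ a′≢a in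
        u , x , u∈ , member r , a′ , a′≢a ∘ sym , Root-difference (Root-sym r)
      ... | no b≢a = let (x , r) = peak-root peak b∈ b≢a in
        x , u , member r , u∈ , a , b≢a , Root-difference r
      from : (∃₂ λ v w → v ∈ O × w ∈ O × ∃ λ c → b ≢ c × (C v ⊖ C w ≈ basis b ⊖ basis c)) → b ∈ B
      from (v , w , v∈ , w∈ , c , b≢c , v-w) with peak-members v∈ | peak-members w∈
      ... | d , d∈ , v≈ | e , e∈ , w≈ = subst (_∈ B) (proj₁ (root-difference≥2 b c d e
        (ℤₚ.≤-reflexive (sym roots)))) d∈
        where
        -- Membership gives e_d - e_e for `C v ⊖ C w`, the assumption gives e_b - e_c. The latter
        -- has difference 2 at `b`, `c`, which forces d = b.
        roots : diff (root d e) b c ≡ ℤ.+ 2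
        roots = trans (lemma (diff ν b c) (basis d b) (basis e b) (basis d c) (basis e c)) (trans
          (sym (cong₂ _-_
            (trans (≈⇒diff≡ (C v) (ν ⊕ basis d) v≈ b c) (diff-⊕ ν (basis d) b c))
            (trans (≈⇒diff≡ (C w) (ν ⊕ basis e) w≈ b c) (diff-⊕ ν (basis e) b c))))
          (trans (sym (diff-⊖ (C v) (C w) b c)) (trans (≈⇒diff≡ (C v ⊖ C w) (root b c) v-w b c)
            (cong₂ _-_ (root-left b≢c) (root-right b≢c)))))
          where
          lemma : ∀ n p q r s → (p - q) - (r - s) ≡ (n + (p - r)) - (n + (q - s))
          lemma = solve-∀

HasSign-negate : {C : Fin n → P k} {O : Subset n} {B : Subset k} →
  HasSign (negate C) O B Sign.+ → HasSign C O B Sign.-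
HasSign-negate {C = C} {O = O} {B = B} (ν , flat , members , attained) =
  (λ a → - ν a) , (λ a∈ b∈ → cong -_ (flat a∈ b∈)) ,
  (λ v∈ → let (a , a∈ , eq) = members v∈ in a , a∈ , convert {a = a} eq) ,
  λ {a} a∈ → let (v , v∈ , eq) = attained a∈ in v , v∈ , convert {a = a} eq
  where
  convert : ∀ {v a} → negate C v ≈ ν ⊕ basis a → C v ≈ (λ a → - ν a) ⊕ (𝟎 ⊖ basis a)
  convert {v} {a} (c , eq) = - c , λ i → trans (sym (ℤₚ.neg-involutive (C v i)))
    (trans (cong -_ (eq i)) (lemma (ν i) (basis a i) c))
    where
    lemma : ∀ i j l → - (i + j + l) ≡ (- i + (0ℤ - j)) + - l
    lemma = solve-∀

IsClass-negate : {C : Fin n → P k} {O : Subset n} → IsClass (negate C) O → IsClass C O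
IsClass-negate {C = C} (nonempty , closed) = nonempty , λ u∈ → mk⇔
  (λ v∈ → EqClosure.map (λ {x} {y} → unnegate {x} {y}) (Equivalence.to (closed u∈) v∈))
  (λ c → Equivalence.from (closed u∈) (EqClosure.map (λ {x} {y} → toNegate {x} {y}) c))
  where
  unnegate : ∀ {u v} → RootConjugate (negate C u) (negate C v) → RootConjugate (C u) (C v)
  unnegate rc = let (_ , _ , r) = RootConjugate⇒Root rc in Root⇒RootConjugate (Root-unnegate C r)
  toNegate : ∀ {u v} → RootConjugate (C u) (C v) → RootConjugate (negate C u) (negate C v)
  toNegate rc = let (_ , _ , r) = RootConjugate⇒Root rc in Root⇒RootConjugate (Root-negate C r)

IsGroundSet-negate : {C : Fin n → P k} {O : Subset n} {B : Subset k} →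
  IsGroundSet (negate C) O B → IsGroundSet C O B
IsGroundSet-negate {C = C} ground a = mk⇔
  (λ a∈ → let (u , v , u∈ , v∈ , b , a≢b , (c , eq)) = Equivalence.to (ground a) a∈ in
    v , u , v∈ , u∈ , b , a≢b , c , λ i → trans (sym (lemma (C u i) (C v i))) (eq i))
  (λ (u , v , u∈ , v∈ , b , a≢b , (c , eq)) → Equivalence.from (ground a)
    (v , u , v∈ , u∈ , b , a≢b , c , λ i → trans (lemma (C v i) (C u i)) (eq i)))
  where
  lemma : ∀ i j → - i - - j ≡ j - i
  lemma = solve-∀

-- The dosp of a tidy separating family

-- A single test suffices: a block of Π(C) with at least three elements has a valley if it has no
-- peak, by `no-peak⇒valley`.
decoration : (C : Fin n → P k) → Subset k → Maybe Sign
decoration C B with ∣ B ∣ ℕ.≤? 2 | hasPeak? C B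
... | yes _ | _     = nothing
... | no _  | yes _ = just Sign.+
... | no _  | no _  = just Sign.-

decorate : (C : Fin n → P k) → Blocks k → Dosp k
decorate C = map λ B → B , decoration C B

module _ {C : Fin n → P k} (tidy : Tidy C) where

  decoration-decorated : ∀ {B} → Nonempty B → Joined C B → Decorated C (B , decoration C B)
  decoration-decorated {B} (b , b∈) joined with ∣ B ∣ ℕ.≤? 2 | hasPeak? C B
  ... | yes ≤2 | _ = small ≤2
  ... | no ≰2  | yes (u , a , peak) =
    let (a′ , a′∈ , a′≢a) = two-elements B (ℕₚ.<⇒≤ (ℕₚ.≰⇒> ≰2)) a in
    large (classOf tidy u) (ℕₚ.≰⇒> ≰2) (classOf-isClass tidy u)
      (peak-groundSet tidy joined peak a′∈ a′≢a) (peak-hasSign tidy joined peak a′∈ a′≢a)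
  ... | no ≰2  | no ¬peak =
    let (b′ , b′∈ , b′≢b)  = two-elements B (ℕₚ.<⇒≤ (ℕₚ.≰⇒> ≰2)) b
        (u , a , valley)   = Conjugacy.no-peak⇒valley tidy (Joined.join joined) ¬peak b′∈ b∈ b′≢b
        (a′ , a′∈ , a′≢a) = two-elements B (ℕₚ.<⇒≤ (ℕₚ.≰⇒> ≰2)) a
        tidy⁻  = Tidy-negate tidy
        joined⁻ = Joined-negate joined in
    large (classOf tidy⁻ u) (ℕₚ.≰⇒> ≰2) (IsClass-negate (classOf-isClass tidy⁻ u))
      (IsGroundSet-negate {C = C} (peak-groundSet tidy⁻ joined⁻ valley a′∈ a′≢a))
      (HasSign-negate {C = C} (peak-hasSign tidy⁻ joined⁻ valley a′∈ a′≢a))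

  module _ (separating : Separating C) {Π : Blocks k} (sorted : Sorted (total C) Π) where

    block-joined : ∀ {B} → B List.∈ Π → Joined C B
    block-joined {B} B∈ = record
      { join = λ {a} {b} a∈ b∈ a≢b → join a b (All.lookup (Sorted.level sorted) B∈ a b a∈ b∈) a≢b
      ; maximal = λ r a∈ → sorted-maximal sorted B∈ a∈ (sym (total-joined tidy r))
      }
      where
      join : ∀ a b → total C a ≡ total C b → a ≢ b → ∃₂ λ u w → Root (C u) (C w) a b
      join a b eq a≢b with compare tidy separating a b a≢b
      ... | conjugate r         = _ , _ , r
      ... | above ≥ (u , lt) = contradiction (sym eq) (ℤₚ.<⇒≢ (sum-mono-< ≥ u lt))
      ... | below ≥ (u , lt) = contradiction eq (ℤₚ.<⇒≢ (sum-mono-< ≥ u lt))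

    decorate-isDosp : IsDospOf C (decorate C Π)
    decorate-isDosp = record
      { partition = subst (IsOSPOfCluster C)
          (sym (trans (sym (Listₚ.map-∘ Π)) (Listₚ.map-id Π))) (sorted⇒isOSPOfCluster tidy separating sorted)
      ; signs = Allₚ.map⁺ (All.tabulate λ B∈ →
          decoration-decorated (All.lookup (Sorted.nonempty sorted) B∈) (block-joined B∈))
      }

-- Merging adjacent blocks

∈-singleton : {a b : Fin k} → b ≡ a → b ∈ ⁅ a ⁆
∈-singleton {a = a} refl = x∈⁅x⁆ a

Sorted-cong : {f g : Fin k → ℤ} {Π : Blocks k} → (∀ a → f a ≡ g a) → Sorted f Π → Sorted g Π
Sorted-cong eq s = record
  { nonempty   = nonempty
  ; level      = All.map (λ l a b a∈ b∈ → trans (sym (eq a)) (trans (l a b a∈ b∈) (eq b))) level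
  ; descending = AllPairs.map (λ h a b a∈ b∈ → subst₂ _<_ (eq b) (eq a) (h a b a∈ b∈)) descending
  ; cover      = cover
  }
  where open Sorted s

Sorted-coarsen : {f g : Fin k → ℤ} {Π : Blocks k} → (∀ a b → f a ≡ f b → g a ≡ g b) →
  (∀ a b → f b < f a → g b < g a) → Sorted f Π → Sorted g Π
Sorted-coarsen flat strict s = record
  { nonempty   = nonempty
  ; level      = All.map (λ l a b a∈ b∈ → flat a b (l a b a∈ b∈)) level
  ; descending = AllPairs.map (λ h a b a∈ b∈ → strict a b (h a b a∈ b∈)) descending
  ; cover      = cover
  }
  where open Sorted s

module _ {f g : Fin k → ℤ} {X Y : Subset k}
  (flat : ∀ a b → f a ≡ f b → g a ≡ g b)
  (merged : ∀ a b → a ∈ X → b ∈ Y → g a ≡ g b)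
  (strict : ∀ a b → f b < f a → ¬ (a ∈ X × b ∈ Y) → g b < g a) where

  private
    ∪-level : Level f X → Level f Y → Level g (X ∪ Y)
    ∪-level lX lY a b a∈ b∈ with x∈p∪q⁻ X Y a∈ | x∈p∪q⁻ X Y b∈
    ... | inj₁ a∈X | inj₁ b∈X = flat a b (lX a b a∈X b∈X)
    ... | inj₁ a∈X | inj₂ b∈Y = merged a b a∈X b∈Y
    ... | inj₂ a∈Y | inj₁ b∈X = sym (merged b a b∈X a∈Y)
    ... | inj₂ a∈Y | inj₂ b∈Y = flat a b (lY a b a∈Y b∈Y)

    beforeX : ∀ {B B′} → Above f B X → Above f B B′ → Above g B B′
    beforeX hX h a b a∈ b∈ = strict a b (h a b a∈ b∈) λ (a∈X , _) → ℤₚ.<-irrefl refl (hX a a a∈ a∈X)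

    afterY : ∀ {B B′} → Above f Y B′ → Above f B B′ → Above g B B′
    afterY hY h a b a∈ b∈ = strict a b (h a b a∈ b∈) λ (_ , b∈Y) → ℤₚ.<-irrefl refl (hY b b b∈Y b∈)

    ∪-below : ∀ {B} → Above f B X → Above f B Y → Above g B (X ∪ Y)
    ∪-below hX hY a b a∈ b∈ with x∈p∪q⁻ X Y b∈
    ... | inj₁ b∈X = beforeX hX hX a b a∈ b∈X
    ... | inj₂ b∈Y = beforeX hX hY a b a∈ b∈Y

    ∪-above : ∀ {B} → Above f X B → Above f Y B → Above g (X ∪ Y) B
    ∪-above hX hY a b a∈ b∈ with x∈p∪q⁻ X Y a∈
    ... | inj₁ a∈X = afterY hY hX a b a∈X b∈
    ... | inj₂ a∈Y = afterY hY hY a b a∈Y b∈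

    afterY-all : ∀ {Ψ} → All (Above f Y) Ψ → AllPairs (Above f) Ψ → AllPairs (Above g) Ψ
    afterY-all []       []       = []
    afterY-all (hY ∷ hYs) (h ∷ hs) = go hYs h ∷ afterY-all hYs hs
      where
      go : ∀ {B Ψ} → All (Above f Y) Ψ → All (Above f B) Ψ → All (Above g B) Ψ
      go []         []       = []
      go (hY ∷ hYs) (h ∷ hs) = afterY hY h ∷ go hYs hs

    ∪-above-all : ∀ {Ψ} → All (Above f X) Ψ → All (Above f Y) Ψ → All (Above g (X ∪ Y)) Ψ
    ∪-above-all []         []         = []
    ∪-above-all (hX ∷ hXs) (hY ∷ hYs) = ∪-above hX hY ∷ ∪-above-all hXs hYs

    merge-descending : ∀ Φ {Ψ} → AllPairs (Above f) (Φ ++ X ∷ Y ∷ Ψ) → AllPairs (Above g) (Φ ++ (X ∪ Y) ∷ Ψ)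
    merge-descending [] ((_ ∷ hX) ∷ hY ∷ hs) = ∪-above-all hX hY ∷ afterY-all hY hs
    merge-descending (B ∷ Φ) (h ∷ hs) with Allₚ.++⁻ʳ Φ h
    ... | hX ∷ hY ∷ hΨ = Allₚ.++⁺ (All.map (beforeX hX) (Allₚ.++⁻ˡ Φ h)) (∪-below hX hY ∷ All.map (beforeX hX) hΨ)
      ∷ merge-descending Φ hs

  -- Strictness may fail only on X × Y. Any two blocks other than this pair include one strictly
  -- above X or one strictly below Y, hence avoid X × Y.
  Sorted-merge : ∀ Φ {Ψ} → Sorted f (Φ ++ X ∷ Y ∷ Ψ) → Sorted g (Φ ++ (X ∪ Y) ∷ Ψ)
  Sorted-merge Φ {Ψ} s = record
    { nonempty   = merge-all (λ (a , a∈) _ → a , p⊆p∪q Y a∈) nonempty (λ z → z)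
    ; level      = merge-all ∪-level level (λ l a b a∈ b∈ → flat a b (l a b a∈ b∈))
    ; descending = merge-descending Φ descending
    ; cover      = λ a → merge-any (Anyₚ.++⁻ Φ (cover a))
    }
    where
    open Sorted s
    merge-all : {P Q : Subset k → Set} → (P X → P Y → Q (X ∪ Y)) → All P (Φ ++ X ∷ Y ∷ Ψ) →
      (∀ {B} → P B → Q B) → All Q (Φ ++ (X ∪ Y) ∷ Ψ)
    merge-all h ps weaken with Allₚ.++⁻ Φ ps
    ... | pΦ , pX ∷ pY ∷ pΨ = Allₚ.++⁺ (All.map weaken pΦ) (h pX pY ∷ All.map weaken pΨ)
    merge-any : ∀ {a} → Any (a ∈_) Φ ⊎ Any (a ∈_) (X ∷ Y ∷ Ψ) → Any (a ∈_) (Φ ++ (X ∪ Y) ∷ Ψ)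
    merge-any (inj₁ a∈)                  = Anyₚ.++⁺ˡ a∈
    merge-any (inj₂ (here a∈))           = Anyₚ.++⁺ʳ Φ (here (p⊆p∪q Y a∈))
    merge-any (inj₂ (there (here a∈)))   = Anyₚ.++⁺ʳ Φ (here (q⊆p∪q X Y a∈))
    merge-any (inj₂ (there (there a∈)))  = Anyₚ.++⁺ʳ Φ (there a∈)

-- Exchanging one vector

-- The vector at `v` becomes zero instead of being dropped: the index set is kept, and a zero vector
-- compares no coordinates.
without : Fin n → (Fin n → P k) → Fin n → P k
without v C u = if does (u Finₚ.≟ v) then 𝟎 else C u

without-≡ : ∀ {v : Fin n} {C : Fin n → P k} → without v C v ≡ 𝟎
without-≡ {v = v} with v Finₚ.≟ v
... | yes _  = refl
... | no v≢v = contradiction refl v≢v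

without-≢ : ∀ {v u : Fin n} {C : Fin n → P k} → u ≢ v → without v C u ≡ C u
without-≢ {v = v} {u} u≢v with u Finₚ.≟ v
... | yes u≡v = contradiction u≡v u≢v
... | no _    = refl

-- An oriented relation: the vectors other than `v` place `a` above `b`, by `merged-above`, and only
-- `v` opposes, so that the totals at `a` and `b` become equal.
Merged : Fin n → (Fin n → P k) → Fin k → Fin k → Set
Merged v C a b = ∃ λ w → Root (C w) (C v) a b

-- What the comparison of the two dosps needs to know of a mutation at `v`. It is symmetric in the
-- two families and no longer mentions quivers.
record Exchange (v : Fin n) (C C′ : Fin n → P k) : Set where
  field
    agree     : ∀ {u} → u ≢ v → ∀ a → C u a ≡ C′ u a
    tidy      : Tidy C
    tidy′     : Tidy C′
    separated : ∀ a b → a ≢ b → ∃ λ u → u ≢ v × diff (C u) a b ≢ 0ℤ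
    turn      : ∀ {a b} → Merged v C a b → diff (C′ v) a b ≡ 1ℤ
    turn′     : ∀ {a b} → Merged v C′ a b → diff (C v) a b ≡ 1ℤ
    cross     : ∀ {a b c d} → Merged v C a b → Merged v C′ c d → b ≡ c ⊎ a ≡ d

Exchange-sym : {v : Fin n} {C C′ : Fin n → P k} → Exchange v C C′ → Exchange v C′ C
Exchange-sym {v = v} {C} {C′} ex = record
  { agree     = λ u≢v a → sym (agree u≢v a)
  ; tidy      = tidy′
  ; tidy′     = tidy
  ; separated = λ a b a≢b → let (u , u≢v , d≢0) = separated a b a≢b in
      u , u≢v , λ d≡0 → d≢0 (trans (cong₂ _-_ (agree u≢v a) (agree u≢v b)) d≡0)
  ; turn      = turn′
  ; turn′     = turn
  ; cross     = λ m m′ → flip (cross m′ m)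
  }
  where
  open Exchange ex
  flip : ∀ {a b c d : Fin _} → d ≡ a ⊎ c ≡ b → b ≡ c ⊎ a ≡ d
  flip (inj₁ p) = inj₂ (sym p)
  flip (inj₂ p) = inj₁ (sym p)

module _ {v : Fin n} {C C′ : Fin n → P k} (ex : Exchange v C C′) where
  open Exchange ex
  open Tidy tidy

  -- The blocks by this sum, the base blocks, refine those of both families: v can
  -- only merge them.
  base-total : P k
  base-total = total (without v C)

  private
    C° = without v C

    off : ∀ {u} → u ≢ v → C° u ≡ C u
    off = without-≢ {C = C}

    vanish : ∀ a b → diff (C° v) a b ≡ 0ℤ
    vanish a b = cong (λ μ → diff μ a b) (without-≡ {v = v} {C})

    Root-≢ : ∀ u w {a b} → Root (C° u) (C° w) a b → u ≢ v × w ≢ v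
    Root-≢ u w {a} {b} r =
      (λ { refl → contradiction (trans (sym (up r)) (vanish a b)) λ () }) ,
      (λ { refl → contradiction (trans (sym (down r)) (vanish a b)) λ () })

    Root-without⁻ : ∀ u w {a b} → Root (C° u) (C° w) a b → Root (C u) (C w) a b
    Root-without⁻ u w {a} {b} r = let (u≢v , w≢v) = Root-≢ u w r in
      subst₂ (λ λ₁ μ → Root λ₁ μ a b) (off u≢v) (off w≢v) r

    tidy° : Tidy C°
    tidy° = record
      { disagree⇒Root = λ u w a b 0<d d<0 →
          let u≢v : u ≢ v
              u≢v = λ { refl → ℤₚ.<-irrefl (sym (vanish a b)) 0<d }
              w≢v : w ≢ v
              w≢v = λ { refl → ℤₚ.<-irrefl (vanish a b) d<0 }
          in subst₂ (λ λ₁ μ → Root λ₁ μ a b) (sym (off u≢v)) (sym (off w≢v))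
            (disagree⇒Root u w a b (subst (λ μ → 0ℤ < diff μ a b) (off u≢v) 0<d)
              (subst (λ μ → diff μ a b < 0ℤ) (off w≢v) d<0))
      ; unique = λ {u} {w} {x} {a} {b} r eq →
          let (u≢v , _) = Root-≢ u w r
              x≢v : x ≢ v
              x≢v = λ { refl → contradiction (trans (sym (up r)) (trans (eq a b) (vanish a b))) λ () }
          in unique (Root-without⁻ u w r) λ i j → trans (cong (λ μ → diff μ i j) (sym (off u≢v)))
            (trans (eq i j) (cong (λ μ → diff μ i j) (off x≢v)))
      }

    separating° : Separating C°
    separating° a b a≢b = let (u , u≢v , d≢0) = separated a b a≢b in
      u , λ d≡0 → d≢0 (trans (cong (λ μ → diff μ a b) (sym (off u≢v))) d≡0)

  exchange-separating : Separating C
  exchange-separating a b a≢b = let (u , _ , d≢0) = separated a b a≢b in u , d≢0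

  base-conjugated : ∀ a b → a ≢ b → base-total a ≡ base-total b →
    ∃₂ λ u w → u ≢ v × w ≢ v × Root (C u) (C w) a b
  base-conjugated a b a≢b eq with compare tidy° separating° a b a≢b
  ... | conjugate {u} {w} r = let (u≢v , w≢v) = Root-≢ u w r in u , w , u≢v , w≢v , Root-without⁻ u w r
  ... | above ≥ (u , lt) = contradiction (sym eq) (ℤₚ.<⇒≢ (sum-mono-< ≥ u lt))
  ... | below ≥ (u , lt) = contradiction eq (ℤₚ.<⇒≢ (sum-mono-< ≥ u lt))

  base-flat : ∀ a b → base-total a ≡ base-total b → total C a ≡ total C b
  base-flat a b eq with a Finₚ.≟ b
  ... | yes refl = refl
  ... | no a≢b   = let (_ , _ , _ , _ , r) = base-conjugated a b a≢b eq in total-joined tidy r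

  -- No vector other than `v` places `b` above `a`, and some `u` places it strictly below. Only `v`
  -- can object, and then it is root-conjugate to `u` through `a` and `b`.
  base-strict : ∀ a b → base-total b < base-total a → Merged v C a b ⊎ total C b < total C a
  base-strict a b lt with compare tidy° separating° a b (λ { refl → ℤₚ.<-irrefl refl lt })
  ... | conjugate {u} {w} r = contradiction (sym (total-joined tidy° {u} {w} r)) (ℤₚ.<⇒≢ lt)
  ... | below ≥ (u , _) = contradiction lt (ℤₚ.≤⇒≯ (sum-mono-≤ ≥))
  ... | above ≥ (u , gt) with C v a ℤₚ.<? C v b
  ...   | yes dn = inj₁ (u , disagree⇒Root u v a b (0<diff⁺ (C u) a b (subst (λ μ → μ b < μ a) (off u≢v) gt))
      (diff<0⁺ (C v) a b dn))
    where
    u≢v : u ≢ v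
    u≢v refl = ℤₚ.<-irrefl (cong (λ μ → μ b) (without-≡ {v = v} {C}))
      (subst (C° v b <_) (cong (λ μ → μ a) (without-≡ {v = v} {C})) gt)
  ...   | no ¬dn = inj₂ (sum-mono-< everywhere u (subst (λ μ → μ b < μ a) (off u≢v) gt))
    where
    u≢v : u ≢ v
    u≢v refl = ℤₚ.<-irrefl (cong (λ μ → μ b) (without-≡ {v = v} {C}))
      (subst (C° v b <_) (cong (λ μ → μ a) (without-≡ {v = v} {C})) gt)
    everywhere : ∀ x → C x b ≤ C x a
    everywhere x with x Finₚ.≟ v
    ... | yes refl = ℤₚ.≮⇒≥ ¬dn
    ... | no x≢v   = subst (λ μ → μ b ≤ μ a) (off x≢v) (≥ x)

  -- Among the vectors other than `v`, only `w` tells `a` and `b` apart.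
  merged-above : ∀ {a b} → Merged v C a b → base-total b < base-total a
  merged-above {a} {b} (w , r) = sum-mono-< everywhere w (subst (λ μ → μ b < μ a) (sym (off w≢v))
      (0<diff⁻ (C w) a b (subst (0ℤ <_) (sym (up r)) (+<+ (s≤s z≤n)))))
    where
    w≢v = Root⇒u≢w {C = C} r
    everywhere : ∀ x → C° x b ≤ C° x a
    everywhere x with x Finₚ.≟ v
    ... | yes refl = ℤₚ.≤-refl
    ... | no x≢v with x Finₚ.≟ w
    ...   | yes refl = ℤₚ.<⇒≤ (0<diff⁻ (C w) a b (subst (0ℤ <_) (sym (up r)) (+<+ (s≤s z≤n))))
    ...   | no x≢w   = ℤₚ.≤-reflexive (sym (ℤₚ.i-j≡0⇒i≡j _ _ (others-vanish r x≢w x≢v)))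

  merged? : ∀ a b → Dec (Merged v C a b)
  merged? a b = Finₚ.any? λ w → Root? tidy w v a b

  total-≤ : ∀ a b → base-total b ≤ base-total a → total C b ≤ total C a
  total-≤ a b le with ℤₚ.<-cmp (base-total b) (base-total a)
  ... | tri≈ _ eq _ = ℤₚ.≤-reflexive (base-flat b a eq)
  ... | tri> _ _ gt = contradiction le (ℤₚ.<⇒≱ gt)
  ... | tri< lt _ _ with base-strict a b lt
  ...   | inj₁ (_ , r) = ℤₚ.≤-reflexive (sym (total-joined tidy r))
  ...   | inj₂ lt′     = ℤₚ.<⇒≤ lt′

  total≡⇒merged : ∀ a b → base-total b < base-total a → total C a ≡ total C b → Merged v C a b
  total≡⇒merged a b lt eq with base-strict a b lt
  ... | inj₁ m   = m
  ... | inj₂ lt′ = contradiction (sym eq) (ℤₚ.<⇒≢ lt′)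

  -- A peak of a base block cannot be v, hence survives the exchange.
  base-hasPeak : ∀ {B} → Level base-total B → 2 ℕ.≤ ∣ B ∣ → HasPeak C B → HasPeak C′ B
  base-hasPeak {B} level 2≤ (u , a , a∈ , top) = u , a , a∈ , λ b b∈ b≢a →
    trans (cong₂ _-_ (sym (agree u≢v a)) (sym (agree u≢v b))) (top b b∈ b≢a)
    where
    u≢v : u ≢ v
    u≢v refl with two-elements B 2≤ a
    ... | b , b∈ , b≢a with base-conjugated a b (b≢a ∘ sym) (level a b a∈ b∈)
    ...   | _ , _ , x≢v , y≢v , r = contradiction
      (trans (sym (top b b∈ b≢a)) (others-vanish r (x≢v ∘ sym) (y≢v ∘ sym))) λ ()

-- Decorated blocks under an exchange

AllPairs-++⁻ : {A : Set} {R : A → A → Set} → ∀ xs {ys} → AllPairs R (xs ++ ys) →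
  AllPairs R ys × All (λ x → All (R x) ys) xs
AllPairs-++⁻ []       rs       = rs , []
AllPairs-++⁻ (x ∷ xs) (r ∷ rs) = let (h , h′) = AllPairs-++⁻ xs rs in h , Allₚ.++⁻ʳ xs r ∷ h′

nonempty⇒1≤∣p∣ : {B : Subset k} → Nonempty B → 1 ℕ.≤ ∣ B ∣
nonempty⇒1≤∣p∣ {B = B} (a , a∈) = subst (ℕ._≤ ∣ B ∣) (∣⁅x⁆∣≡1 a)
  (p⊆q⇒∣p∣≤∣q∣ λ {b} b∈ → subst (_∈ B) (sym (x∈⁅y⁆⇒x≡y a b∈)) a∈)

block-⊥ : ∀ ε → block {k} Subset.⊥ ε ≡ []
block-⊥ {k} ε with ∣ Subset.⊥ {k} ∣ | ∣⊥∣≡0 k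
... | 0 | refl = refl

block-small : (B : Subset k) → ∀ ε → 1 ℕ.≤ ∣ B ∣ → ∣ B ∣ ℕ.≤ 2 → block B ε ≡ (B , nothing) ∷ []
block-small B ε 1≤ ≤2 with ∣ B ∣
... | 1 = refl
... | 2 = refl
block-small B ε 1≤ (s≤s (s≤s ())) | suc (suc (suc _))

block-large : (B : Subset k) → ∀ ε → 3 ℕ.≤ ∣ B ∣ → block B ε ≡ (B , just ε) ∷ []
block-large B ε 3≤ with ∣ B ∣
block-large B ε (s≤s (s≤s (s≤s _))) | suc (suc (suc _)) = refl

module _ (C : Fin n → P k) (B : Subset k) where

  decoration-small : ∣ B ∣ ℕ.≤ 2 → decoration C B ≡ nothing
  decoration-small ≤2 with ∣ B ∣ ℕ.≤? 2
  ... | yes _ = refl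
  ... | no ≰2 = contradiction ≤2 ≰2

  decoration-peak : 3 ℕ.≤ ∣ B ∣ → HasPeak C B → decoration C B ≡ just Sign.+
  decoration-peak 3≤ peak with ∣ B ∣ ℕ.≤? 2 | hasPeak? C B
  ... | yes ≤2 | _        = contradiction 3≤ (ℕₚ.≤⇒≯ ≤2)
  ... | no _   | yes _    = refl
  ... | no _   | no ¬peak = contradiction peak ¬peak

  decoration-no-peak : 3 ℕ.≤ ∣ B ∣ → ¬ HasPeak C B → decoration C B ≡ just Sign.-
  decoration-no-peak 3≤ ¬peak with ∣ B ∣ ℕ.≤? 2 | hasPeak? C B
  ... | yes ≤2 | _        = contradiction 3≤ (ℕₚ.≤⇒≯ ≤2)
  ... | no _   | yes peak = contradiction peak ¬peak
  ... | no _   | no _     = refl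

  decorate-block : ∀ ε → Nonempty B → (3 ℕ.≤ ∣ B ∣ → decoration C B ≡ just ε) →
    decorate C (B ∷ []) ≡ block B ε
  decorate-block ε nonempty large≡ with ℕₚ.≤-<-connex ∣ B ∣ 2
  ... | inj₁ ≤2 = trans (cong (λ d → (B , d) ∷ []) (decoration-small ≤2))
    (sym (block-small B ε (nonempty⇒1≤∣p∣ nonempty) ≤2))
  ... | inj₂ 3≤ = trans (cong (λ d → (B , d) ∷ []) (large≡ 3≤)) (sym (block-large B ε 3≤))

Peak-⊆ : (C : Fin n → P k) {B B′ : Subset k} → B′ ⊆ B → ∀ {u a} → a ∈ B′ → Peak C B u a → Peak C B′ u a
Peak-⊆ C B′⊆B a∈ (_ , top) = a∈ , λ b b∈ → top b (B′⊆B b∈)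

-- The peak may sit at an element `a` outside `B′`; its excess is first moved to an element of `B′`.
HasPeak-⊆ : {C : Fin n → P k} → Tidy C → {B B′ : Subset k} → Conjugated C B → B′ ⊆ B → Nonempty B′ →
  ∀ {u a} → Peak C B u a → a ∉ B′ → HasPeak C B′
HasPeak-⊆ {C = C} tidy join B′⊆B (b , b∈) {u} {a} peak a∉ =
  let (x , r) = Conjugacy.peak-root tidy join peak (B′⊆B b∈) (λ { refl → a∉ b∈ }) in
  x , b , Peak-⊆ C B′⊆B b∈ (Conjugacy.peak-spread tidy join peak (B′⊆B b∈) r)

module _ {v : Fin n} {C C′ : Fin n → P k} (ex : Exchange v C C′) where
  open Exchange ex

  base-total-sym : ∀ a → base-total ex a ≡ base-total (Exchange-sym ex) a
  base-total-sym a = sum-cong-≗ λ u → helper u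
    where
    helper : ∀ u → without v C u a ≡ without v C′ u a
    helper u with u Finₚ.≟ v
    ... | yes _  = refl
    ... | no u≢v = agree u≢v a

  merged-peak : ∀ {B a} → a ∈ B → (∀ b → b ∈ B → b ≢ a → Merged v C b a) → Peak C B v a
  merged-peak {a = a} a∈ merged = a∈ , λ b b∈ b≢a → let (_ , r) = merged b b∈ b≢a in
    trans (diff-flip (C v) b a) (cong -_ (down r))

  merged-valley : ∀ {B a} → a ∈ B → (∀ b → b ∈ B → b ≢ a → Merged v C a b) → Peak (negate C) B v a
  merged-valley {a = a} a∈ merged = a∈ , λ b b∈ b≢a → let (_ , r) = merged b b∈ b≢a in
    trans (diff-negate C v a b) (trans (diff-flip (C v) a b) (cong -_ (down r)))

module _ {v : Fin n} {C C′ : Fin n → P k} (ex : Exchange v C C′) where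
  open Exchange ex

  private
    ex′ = Exchange-sym ex
    T = base-total ex

  base-level-sym : ∀ {B} → Level T B → Level (base-total ex′) B
  base-level-sym l a b a∈ b∈ = trans (sym (base-total-sym ex a)) (trans (l a b a∈ b∈) (base-total-sym ex b))

  decoration-exchange : ∀ {B} → Level T B → decoration C B ≡ decoration C′ B
  decoration-exchange {B} level with ∣ B ∣ ℕ.≤? 2 | hasPeak? C B | hasPeak? C′ B
  ... | yes _  | _        | _        = refl
  ... | no _   | yes _    | yes _    = refl
  ... | no ≰2  | yes peak | no ¬peak =
    contradiction (base-hasPeak ex level (ℕₚ.<⇒≤ (ℕₚ.≰⇒> ≰2)) peak) ¬peak
  ... | no ≰2  | no ¬peak | yes peak =
    contradiction (base-hasPeak ex′ (base-level-sym level) (ℕₚ.<⇒≤ (ℕₚ.≰⇒> ≰2)) peak) ¬peak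
  ... | no _   | no _     | no _     = refl

  decorate-exchange : ∀ {Π} → All (Level T) Π → decorate C Π ≡ decorate C′ Π
  decorate-exchange levels = Listₚ.map-cong-local (All.map (λ l → cong (_ ,_) (decoration-exchange l)) levels)

  exchange-strict : (∀ a b → ¬ Merged v C a b) → ∀ {Π} → Sorted T Π → Sorted (total C) Π
  exchange-strict ¬merged = Sorted-coarsen (base-flat ex) strict
    where
    strict : ∀ a b → T b < T a → total C b < total C a
    strict a b lt with base-strict ex a b lt
    ... | inj₁ m = contradiction m (¬merged a b)
    ... | inj₂ h = h

  exchange-merge : ∀ {X Y} → (∀ a b → a ∈ X → b ∈ Y → Merged v C a b) →
    (∀ a b → Merged v C a b → a ∈ X × b ∈ Y) →
    ∀ Φ {Ψ} → Sorted T (Φ ++ X ∷ Y ∷ Ψ) → Sorted (total C) (Φ ++ (X ∪ Y) ∷ Ψ)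
  exchange-merge {X} {Y} merged inside = Sorted-merge (base-flat ex)
    (λ a b a∈ b∈ → let (_ , r) = merged a b a∈ b∈ in total-joined tidy r) strict
    where
    strict : ∀ a b → T b < T a → ¬ (a ∈ X × b ∈ Y) → total C b < total C a
    strict a b lt out with base-strict ex a b lt
    ... | inj₁ m = contradiction (inside a b m) out
    ... | inj₂ h = h

-- An exchange in which the family C merges base blocks L | {a} and C′ merges
-- base blocks {a} | R; one of L and R may be absent.
module _ {v : Fin n} {C C′ : Fin n → P k} (ex : Exchange v C C′) (a : Fin k)
  (left  : ∀ {x y} → Merged v C x y → y ≡ a)
  (right : ∀ {x y} → Merged v C′ x y → x ≡ a)
  (alone : ∀ b → base-total ex b ≡ base-total ex a → b ≡ a) where
  open Exchange ex

  private
    ex′ = Exchange-sym ex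
    T = base-total ex

    above-left : ∀ {b} → Merged v C b a → T a < T b
    above-left = merged-above ex

    below-right : ∀ {b} → Merged v C′ a b → T b < T a
    below-right {b} m = subst₂ _<_ (sym (base-total-sym ex b)) (sym (base-total-sym ex a))
      (merged-above ex′ m)

    -- Totals are weakly monotone in the base order and agree at `b` and `a`, so a coordinate `c` in
    -- between has the same total. Then `b` is merged with `c`, and `left` gives c = a.
    no-between-left : ∀ {b c} → Merged v C b a → T c < T b → ¬ T a < T c
    no-between-left {b} {c} m@(_ , r) c<b a<c = ℤₚ.<-irrefl (cong T (sym (left (total≡⇒merged ex b c c<b
      (ℤₚ.≤-antisym (subst (_≤ total C c) (sym (total-joined tidy r)) (total-≤ ex c a (ℤₚ.<⇒≤ a<c)))
        (total-≤ ex b c (ℤₚ.<⇒≤ c<b))))))) a<c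

    T⇒T′ : ∀ {b c} → T b < T c → base-total ex′ b < base-total ex′ c
    T⇒T′ {b} {c} = subst₂ _<_ (base-total-sym ex b) (base-total-sym ex c)

    no-between-right : ∀ {b c} → Merged v C′ a b → T b < T c → ¬ T c < T a
    no-between-right {b} {c} m@(_ , r) b<c c<a = ℤₚ.<-irrefl (cong T (right (total≡⇒merged ex′ c b (T⇒T′ b<c)
      (ℤₚ.≤-antisym (subst (total C′ c ≤_) (total-joined tidy′ r) (total-≤ ex′ a c (ℤₚ.<⇒≤ (T⇒T′ c<a))))
        (total-≤ ex′ c b (ℤₚ.<⇒≤ (T⇒T′ b<c))))))) c<a

    merged-level-left : ∀ {b c} → Merged v C b a → T c ≡ T b → Merged v C c a
    merged-level-left {b} {c} m@(_ , r) eq = total≡⇒merged ex c a (subst (T a <_) (sym eq) (above-left m))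
      (trans (base-flat ex c b eq) (total-joined tidy r))

    merged-level-right : ∀ {b c} → Merged v C′ a b → T c ≡ T b → Merged v C′ a c
    merged-level-right {b} {c} m@(_ , r) eq = total≡⇒merged ex′ a c
      (T⇒T′ (subst (_< T a) (sym eq) (below-right m)))
      (trans (total-joined tidy′ r) (base-flat ex′ b c
        (trans (sym (base-total-sym ex b)) (trans (sym eq) (base-total-sym ex c)))))

    -- An absent block is represented by the empty set. Thus `L ∪ ⁅ a ⁆` and `block L` have a
    -- meaning whether or not L is a block, as in the definition of dosp mutations.
    data AtMostOne : Blocks k → Subset k → Set where
      none : AtMostOne [] Subset.⊥
      one  : ∀ {B} → AtMostOne (B ∷ []) B

    record LeftSplit (Φ⁺ : Blocks k) : Set where
      field
        {Φ Ls}  : Blocks k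
        {L}     : Subset k
        form    : AtMostOne Ls L
        split   : Φ⁺ ≡ Φ ++ Ls
        members : ∀ b → b ∈ L ⇔ Merged v C b a

    record RightSplit (Ψ⁺ : Blocks k) : Set where
      field
        {Ψ Rs}  : Blocks k
        {R}     : Subset k
        form    : AtMostOne Rs R
        split   : Ψ⁺ ≡ Rs ++ Ψ
        members : ∀ b → b ∈ R ⇔ Merged v C′ a b

    below-a : ∀ {Ψ b} → All (Above T ⁅ a ⁆) Ψ → Any (b ∈_) Ψ → T b < T a
    below-a h b∈ = let (hb , b∈B) = All.lookupAny h b∈ in hb a _ (x∈⁅x⁆ a) b∈B

    -- If anything is merged with `a` in C, it lies in the block directly before that of `a`, by
    -- `no-between-left`; the rest of this block is merged as well, being level with it.
    leftSplit : ∀ Φ⁺ {Ψ⁺} → Sorted T (Φ⁺ ++ ⁅ a ⁆ ∷ Ψ⁺) → LeftSplit Φ⁺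
    leftSplit Φ⁺ s with Finₚ.any? (λ b → merged? ex b a)
    ... | no ¬m = record { Φ = Φ⁺ ; form = none ; split = sym (Listₚ.++-identityʳ Φ⁺)
      ; members = λ b → mk⇔ (λ b∈ → contradiction b∈ ∉⊥) (λ m → contradiction (b , m) ¬m) }
    ... | yes (b , m) with initLast Φ⁺
    leftSplit .[] s | yes (b , m) | [] with Sorted.descending s | Sorted.cover s b
    ... | h ∷ _ | here b∈   = contradiction (cong T (sym (x∈⁅y⁆⇒x≡y a b∈))) (ℤₚ.<⇒≢ (above-left m))
    ... | h ∷ _ | there b∈  = contradiction (below-a h b∈) (ℤₚ.<-asym (above-left m))
    leftSplit .(Φ ++ L ∷ []) {Ψ⁺} s | yes (b , m) | Φ ∷ʳ′ L
      rewrite Listₚ.++-assoc Φ (L ∷ []) (⁅ a ⁆ ∷ Ψ⁺) = record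
      { form = one ; split = refl ; members = λ c → mk⇔
        (λ c∈ → merged-level-left m (All.head level-L c b c∈ (inL m)))
        inL }
      where
      open Sorted s
      level-L = Allₚ.++⁻ʳ Φ level
      order = AllPairs-++⁻ Φ descending
      inL : ∀ {b} → Merged v C b a → b ∈ L
      inL {b} m with Anyₚ.++⁻ Φ (cover b) | proj₁ order | All.head (Allₚ.++⁻ʳ Φ nonempty)
      ... | inj₂ (here b∈)          | _           | _        = b∈
      ... | inj₂ (there (here b∈))  | _           | _        =
        contradiction (cong T (sym (x∈⁅y⁆⇒x≡y a b∈))) (ℤₚ.<⇒≢ (above-left m))
      ... | inj₂ (there (there b∈)) | _ ∷ (h ∷ _) | _        =
        contradiction (below-a h b∈) (ℤₚ.<-asym (above-left m))
      ... | inj₁ b∈                 | (h ∷ _) ∷ _ | (l , l∈) =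
        let (hb , b∈B) = All.lookupAny (proj₂ order) b∈ in
        contradiction (h l a l∈ (x∈⁅x⁆ a)) (no-between-left m (All.head hb b l b∈B l∈))

    rightSplit : ∀ Φ⁺ Ψ⁺ → Sorted T (Φ⁺ ++ ⁅ a ⁆ ∷ Ψ⁺) → RightSplit Ψ⁺
    rightSplit Φ⁺ Ψ⁺ s with Finₚ.any? (λ b → merged? ex′ a b)
    ... | no ¬m = record { Ψ = Ψ⁺ ; form = none ; split = refl
      ; members = λ b → mk⇔ (λ b∈ → contradiction b∈ ∉⊥) (λ m → contradiction (b , m) ¬m) }
    ... | yes (b , m) = fromMerged Ψ⁺ s
      where
      above-a : ∀ {Φ Ψ b} → All (λ B → All (Above T B) (⁅ a ⁆ ∷ Ψ)) Φ → Any (b ∈_) Φ → T a < T b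
      above-a h b∈ = let (hb , b∈B) = All.lookupAny h b∈ in All.head hb _ a b∈B (x∈⁅x⁆ a)
      fromMerged : ∀ Ψ⁺ → Sorted T (Φ⁺ ++ ⁅ a ⁆ ∷ Ψ⁺) → RightSplit Ψ⁺
      fromMerged [] s with Anyₚ.++⁻ Φ⁺ (Sorted.cover s b)
      ... | inj₁ b∈        = contradiction (above-a (proj₂ (AllPairs-++⁻ Φ⁺ (Sorted.descending s))) b∈)
        (ℤₚ.<-asym (below-right m))
      ... | inj₂ (here b∈) = contradiction (cong T (x∈⁅y⁆⇒x≡y a b∈)) (ℤₚ.<⇒≢ (below-right m))
      fromMerged (R ∷ Ψ) s = record
        { form = one ; split = refl ; members = λ c → mk⇔
          (λ c∈ → merged-level-right m (All.head (All.tail (Allₚ.++⁻ʳ Φ⁺ level)) c b c∈ (inR m)))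
          inR }
        where
        open Sorted s
        order = AllPairs-++⁻ Φ⁺ descending
        inR : ∀ {b} → Merged v C′ a b → b ∈ R
        inR {b} m with Anyₚ.++⁻ Φ⁺ (cover b) | proj₁ order | All.tail (Allₚ.++⁻ʳ Φ⁺ nonempty)
        ... | inj₁ b∈ | _ | _ = contradiction (above-a (proj₂ order) b∈) (ℤₚ.<-asym (below-right m))
        ... | inj₂ (here b∈) | _ | _ = contradiction (cong T (x∈⁅y⁆⇒x≡y a b∈)) (ℤₚ.<⇒≢ (below-right m))
        ... | inj₂ (there (here b∈)) | _ | _ = b∈
        ... | inj₂ (there (there b∈)) | (h ∷ _) ∷ h′ ∷ _ | (r , r∈) ∷ _ =
          let (hb , b∈B) = All.lookupAny h′ b∈ in
          contradiction (h a r (x∈⁅x⁆ a) r∈) (no-between-right m (hb r b r∈ b∈B))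

    sorted-left : ∀ {Ls L} Φ {Ψ⁺} → AtMostOne Ls L → (∀ b → b ∈ L ⇔ Merged v C b a) →
      Sorted T ((Φ ++ Ls) ++ ⁅ a ⁆ ∷ Ψ⁺) → Sorted (total C) (Φ ++ (L ∪ ⁅ a ⁆) ∷ Ψ⁺)
    sorted-left Φ none inL s rewrite Listₚ.++-identityʳ Φ | ∪-identityˡ ⁅ a ⁆ = exchange-strict ex
      (λ x y m → ∉⊥ (Equivalence.from (inL x) (subst (Merged v C x) (left m) m))) s
    sorted-left {L = L} Φ {Ψ⁺} one inL s rewrite Listₚ.++-assoc Φ (L ∷ []) (⁅ a ⁆ ∷ Ψ⁺) = exchange-merge ex
      (λ x y x∈ y∈ → subst (Merged v C x) (sym (x∈⁅y⁆⇒x≡y a y∈)) (Equivalence.to (inL x) x∈))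
      (λ x y m → Equivalence.from (inL x) (subst (Merged v C x) (left m) m) , ∈-singleton (left m)) Φ s

    sorted-right : ∀ {Rs R} Φ⁺ {Ψ} → AtMostOne Rs R → (∀ b → b ∈ R ⇔ Merged v C′ a b) →
      Sorted (base-total ex′) (Φ⁺ ++ ⁅ a ⁆ ∷ Rs ++ Ψ) → Sorted (total C′) (Φ⁺ ++ (⁅ a ⁆ ∪ R) ∷ Ψ)
    sorted-right Φ⁺ none inR s rewrite ∪-identityʳ ⁅ a ⁆ = exchange-strict ex′
      (λ x y m → ∉⊥ (Equivalence.from (inR y) (subst (λ z → Merged v C′ z y) (right m) m))) s
    sorted-right Φ⁺ one inR s = exchange-merge ex′
      (λ x y x∈ y∈ → subst (λ z → Merged v C′ z y) (sym (x∈⁅y⁆⇒x≡y a x∈)) (Equivalence.to (inR y) y∈))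
      (λ x y m → ∈-singleton (right m) , Equivalence.from (inR y) (subst (λ z → Merged v C′ z y) (right m) m))
      Φ⁺ s

    decorate-atMostOne : ∀ {D : Fin n → P k} {Ls L} ε → AtMostOne Ls L → All Nonempty Ls →
      (Nonempty L → 3 ℕ.≤ ∣ L ∣ → decoration D L ≡ just ε) → decorate D Ls ≡ block L ε
    decorate-atMostOne ε none _ _ = sym (block-⊥ ε)
    decorate-atMostOne {D = D} {L = L} ε one (ne ∷ []) large≡ = decorate-block D L ε ne (large≡ ne)

    module _ {Φ Ψ Ls Rs L R} (formL : AtMostOne Ls L) (formR : AtMostOne Rs R)
      (inL : ∀ b → b ∈ L ⇔ Merged v C b a) (inR : ∀ b → b ∈ R ⇔ Merged v C′ a b)
      (s : Sorted T ((Φ ++ Ls) ++ ⁅ a ⁆ ∷ Rs ++ Ψ)) where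

      sortedC : Sorted (total C) (Φ ++ (L ∪ ⁅ a ⁆) ∷ Rs ++ Ψ)
      sortedC = sorted-left Φ formL inL s

      sortedC′ : Sorted (total C′) ((Φ ++ Ls) ++ (⁅ a ⁆ ∪ R) ∷ Ψ)
      sortedC′ = sorted-right (Φ ++ Ls) formR inR (Sorted-cong (base-total-sym ex) s)

      a∉L : a ∉ L
      a∉L a∈ = ℤₚ.<-irrefl refl (above-left (Equivalence.to (inL a) a∈))

      a∉R : a ∉ R
      a∉R a∈ = ℤₚ.<-irrefl refl (below-right (Equivalence.to (inR a) a∈))

      L∩R : Empty (L ∩ R)
      L∩R (b , b∈) = let (b∈L , b∈R) = x∈p∩q⁻ L R b∈ in
        ℤₚ.<-asym (above-left (Equivalence.to (inL b) b∈L)) (below-right (Equivalence.to (inR b) b∈R))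

      levels = Allₚ.++⁻ (Φ ++ Ls) (Sorted.level s)
      levelsΦ = Allₚ.++⁻ˡ Φ (proj₁ levels)
      levelsLs = Allₚ.++⁻ʳ Φ (proj₁ levels)
      levelsRs = Allₚ.++⁻ˡ Rs (All.tail (proj₂ levels))
      levelsΨ = Allₚ.++⁻ʳ Rs (All.tail (proj₂ levels))

      joinC : Conjugated C (L ∪ ⁅ a ⁆)
      joinC = Joined.join (block-joined tidy (exchange-separating ex) sortedC (Listₘ.∈-++⁺ʳ Φ (here refl)))

      joinC′ : Conjugated C′ (⁅ a ⁆ ∪ R)
      joinC′ = Joined.join (block-joined tidy′ (exchange-separating ex′) sortedC′ (Listₘ.∈-++⁺ʳ (Φ ++ Ls) (here refl)))

      peak : Peak C (L ∪ ⁅ a ⁆) v a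
      peak = merged-peak ex (q⊆p∪q L ⁅ a ⁆ (x∈⁅x⁆ a)) λ b b∈ b≢a → helper b≢a (x∈p∪q⁻ L ⁅ a ⁆ b∈)
        where
        helper : ∀ {b} → b ≢ a → b ∈ L ⊎ b ∈ ⁅ a ⁆ → Merged v C b a
        helper b≢a (inj₁ b∈) = Equivalence.to (inL _) b∈
        helper b≢a (inj₂ b∈) = contradiction (x∈⁅y⁆⇒x≡y a b∈) b≢a

      valley : Peak (negate C′) (⁅ a ⁆ ∪ R) v a
      valley = merged-valley ex′ (p⊆p∪q R (x∈⁅x⁆ a)) λ b b∈ b≢a → helper b≢a (x∈p∪q⁻ ⁅ a ⁆ R b∈)
        where
        helper : ∀ {b} → b ≢ a → b ∈ ⁅ a ⁆ ⊎ b ∈ R → Merged v C′ a b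
        helper b≢a (inj₂ b∈) = Equivalence.to (inR _) b∈
        helper b≢a (inj₁ b∈) = contradiction (x∈⁅y⁆⇒x≡y a b∈) b≢a

      decorate-La : decorate C ((L ∪ ⁅ a ⁆) ∷ []) ≡ block (L ∪ ⁅ a ⁆) Sign.+
      decorate-La = decorate-block C (L ∪ ⁅ a ⁆) Sign.+ (a , q⊆p∪q L ⁅ a ⁆ (x∈⁅x⁆ a)) λ 3≤ →
        decoration-peak C (L ∪ ⁅ a ⁆) 3≤ (v , a , peak)

      decorate-aR : decorate C′ ((⁅ a ⁆ ∪ R) ∷ []) ≡ block (⁅ a ⁆ ∪ R) Sign.-
      decorate-aR = decorate-block C′ (⁅ a ⁆ ∪ R) Sign.- (a , p⊆p∪q R (x∈⁅x⁆ a)) λ 3≤ →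
        decoration-no-peak C′ (⁅ a ⁆ ∪ R) 3≤ λ p →
          Conjugacy.peak⇒¬valley tidy′ joinC′ 3≤ p (v , a , valley)

      nonempties = Allₚ.++⁻ (Φ ++ Ls) (Sorted.nonempty s)

      -- L is a block of Π(C′), but its sign is found in C, where it is part of L ∪ {a} and inherits
      -- a peak, and is transferred by `decoration-exchange`. Dually, the sign of R is found in C′.
      decorate-L : decorate C Ls ≡ block L Sign.+
      decorate-L = decorate-atMostOne Sign.+ formL (Allₚ.++⁻ʳ Φ (proj₁ nonempties)) λ ne 3≤ →
        decoration-peak C L 3≤ (HasPeak-⊆ tidy joinC (p⊆p∪q ⁅ a ⁆) ne peak a∉L)

      decorate-R : decorate C′ Rs ≡ block R Sign.-
      decorate-R = decorate-atMostOne Sign.- formR (Allₚ.++⁻ˡ Rs (All.tail (proj₂ nonempties))) λ ne 3≤ →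
        decoration-no-peak C′ R 3≤ λ p → Conjugacy.peak⇒¬valley tidy′
          (λ b∈ c∈ → joinC′ (q⊆p∪q ⁅ a ⁆ R b∈) (q⊆p∪q ⁅ a ⁆ R c∈)) 3≤ p
          (HasPeak-⊆ (Tidy-negate tidy′) (Conjugated-negate {C = C′} joinC′) (q⊆p∪q ⁅ a ⁆ R) ne valley a∉R)

      decorate-++ : ∀ (C : Fin n → P k) xs ys → decorate C (xs ++ ys) ≡ decorate C xs ++ decorate C ys
      decorate-++ C = Listₚ.map-++ _

      before : decorate C (Φ ++ (L ∪ ⁅ a ⁆) ∷ Rs ++ Ψ) ≡
        decorate C Φ ++ (block (L ∪ ⁅ a ⁆) Sign.+ ++ block R Sign.-) ++ decorate C Ψ
      before = begin
        decorate C (Φ ++ (L ∪ ⁅ a ⁆) ∷ Rs ++ Ψ)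
          ≡⟨ decorate-++ C Φ _ ⟩
        decorate C Φ ++ decorate C ((L ∪ ⁅ a ⁆) ∷ []) ++ decorate C (Rs ++ Ψ)
          ≡⟨ cong₂ (λ xs ys → decorate C Φ ++ xs ++ ys) decorate-La
               (trans (decorate-++ C Rs Ψ)
                 (cong (_++ decorate C Ψ) (trans (decorate-exchange ex levelsRs) decorate-R))) ⟩
        decorate C Φ ++ block (L ∪ ⁅ a ⁆) Sign.+ ++ block R Sign.- ++ decorate C Ψ
          ≡⟨ cong (decorate C Φ ++_) (Listₚ.++-assoc (block (L ∪ ⁅ a ⁆) Sign.+) _ _) ⟨
        decorate C Φ ++ (block (L ∪ ⁅ a ⁆) Sign.+ ++ block R Sign.-) ++ decorate C Ψ ∎
        where open ≡-Reasoning

      after : decorate C′ ((Φ ++ Ls) ++ (⁅ a ⁆ ∪ R) ∷ Ψ) ≡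
        decorate C Φ ++ (block L Sign.+ ++ block (⁅ a ⁆ ∪ R) Sign.-) ++ decorate C Ψ
      after = begin
        decorate C′ ((Φ ++ Ls) ++ (⁅ a ⁆ ∪ R) ∷ Ψ)
          ≡⟨ decorate-++ C′ (Φ ++ Ls) _ ⟩
        decorate C′ (Φ ++ Ls) ++ decorate C′ ((⁅ a ⁆ ∪ R) ∷ []) ++ decorate C′ Ψ
          ≡⟨ cong₂ (λ xs ys → xs ++ ys) (sym (decorate-exchange ex (proj₁ levels)))
               (cong₂ _++_ decorate-aR (sym (decorate-exchange ex levelsΨ))) ⟩
        decorate C (Φ ++ Ls) ++ block (⁅ a ⁆ ∪ R) Sign.- ++ decorate C Ψ
          ≡⟨ cong (_++ _) (trans (decorate-++ C Φ Ls) (cong (decorate C Φ ++_) decorate-L)) ⟩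
        (decorate C Φ ++ block L Sign.+) ++ block (⁅ a ⁆ ∪ R) Sign.- ++ decorate C Ψ
          ≡⟨ Listₚ.++-assoc (decorate C Φ) _ _ ⟩
        decorate C Φ ++ block L Sign.+ ++ block (⁅ a ⁆ ∪ R) Sign.- ++ decorate C Ψ
          ≡⟨ cong (decorate C Φ ++_) (Listₚ.++-assoc (block L Sign.+) _ _) ⟨
        decorate C Φ ++ (block L Sign.+ ++ block (⁅ a ⁆ ∪ R) Sign.-) ++ decorate C Ψ ∎
        where open ≡-Reasoning

      dosps-move : ∃₂ λ D D′ → IsDospOf C D × IsDospOf C′ D′ × Move D D′
      dosps-move = _ , _ ,
        decorate-isDosp tidy (exchange-separating ex) sortedC ,
        decorate-isDosp tidy′ (exchange-separating ex′) sortedC′ ,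
        subst₂ Move (sym before) (sym after) (move (decorate C Φ) (decorate C Ψ) a∉L a∉R L∩R)

  exchange-move : ∃₂ λ D D′ → IsDospOf C D × IsDospOf C′ D′ × Move D D′
  exchange-move with sorted-exists T
  ... | Π , s with List.find (Sorted.cover s a)
  ...   | A , A∈ , a∈A with Listₘ.∈-∃++ A∈
  ...     | Φ⁺ , Ψ⁺ , refl with ⊆-antisym {i = A} {⁅ a ⁆}
      (λ b∈ → ∈-singleton (alone _ (All.lookup (Sorted.level s) A∈ _ a b∈ a∈A)))
      (λ b∈ → subst (_∈ A) (sym (x∈⁅y⁆⇒x≡y a b∈)) a∈A)
  ...       | refl with leftSplit Φ⁺ s | rightSplit Φ⁺ Ψ⁺ s
  ...         | record { Φ = Φ ; form = formL ; split = refl ; members = inL }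
              | record { form = formR ; split = refl ; members = inR } =
    dosps-move {Φ = Φ} formL formR inL inR s

-- Merged pairs and the cases of an exchange

root-difference>0 : (a b c d : Fin k) → 0ℤ < diff (root c d) a b → a ≡ c ⊎ b ≡ d
root-difference>0 a b c d gt = root-difference<0 a b d c
  (subst (_< 0ℤ) (sym (root-flip c d a b)) (ℤₚ.neg-mono-< gt))

Dosps : (C C′ : Fin n → P k) → (Dosp k → Dosp k → Set) → Set
Dosps C C′ R = ∃₂ λ D D′ → IsDospOf C D × IsDospOf C′ D′ × R D D′

Dosps-mutation-sym : {C C′ : Fin n → P k} → Dosps C′ C DospMutation → Dosps C C′ DospMutation
Dosps-mutation-sym (D , D′ , o , o′ , inj₁ m) = D′ , D , o′ , o , inj₂ m
Dosps-mutation-sym (D , D′ , o , o′ , inj₂ m) = D′ , D , o′ , o , inj₁ m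

module _ {v : Fin n} {C C′ : Fin n → P k} (ex : Exchange v C C′) where
  open Exchange ex
  open Tidy tidy

  -- At `a`, `b` the vector `v` has difference -1, while `w′` has 1 if it is `w` and 0 otherwise. So
  -- the root between `w′` and `v` has a positive difference there.
  merged-star : ∀ {a b c d} → Merged v C a b → Merged v C c d → a ≡ c ⊎ b ≡ d
  merged-star {a} {b} {c} {d} (w , r) (w′ , r′) = root-difference>0 a b c d (positive (w′ Finₚ.≟ w))
    where
    difference : diff (root c d) a b ≡ diff (C w′) a b + 1ℤ
    difference = trans (root-shift r′ a b) (cong (λ z → diff (C w′) a b - z) (down r))
    positive : Dec (w′ ≡ w) → 0ℤ < diff (root c d) a b
    positive (yes refl) = subst (0ℤ <_) (sym (trans difference (cong (_+ 1ℤ) (up r)))) (+<+ (s≤s z≤n))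
    positive (no w′≢w)  = subst (0ℤ <_) (sym (trans difference (cong (_+ 1ℤ)
      (others-vanish r w′≢w (Root⇒u≢w {C = C} r′))))) (+<+ (s≤s z≤n))

  -- A coordinate in the base block of `a` has the same total, so it is merged with `x` as well, and
  -- `left` identifies it with `a`.
  merged-alone : ∀ {x a} → Merged v C x a → (∀ {x y} → Merged v C x y → y ≡ a) →
    ∀ b → base-total ex b ≡ base-total ex a → b ≡ a
  merged-alone {x} {a} m@(_ , r) left b eq = left (total≡⇒merged ex x b
    (subst (_< base-total ex x) (sym eq) (merged-above ex m))
    (trans (total-joined tidy r) (base-flat ex a b (sym eq))))

  merged-alone′ : ∀ {a y} → Merged v C a y → (∀ {x y} → Merged v C x y → x ≡ a) →
    ∀ b → base-total ex b ≡ base-total ex a → b ≡ a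
  merged-alone′ {a} {y} m@(_ , r) right b eq = right (total≡⇒merged ex b y
    (subst (base-total ex y <_) (sym eq) (merged-above ex m))
    (trans (base-flat ex b a eq) (total-joined tidy r)))

module _ {v : Fin n} {C C′ : Fin n → P k} (ex : Exchange v C C′) where
  open Exchange ex

  private
    ex′ = Exchange-sym ex

  dosps-unmerged : (∀ a b → ¬ Merged v C a b) → (∀ a b → ¬ Merged v C′ a b) → Dosps C C′ _≡_
  dosps-unmerged ¬m ¬m′ = let (Π , s) = sorted-exists (base-total ex) in
    decorate C Π , decorate C′ Π ,
    decorate-isDosp tidy (exchange-separating ex) (exchange-strict ex ¬m s) ,
    decorate-isDosp tidy′ (exchange-separating ex′)
      (exchange-strict ex′ ¬m′ (Sorted-cong (base-total-sym ex) s)) ,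
    decorate-exchange ex (Sorted.level s)

module _ {v : Fin n} {C C′ : Fin n → P k} (ex : Exchange v C C′) where
  open Exchange ex

  private
    ex′ = Exchange-sym ex

  -- By `merged-star` all merged pairs share the lower coordinate y or all share the upper
  -- coordinate x. The first case is a move with a = y and R empty, the second a move read backwards
  -- with a = x and L empty.
  dosps-one-sided : ∀ {x y} → Merged v C x y → (∀ a b → ¬ Merged v C′ a b) → Dosps C C′ DospMutation
  dosps-one-sided {x} {y} m ¬m′ with Finₚ.any? (λ c → Finₚ.any? λ d → merged? ex c d ×-dec ¬? (d Finₚ.≟ y))
  ... | no none = let (D , D′ , o , o′ , mv) = exchange-move ex y same (λ m′ → contradiction m′ (¬m′ _ _))
                        (merged-alone ex m same) in D , D′ , o , o′ , inj₁ mv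
    where
    same : ∀ {c d} → Merged v C c d → d ≡ y
    same {c} {d} m₁ with d Finₚ.≟ y
    ... | yes d≡y = d≡y
    ... | no d≢y  = contradiction (c , d , m₁ , d≢y) none
  ... | yes (c , d , m₁ , d≢y) =
      let (D , D′ , o , o′ , mv) = exchange-move ex′ x (λ m′ → contradiction m′ (¬m′ _ _)) same
                                       λ b eq → merged-alone′ ex m same b
                                         (trans (base-total-sym ex b) (trans eq (sym (base-total-sym ex x))))
      in D′ , D , o′ , o , inj₂ mv
    where
    c≡x : c ≡ x
    c≡x with merged-star ex m₁ m
    ... | inj₁ p = p
    ... | inj₂ p = contradiction p d≢y
    same : ∀ {e f} → Merged v C e f → e ≡ x
    same m₂ with merged-star ex m₂ m | merged-star ex m₂ m₁
    ... | inj₁ p    | _         = p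
    ... | inj₂ _    | inj₁ p    = trans p c≡x
    ... | inj₂ refl | inj₂ refl = contradiction refl d≢y

  -- Comparing a further merged pair with both given pairs, the alternatives to containing `a` in
  -- the right place would give x = y. But in the base order x is above `a` and y is below it.
  dosps-two-sided : ∀ {x a y} → Merged v C x a → Merged v C′ a y → Dosps C C′ Move
  dosps-two-sided {x} {a} {y} m m′ = exchange-move ex a left right (merged-alone ex m left)
    where
    T = base-total ex
    x≢y : x ≢ y
    x≢y refl = ℤₚ.<-asym (merged-above ex m)
      (subst₂ _<_ (sym (base-total-sym ex y)) (sym (base-total-sym ex a)) (merged-above ex′ m′))
    left : ∀ {c d} → Merged v C c d → d ≡ a
    left m₁ with cross m₁ m′ | merged-star ex m₁ m
    ... | inj₁ p    | _         = p
    ... | inj₂ _    | inj₂ p    = p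
    ... | inj₂ refl | inj₁ refl = contradiction refl x≢y
    right : ∀ {c d} → Merged v C′ c d → c ≡ a
    right m₁ with cross m m₁ | merged-star ex′ m₁ m′
    ... | inj₁ p    | _         = sym p
    ... | inj₂ _    | inj₁ p    = p
    ... | inj₂ refl | inj₂ refl = contradiction refl x≢y

exchange-dosps : {v : Fin n} {C C′ : Fin n → P k} → Exchange v C C′ →
  Dosps C C′ λ D D′ → D ≡ D′ ⊎ DospMutation D D′
exchange-dosps {v = v} {C} {C′} ex = cases
  (Finₚ.any? λ a → Finₚ.any? λ b → merged? ex a b) (Finₚ.any? λ a → Finₚ.any? λ b → merged? ex′ a b)
  where
  ex′ = Exchange-sym ex
  mutation : Dosps C C′ DospMutation → Dosps C C′ λ D D′ → D ≡ D′ ⊎ DospMutation D D′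
  mutation (D , D′ , o , o′ , m) = D , D′ , o , o′ , inj₂ m
  cases : Dec (∃₂ (Merged v C)) → Dec (∃₂ (Merged v C′)) → Dosps C C′ λ D D′ → D ≡ D′ ⊎ DospMutation D D′
  cases (no ¬m) (no ¬m′) =
    let (D , D′ , o , o′ , eq) = dosps-unmerged ex (λ a b m → ¬m (a , b , m)) (λ a b m → ¬m′ (a , b , m)) in
    D , D′ , o , o′ , inj₁ eq
  cases (yes (a , b , m)) (no ¬m′) = mutation (dosps-one-sided ex m λ a b m′ → ¬m′ (a , b , m′))
  cases (no ¬m) (yes (a , b , m′)) =
    mutation (Dosps-mutation-sym {C = C} {C′} (dosps-one-sided ex′ m′ λ a b m → ¬m (a , b , m)))
  cases (yes (a , b , m)) (yes (c , d , m′)) with Exchange.cross ex m m′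
  ... | inj₁ refl = let (D , D′ , o , o′ , mv) = dosps-two-sided ex m m′ in D , D′ , o , o′ , inj₂ (inj₁ mv)
  ... | inj₂ refl = let (D , D′ , o , o′ , mv) = dosps-two-sided ex′ m′ m in D′ , D , o′ , o , inj₂ (inj₂ mv)

-- Mutation and the balance condition

-- Cancelling oriented 2-cycles is truncated subtraction in both directions, and this leaves the
-- signed number of arrows unchanged.
+-∸-difference : ∀ x y → ℤ.+ (x ℕ.∸ y) - ℤ.+ (y ℕ.∸ x) ≡ ℤ.+ x - ℤ.+ y
+-∸-difference zero    zero    = refl
+-∸-difference zero    (suc y) = refl
+-∸-difference (suc x) zero    = refl
+-∸-difference (suc x) (suc y) = trans (+-∸-difference x y)
  (trans (ℤₚ.m-n≡m⊖n x y) (sym (trans (ℤₚ.m-n≡m⊖n (suc x) (suc y)) (ℤₚ.[1+m]⊖[1+n]≡m⊖n x y))))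

sum-update : {f g : Fin n → ℤ} (v : Fin n) → (∀ u → u ≢ v → f u ≡ g u) → sum f ≡ sum g + (f v - g v)
sum-update {f = f} {g} v eq = trans (lemma (sum f) (sum g)) (cong (sum g +_)
  (trans (sym (sum-difference f g)) (sum-single (λ u → f u - g u) v λ u u≢v → ℤₚ.i≡j⇒i-j≡0 (eq u u≢v))))
  where
  lemma : ∀ i j → i ≡ j + (i - j)
  lemma = solve-∀

module _ (q : Fin n → Fin n → ℕ) (v : Fin n) where

  mutateArrows-source : ∀ w → mutateArrows v q v w ≡ q w v
  mutateArrows-source w with v Finₚ.≟ v
  ... | yes _  = refl
  ... | no v≢v = contradiction refl v≢v

  mutateArrows-target : ∀ u → mutateArrows v q u v ≡ q v u
  mutateArrows-target u with u Finₚ.≟ v | v Finₚ.≟ v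
  ... | yes _ | _      = refl
  ... | no _  | yes _  = refl
  ... | no _  | no v≢v = contradiction refl v≢v

  mutateArrows-other : ∀ {u w} → u ≢ v → w ≢ v →
    mutateArrows v q u w ≡ (q u w ℕ.+ q u v ℕ.* q v w) ℕ.∸ (q w u ℕ.+ q w v ℕ.* q v u)
  mutateArrows-other {u} {w} u≢v w≢v with u Finₚ.≟ v | w Finₚ.≟ v
  ... | yes u≡v | _       = contradiction u≡v u≢v
  ... | no _    | yes w≡v = contradiction w≡v w≢v
  ... | no _    | no _    = refl

Antisymmetric : (Fin n → Fin n → ℕ) → Set
Antisymmetric q = ∀ u w → q u w ≡ 0 ⊎ q w u ≡ 0

-- The entries of the exchange matrix. With them `Balanced` is a linear condition: incoming minus
-- outgoing weight.
signedArrows : (Fin n → Fin n → ℕ) → Fin n → Fin n → ℤ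
signedArrows q u w = ℤ.+ q u w - ℤ.+ q w u

Balanced : (Fin n → Fin n → ℕ) → (Fin n → P k) → Set
Balanced q C = ∀ w i → sum (λ u → signedArrows q u w * C u i) ≡ 0ℤ

antisymmetric-loop : {q : Fin n → Fin n → ℕ} → Antisymmetric q → ∀ v → q v v ≡ 0
antisymmetric-loop anti v with anti v v
... | inj₁ eq = eq
... | inj₂ eq = eq

signedArrows≡0 : {q : Fin n → Fin n → ℕ} → Antisymmetric q → ∀ u w → signedArrows q u w ≡ 0ℤ →
  q u w ≡ 0 × q w u ≡ 0
signedArrows≡0 anti u w b≡0 with ℤₚ.+-injective (ℤₚ.i-j≡0⇒i≡j _ _ b≡0) | anti u w
... | eq | inj₁ u→w≡0 = u→w≡0 , trans (sym eq) u→w≡0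
... | eq | inj₂ w→u≡0 = trans eq w→u≡0 , w→u≡0

mutateArrows-antisymmetric : {q : Fin n → Fin n → ℕ} → Antisymmetric q → ∀ v →
  Antisymmetric (mutateArrows v q)
mutateArrows-antisymmetric {q = q} anti v u w with u Finₚ.≟ v | w Finₚ.≟ v
... | yes _ | yes _ = anti w u
... | yes _ | no _  = anti w u
... | no _  | yes _ = anti w u
... | no _  | no _  with ℕₚ.≤-total (q u w ℕ.+ q u v ℕ.* q v w) (q w u ℕ.+ q w v ℕ.* q v u)
...   | inj₁ ≤ = inj₁ (ℕₚ.m≤n⇒m∸n≡0 ≤)
...   | inj₂ ≥ = inj₂ (ℕₚ.m≤n⇒m∸n≡0 ≥)

module _ {q : Fin n → Fin n → ℕ} {C C′ : Fin n → P k} (v : Fin n)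
  (others  : ∀ {u} → u ≢ v → ∀ i → C′ u i ≡ C u i)
  (mutated : ∀ i → C′ v i ≡ - C v i + sum (λ u → ℤ.+ q u v * C u i)) where

  -- At `v` all signs are reversed. At another `w`, the paths through `v` add `q v w` times the
  -- incoming weight of `v` minus `q w v` times the outgoing one. The two weights agree by balance
  -- at `v`, and the sum cancels against the change in the term of `v`, whose arrows are reversed
  -- and whose weight is mutated.
  mutate-balanced : Antisymmetric q → Balanced q C → Balanced (mutateArrows v q) C′
  mutate-balanced anti balanced w i = balanced-at (w Finₚ.≟ v)
    where
    balanced-at : Dec (w ≡ v) → sum (λ u → signedArrows (mutateArrows v q) u w * C′ u i) ≡ 0ℤ
    balanced-at (yes refl) = trans (sum-cong-≗ negated)
      (trans (sum-difference (λ _ → 0ℤ) (λ u → signedArrows q u v * C u i))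
        (cong₂ _-_ (sum-zero {n} (λ _ → 0ℤ) λ _ → refl) (balanced v i)))
      where
      flip : ∀ x y c → (x - y) * c ≡ 0ℤ - (y - x) * c
      flip = solve-∀
      loop : ∀ x c c′ → (x - x) * c ≡ 0ℤ - (x - x) * c′
      loop = solve-∀
      reversed : ∀ {u} → Dec (u ≡ v) → signedArrows q v u * C′ u i ≡ 0ℤ - signedArrows q u v * C u i
      reversed (yes refl)    = loop (ℤ.+ q v v) (C′ v i) (C v i)
      reversed {u} (no u≢v) = trans (cong (signedArrows q v u *_) (others u≢v i))
        (flip (ℤ.+ q v u) (ℤ.+ q u v) (C u i))
      negated : ∀ u → signedArrows (mutateArrows v q) u v * C′ u i ≡ 0ℤ - signedArrows q u v * C u i
      negated u = trans
        (cong (_* C′ u i) (cong₂ (λ x y → ℤ.+ x - ℤ.+ y) (mutateArrows-target q v u) (mutateArrows-source q v u)))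
        (reversed (u Finₚ.≟ v))
    balanced-at (no w≢v) = trans (sum-update v off) (trans (cong₂ _+_ total-G (cong₂ _-_ term-v G-v))
      (final (ℤ.+ q v w) (ℤ.+ q w v) incoming (C v i)))
      where
      incoming outgoing : ℤ
      incoming = sum λ u → ℤ.+ q u v * C u i
      outgoing = sum λ u → ℤ.+ q v u * C u i
      -- `G` is the new summand for vertices other than `v`, extended to `v` by the same formula;
      -- `sum-update` then corrects the single term at `v`.
      G : Fin n → ℤ
      G u = signedArrows q u w * C u i + (ℤ.+ q v w * (ℤ.+ q u v * C u i) - ℤ.+ q w v * (ℤ.+ q v u * C u i))
      balance-v : incoming ≡ outgoing
      balance-v = ℤₚ.i-j≡0⇒i≡j _ _
        (trans (sym (sum-difference (λ u → ℤ.+ q u v * C u i) (λ u → ℤ.+ q v u * C u i)))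
        (trans (sum-cong-≗ λ u → factor (ℤ.+ q u v) (ℤ.+ q v u) (C u i)) (balanced v i)))
        where
        factor : ∀ x y c → x * c - y * c ≡ (x - y) * c
        factor = solve-∀
      off : ∀ u → u ≢ v → signedArrows (mutateArrows v q) u w * C′ u i ≡ G u
      off u u≢v rewrite mutateArrows-other q v u≢v w≢v | mutateArrows-other q v w≢v u≢v | others u≢v i =
        trans (cong (_* C u i) (+-∸-difference (q u w ℕ.+ q u v ℕ.* q v w) (q w u ℕ.+ q w v ℕ.* q v u)))
          (trans (cong (_* C u i) (cong₂ _-_ (homo (q u w) (q u v) (q v w)) (homo (q w u) (q w v) (q v u))))
            (expand (ℤ.+ q u w) (ℤ.+ q u v) (ℤ.+ q v w) (ℤ.+ q w u) (ℤ.+ q w v) (ℤ.+ q v u) (C u i)))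
        where
        homo : ∀ x y z → ℤ.+ (x ℕ.+ y ℕ.* z) ≡ ℤ.+ x + ℤ.+ y * ℤ.+ z
        homo x y z = trans (ℤₚ.pos-+ x (y ℕ.* z)) (cong (λ t → ℤ.+ x + t) (ℤₚ.pos-* y z))
        expand : ∀ a b c d e f x → (a + b * c - (d + e * f)) * x ≡ (a - d) * x + (c * (b * x) - e * (f * x))
        expand = solve-∀
      total-G : sum G ≡ (ℤ.+ q v w - ℤ.+ q w v) * incoming
      total-G = trans (∑-distrib-+ (λ u → signedArrows q u w * C u i)
          (λ u → ℤ.+ q v w * (ℤ.+ q u v * C u i) - ℤ.+ q w v * (ℤ.+ q v u * C u i)))
        (trans (cong₂ _+_ (balanced w i) (trans
          (sum-difference (λ u → ℤ.+ q v w * (ℤ.+ q u v * C u i)) (λ u → ℤ.+ q w v * (ℤ.+ q v u * C u i)))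
          (cong₂ _-_ (sym (*-distribˡ-sum (ℤ.+ q v w) (λ u → ℤ.+ q u v * C u i)))
            (trans (sym (*-distribˡ-sum (ℤ.+ q w v) (λ u → ℤ.+ q v u * C u i)))
              (cong (λ t → ℤ.+ q w v * t) (sym balance-v))))))
          (collect (ℤ.+ q v w) (ℤ.+ q w v) incoming))
        where
        collect : ∀ x y z → 0ℤ + (x * z - y * z) ≡ (x - y) * z
        collect = solve-∀
      term-v : signedArrows (mutateArrows v q) v w * C′ v i ≡ (ℤ.+ q w v - ℤ.+ q v w) * (- C v i + incoming)
      term-v = cong₂ _*_ (cong₂ (λ x y → ℤ.+ x - ℤ.+ y) (mutateArrows-source q v w)
        (mutateArrows-target q v w)) (mutated i)
      G-v : G v ≡ (ℤ.+ q v w - ℤ.+ q w v) * C v i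
      G-v rewrite antisymmetric-loop anti v = drop (ℤ.+ q v w) (ℤ.+ q w v) (C v i)
        where
        drop : ∀ x y z → (x - y) * z + (x * (0ℤ * z) - y * (0ℤ * z)) ≡ (x - y) * z
        drop = solve-∀
      final : ∀ x y z c → (x - y) * z + ((y - x) * (- c + z) - (x - y) * c) ≡ 0ℤ
      final = solve-∀

-- Seeds joined to the initial one

weight-mutated : (s : PSeed n k m) (v : Fin n) (p : Fin m) → ∀ i →
  π[ p ] (mutate v s) v i ≡ - π[ p ] s v i + sum (λ u → ℤ.+ arrows s u v * π[ p ] s u i)
weight-mutated s v p i = cong (λ f → f p i) (updateAt-updates v (weight s))

weight-unchanged : (s : PSeed n k m) (v : Fin n) (p : Fin m) → ∀ {u} → u ≢ v → ∀ i →
  π[ p ] (mutate v s) u i ≡ π[ p ] s u i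
weight-unchanged s v p {u} u≢v i = cong (λ f → f p i) (updateAt-minimal u v (weight s) u≢v)

record Valid (p : Fin m) (s : PSeed n k m) : Set where
  field
    antisymmetric : Antisymmetric (arrows s)
    balanced      : Balanced (arrows s) (π[ p ] s)

mutate-valid : {p : Fin m} {s : PSeed n k m} → ∀ v → Valid p s → Valid p (mutate v s)
mutate-valid {p = p} {s} v valid = record
  { antisymmetric = mutateArrows-antisymmetric antisymmetric v
  ; balanced      = mutate-balanced v (weight-unchanged s v p) (weight-mutated s v p) antisymmetric balanced
  }
  where open Valid valid

reachable-valid : {p : Fin m} {s s₀ : PSeed n k m} → Valid p s₀ → s ∈𝔼-good[ s₀ ] → Valid p s
reachable-valid valid (initial _)  = valid
reachable-valid valid (step r v _) = mutate-valid v (reachable-valid valid r)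

reachable-good : {s s₀ : PSeed n k m} → s ∈𝔼-good[ s₀ ] → Good s
reachable-good (initial good)  = good
reachable-good (step _ _ good) = good

Isolated : (Fin n → Fin n → ℕ) → Fin n → Set
Isolated q z = ∀ u → q z u ≡ 0 × q u z ≡ 0

-- A property that passes from a mutated seed back to the seed itself, so that it
-- can be refuted in the initial seed.
record Confined (p : Fin m) (Z : Subset n) (a b : Fin k) (s : PSeed n k m) : Set where
  field
    isolated : ∀ {z} → z ∈ Z → Isolated (arrows s) z
    equal    : ∀ {u} → u ∉ Z → diff (π[ p ] s u) a b ≡ 0ℤ

-- No path through `v` starts or ends at an isolated vertex, so its signed arrows are unchanged up
-- to sign. If `v` lies outside `Z`, the arrows into `v` come from vertices with equal coordinates
-- `a` and `b`, the ones in `Z` sending none; so mutation only negates the difference at `v`.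
mutate-confined : {p : Fin m} {s : PSeed n k m} {Z : Subset n} {a b : Fin k} → Valid p s → ∀ v →
  Confined p Z a b (mutate v s) → Confined p Z a b s
mutate-confined {p = p} {s} {Z} {a} {b} valid v confined = record { isolated = isolated′ ; equal = equal′ }
  where
  open Valid valid
  open Confined confined
  q = arrows s
  isolated′ : ∀ {z} → z ∈ Z → Isolated q z
  isolated′ {z} z∈ u with z Finₚ.≟ v | u Finₚ.≟ v
  ... | yes refl | _        = let (zu , uz) = isolated z∈ u in
    trans (sym (mutateArrows-target q v u)) uz , trans (sym (mutateArrows-source q v u)) zu
  ... | no _     | yes refl = let (zu , uz) = isolated z∈ v in
    trans (sym (mutateArrows-source q v z)) uz , trans (sym (mutateArrows-target q v z)) zu
  ... | no z≢v   | no u≢v   = signedArrows≡0 antisymmetric z u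
    (trans (sym (+-∸-difference (q z u) (q u z))) (cong₂ (λ x y → ℤ.+ x - ℤ.+ y) z→u u→z))
    where
    zv = isolated z∈ v
    v→z≡0 : q v z ≡ 0
    v→z≡0 = trans (sym (mutateArrows-target q v z)) (proj₁ zv)
    z→v≡0 : q z v ≡ 0
    z→v≡0 = trans (sym (mutateArrows-source q v z)) (proj₂ zv)
    z→u : q z u ℕ.∸ q u z ≡ 0
    z→u = trans (cong₂ ℕ._∸_
        (sym (trans (cong (λ x → q z u ℕ.+ x ℕ.* q v u) z→v≡0) (ℕₚ.+-identityʳ _)))
        (sym (trans (cong (λ x → q u z ℕ.+ q u v ℕ.* x) v→z≡0)
          (trans (cong (q u z ℕ.+_) (ℕₚ.*-zeroʳ (q u v))) (ℕₚ.+-identityʳ _)))))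
      (trans (sym (mutateArrows-other q v z≢v u≢v)) (proj₁ (isolated z∈ u)))
    u→z : q u z ℕ.∸ q z u ≡ 0
    u→z = trans (cong₂ ℕ._∸_
        (sym (trans (cong (λ x → q u z ℕ.+ q u v ℕ.* x) v→z≡0)
          (trans (cong (q u z ℕ.+_) (ℕₚ.*-zeroʳ (q u v))) (ℕₚ.+-identityʳ _))))
        (sym (trans (cong (λ x → q z u ℕ.+ x ℕ.* q v u) z→v≡0) (ℕₚ.+-identityʳ _))))
      (trans (sym (mutateArrows-other q v u≢v z≢v)) (proj₂ (isolated z∈ u)))
  C = π[ p ] s
  C′ = π[ p ] (mutate v s)
  unchanged : ∀ {u} → u ∉ Z → u ≢ v → diff (C u) a b ≡ 0ℤ
  unchanged {u} u∉ u≢v = trans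
    (sym (cong₂ _-_ (weight-unchanged s v p u≢v a) (weight-unchanged s v p u≢v b))) (equal u∉)
  equal′ : ∀ {u} → u ∉ Z → diff (C u) a b ≡ 0ℤ
  equal′ {u} u∉ with u Finₚ.≟ v
  ... | no u≢v   = unchanged u∉ u≢v
  ... | yes refl = ℤₚ.neg-injective (trans (sym (ℤₚ.+-identityʳ _))
      (trans (cong (λ x → - diff (C v) a b + x) (sym incoming))
      (trans (lemma (C v a) (C v b) (sum λ u → ℤ.+ q u v * C u a) (sum λ u → ℤ.+ q u v * C u b))
        (trans (sym (cong₂ _-_ (weight-mutated s v p a) (weight-mutated s v p b))) (equal u∉)))))
    where
    lemma : ∀ i j x y → - (i - j) + (x - y) ≡ (- i + x) - (- j + y)
    lemma = solve-∀
    factor : ∀ x c d → x * c - x * d ≡ x * (c - d)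
    factor = solve-∀
    term : ∀ u → ℤ.+ q u v * diff (C u) a b ≡ 0ℤ
    term u with u Finₚ.≟ v | u ∈? Z
    ... | yes refl | _ = cong (λ x → ℤ.+ x * diff (C v) a b) (antisymmetric-loop antisymmetric v)
    ... | no _ | yes u∈ = cong (λ x → ℤ.+ x * diff (C u) a b) (proj₁ (isolated′ u∈ v))
    ... | no u≢v | no u∉ = trans (cong (λ x → ℤ.+ q u v * x) (unchanged u∉ u≢v)) (ℤₚ.*-zeroʳ (ℤ.+ q u v))
    incoming : sum (λ u → ℤ.+ q u v * C u a) - sum (λ u → ℤ.+ q u v * C u b) ≡ 0ℤ
    incoming = trans (sym (sum-difference (λ u → ℤ.+ q u v * C u a) (λ u → ℤ.+ q u v * C u b)))
      (sum-zero _ λ u → trans (factor (ℤ.+ q u v) (C u a) (C u b)) (term u))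

reachable-confined : {p : Fin m} {s s₀ : PSeed n k m} {Z : Subset n} {a b : Fin k} → Valid p s₀ →
  s ∈𝔼-good[ s₀ ] → Confined p Z a b s → Confined p Z a b s₀
reachable-confined valid (initial _)  c = c
reachable-confined valid (step r v _) c =
  reachable-confined valid r (mutate-confined (reachable-valid valid r) v c)

-- Two vertices for every level: in the initial seed they lie on the two sides of
-- a triangle at the puncture.
record Rich (C : Fin n → P k) : Set where
  field
    vertex    : ∀ l → 1 ℕ.≤ l → l ℕ.< k → Bool → Fin n
    injective : ∀ {l l′} (p : 1 ℕ.≤ l) (q : l ℕ.< k) (p′ : 1 ℕ.≤ l′) (q′ : l′ ℕ.< k) {d d′} →
      vertex l p q d ≡ vertex l′ p′ q′ d′ → l ≡ l′ × d ≡ d′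
    separates : ∀ l (p : 1 ℕ.≤ l) (q : l ℕ.< k) d a b → toℕ a ℕ.< l → l ℕ.≤ toℕ b →
      diff (C (vertex l p q d)) a b ≢ 0ℤ

-- A level separating a and b.
gap : Fin k → Fin k → ℕ
gap a b = suc (toℕ a ℕ.⊓ toℕ b)

apart : {a b : Fin k} → a ≢ b → toℕ a ℕ.< toℕ b ⊎ toℕ b ℕ.< toℕ a
apart {a = a} {b} a≢b with ℕₚ.<-cmp (toℕ a) (toℕ b)
... | tri≈ _ eq _ = contradiction (Finₚ.toℕ-injective eq) a≢b
... | tri< lt _ _ = inj₁ lt
... | tri> _ _ gt = inj₂ gt

gap-< : {a b : Fin k} → a ≢ b → gap a b ℕ.< k
gap-< {a = a} {b} a≢b with apart a≢b
... | inj₁ lt = ℕₚ.≤-<-trans (ℕₚ.≤-trans (s≤s (ℕₚ.m⊓n≤m _ _)) lt) (Finₚ.toℕ<n b)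
... | inj₂ gt = ℕₚ.≤-<-trans (ℕₚ.≤-trans (s≤s (ℕₚ.m⊓n≤n (toℕ a) _)) gt) (Finₚ.toℕ<n a)

-- The gap determines the smaller coordinate of a pair, and disjoint pairs cannot have it in common.
gap-injective : {a b c d : Fin k} → a ≢ c → a ≢ d → b ≢ c → b ≢ d → gap a b ≢ gap c d
gap-injective {a = a} {b} {c} {d} a≢c a≢d b≢c b≢d eq
  with ℕₚ.⊓-sel (toℕ a) (toℕ b) | ℕₚ.⊓-sel (toℕ c) (toℕ d)
... | inj₁ p | inj₁ q = a≢c (Finₚ.toℕ-injective (trans (sym p) (trans (ℕₚ.suc-injective eq) q)))
... | inj₁ p | inj₂ q = a≢d (Finₚ.toℕ-injective (trans (sym p) (trans (ℕₚ.suc-injective eq) q)))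
... | inj₂ p | inj₁ q = b≢c (Finₚ.toℕ-injective (trans (sym p) (trans (ℕₚ.suc-injective eq) q)))
... | inj₂ p | inj₂ q = b≢d (Finₚ.toℕ-injective (trans (sym p) (trans (ℕₚ.suc-injective eq) q)))

module _ {p : Fin m} {s : PSeed n k m} (rich : Rich (π[ p ] s)) where
  open Rich rich

  -- The gap is a level above the smaller coordinate and at most the larger one, so both vertices of
  -- this level tell `a` and `b` apart. Vertices outside `Z` do not.
  confined-vertex : ∀ {Z a b} → Confined p Z a b s → (a≢b : a ≢ b) → ∀ d →
    vertex (gap a b) (s≤s z≤n) (gap-< a≢b) d ∈ Z
  confined-vertex {Z} {a} {b} confined a≢b d =
    decidable-stable (x ∈? Z) λ x∉ → unequal (apart a≢b) (Confined.equal confined x∉)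
    where
    x = vertex (gap a b) (s≤s z≤n) (gap-< a≢b) d
    unequal : toℕ a ℕ.< toℕ b ⊎ toℕ b ℕ.< toℕ a → diff (π[ p ] s x) a b ≢ 0ℤ
    unequal (inj₁ lt) = separates _ _ _ d a b (s≤s (ℕₚ.≤-reflexive (sym (ℕₚ.m≤n⇒m⊓n≡m (ℕₚ.<⇒≤ lt)))))
      (subst (ℕ._≤ toℕ b) (cong suc (sym (ℕₚ.m≤n⇒m⊓n≡m (ℕₚ.<⇒≤ lt)))) lt)
    unequal (inj₂ gt) eq = separates _ _ _ d b a (s≤s (ℕₚ.≤-reflexive (sym (ℕₚ.m≥n⇒m⊓n≡n (ℕₚ.<⇒≤ gt)))))
      (subst (ℕ._≤ toℕ a) (cong suc (sym (ℕₚ.m≥n⇒m⊓n≡n (ℕₚ.<⇒≤ gt)))) gt)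
      (trans (diff-flip (π[ p ] s x) a b) (cong -_ eq))

  ¬confined-single : ∀ {Z v a b} → Z ⊆ ⁅ v ⁆ → a ≢ b → ¬ Confined p Z a b s
  ¬confined-single {v = v} {a} {b} Z⊆v a≢b confined = contradiction
    (proj₂ (injective (s≤s z≤n) (gap-< a≢b) (s≤s z≤n) (gap-< a≢b)
      (trans (at-v true) (sym (at-v false))))) λ ()
    where
    at-v : ∀ d → vertex (gap a b) (s≤s z≤n) (gap-< a≢b) d ≡ v
    at-v d = x∈⁅y⁆⇒x≡y v (Z⊆v (confined-vertex confined a≢b d))

  -- Two levels provide four vertices, but Z has only two elements.
  ¬confined-double : ∀ {v w a b c d} → a ≢ b → c ≢ d → gap a b ≢ gap c d →
    Confined p (⁅ v ⁆ ∪ ⁅ w ⁆) a b s → ¬ Confined p (⁅ v ⁆ ∪ ⁅ w ⁆) c d s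
  ¬confined-double {v} {w} {a} {b} {c} {d} a≢b c≢d gaps conf conf′ =
    pigeonhole (either (confined-vertex conf a≢b true)) (either (confined-vertex conf a≢b false))
      (either (confined-vertex conf′ c≢d true))
    where
    either : ∀ {x} → x ∈ ⁅ v ⁆ ∪ ⁅ w ⁆ → x ≡ v ⊎ x ≡ w
    either x∈ with x∈p∪q⁻ ⁅ v ⁆ ⁅ w ⁆ x∈
    ... | inj₁ x∈v = inj₁ (x∈⁅y⁆⇒x≡y v x∈v)
    ... | inj₂ x∈w = inj₂ (x∈⁅y⁆⇒x≡y w x∈w)
    x₁ x₂ x₃ : Fin _
    x₁ = vertex (gap a b) (s≤s z≤n) (gap-< a≢b) true
    x₂ = vertex (gap a b) (s≤s z≤n) (gap-< a≢b) false
    x₃ = vertex (gap c d) (s≤s z≤n) (gap-< c≢d) true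
    x₁≢x₂ : x₁ ≢ x₂
    x₁≢x₂ eq with proj₂ (injective (s≤s z≤n) (gap-< a≢b) (s≤s z≤n) (gap-< a≢b) eq)
    ... | ()
    x₁≢x₃ : x₁ ≢ x₃
    x₁≢x₃ eq = gaps (proj₁ (injective (s≤s z≤n) (gap-< a≢b) (s≤s z≤n) (gap-< c≢d) eq))
    x₂≢x₃ : x₂ ≢ x₃
    x₂≢x₃ eq = gaps (proj₁ (injective (s≤s z≤n) (gap-< a≢b) (s≤s z≤n) (gap-< c≢d) eq))
    pigeonhole : x₁ ≡ v ⊎ x₁ ≡ w → x₂ ≡ v ⊎ x₂ ≡ w → ¬ (x₃ ≡ v ⊎ x₃ ≡ w)
    pigeonhole (inj₁ p) (inj₁ q) _        = x₁≢x₂ (trans p (sym q))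
    pigeonhole (inj₂ p) (inj₂ q) _        = x₁≢x₂ (trans p (sym q))
    pigeonhole (inj₁ p) (inj₂ _) (inj₁ r) = x₁≢x₃ (trans p (sym r))
    pigeonhole (inj₁ _) (inj₂ q) (inj₂ r) = x₂≢x₃ (trans q (sym r))
    pigeonhole (inj₂ _) (inj₁ q) (inj₁ r) = x₂≢x₃ (trans q (sym r))
    pigeonhole (inj₂ p) (inj₁ _) (inj₂ r) = x₁≢x₃ (trans p (sym r))

-- Mutation in the good part is an exchange

-- The entries 1 and -1 occur only once each in a root, so equal entries at distinct `c` and `d` are
-- both 0.
root-disjoint : (a b c d : Fin k) → a ≢ b → c ≢ d → diff (root a b) c d ≡ 0ℤ → a ≢ c × a ≢ d × b ≢ c × b ≢ d
root-disjoint a b c d a≢b c≢d eq with a Finₚ.≟ c | b Finₚ.≟ c | a Finₚ.≟ d | b Finₚ.≟ d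
root-disjoint a b c d a≢b c≢d eq | no ac | no bc | no ad | no bd = ac , ad , bc , bd
root-disjoint a b c d a≢b c≢d eq | yes p | yes q | _ | _ = contradiction (trans p (sym q)) a≢b
root-disjoint a b c d a≢b c≢d eq | _ | _ | yes p | yes q = contradiction (trans p (sym q)) a≢b
root-disjoint a b c d a≢b c≢d eq | yes p | _ | yes q | _ = contradiction (trans (sym p) q) c≢d
root-disjoint a b c d a≢b c≢d eq | _ | yes p | _ | yes q = contradiction (trans (sym p) q) c≢d
root-disjoint a b c d a≢b c≢d () | yes p | no _ | no _ | yes _
root-disjoint a b c d a≢b c≢d () | yes p | no _ | no _ | no _
root-disjoint a b c d a≢b c≢d () | no _ | yes _ | yes _ | no _
root-disjoint a b c d a≢b c≢d () | no _ | yes _ | no _ | no _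
root-disjoint a b c d a≢b c≢d () | no _ | no _ | yes _ | no _
root-disjoint a b c d a≢b c≢d () | no _ | no _ | no _ | yes _

module _ {p : Fin m} {s s₀ : PSeed n k m} (valid₀ : Valid p s₀) (rich : Rich (π[ p ] s₀))
  (reachable : s ∈𝔼-good[ s₀ ]) (v : Fin n) (good′ : Good (mutate v s)) where

  private
    C  = π[ p ] s
    C′ = π[ p ] (mutate v s)
    q  = arrows s
    good = reachable-good reachable
    tidy : Tidy C
    tidy = good⇒Tidy C (proj₁ (good p)) (proj₂ (good p))
    tidy′ : Tidy C′
    tidy′ = good⇒Tidy C′ (proj₁ (good′ p)) (proj₂ (good′ p))
    open Valid (reachable-valid valid₀ reachable)

    agree : ∀ {u} → u ≢ v → ∀ i → C u i ≡ C′ u i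
    agree u≢v i = sym (weight-unchanged s v p u≢v i)

    agree-diff : ∀ {u} → u ≢ v → ∀ a b → diff (C u) a b ≡ diff (C′ u) a b
    agree-diff u≢v a b = cong₂ _-_ (agree u≢v a) (agree u≢v b)

    confined₀ : ∀ {Z a b} → Confined p Z a b s → Confined p Z a b s₀
    confined₀ = reachable-confined valid₀ reachable

    factor : ∀ x c d → x * c - x * d ≡ x * (c - d)
    factor = solve-∀

    balanced-diff : ∀ w a b → sum (λ u → signedArrows q u w * diff (C u) a b) ≡ 0ℤ
    balanced-diff w a b = trans (sum-cong-≗ λ u → sym (factor (signedArrows q u w) (C u a) (C u b)))
      (trans (sum-difference (λ u → signedArrows q u w * C u a) (λ u → signedArrows q u w * C u b))
        (cong₂ _-_ (balanced w a) (balanced w b)))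

    -- Projected to the difference at `a`, `b`, the balance at any vertex involves only the two
    -- vectors that tell these coordinates apart.
    balanced-pair : ∀ {u w a b} → u ≢ w → (∀ x → x ≢ u → x ≢ w → diff (C x) a b ≡ 0ℤ) → ∀ x →
      signedArrows q u x * diff (C u) a b + signedArrows q w x * diff (C w) a b ≡ 0ℤ
    balanced-pair {a = a} {b} u≢w rest≡0 x = trans
      (sym (sum-pair (λ u → signedArrows q u x * diff (C u) a b) u≢w
      λ y y≢u y≢w → trans (cong (signedArrows q y x *_) (rest≡0 y y≢u y≢w))
        (ℤₚ.*-zeroʳ (signedArrows q y x))))
      (balanced-diff x a b)

    mutated-diff : ∀ {w a b} → w ≢ v → (∀ x → x ≢ w → x ≢ v → diff (C x) a b ≡ 0ℤ) →
      diff (C′ v) a b ≡ - diff (C v) a b + ℤ.+ q w v * diff (C w) a b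
    mutated-diff {w} {a} {b} w≢v rest≡0 = begin
      diff (C′ v) a b
        ≡⟨ cong₂ _-_ (weight-mutated s v p a) (weight-mutated s v p b) ⟩
      (- C v a + sum (λ u → ℤ.+ q u v * C u a)) - (- C v b + sum (λ u → ℤ.+ q u v * C u b))
        ≡⟨ lemma (C v a) (C v b) (sum λ u → ℤ.+ q u v * C u a) (sum λ u → ℤ.+ q u v * C u b) ⟩
      - diff (C v) a b + (sum (λ u → ℤ.+ q u v * C u a) - sum (λ u → ℤ.+ q u v * C u b))
        ≡⟨ cong (λ z → - diff (C v) a b + z) incoming ⟩
      - diff (C v) a b + ℤ.+ q w v * diff (C w) a b ∎
      where
      open ≡-Reasoning
      lemma : ∀ i j x y → (- i + x) - (- j + y) ≡ - (i - j) + (x - y)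
      lemma = solve-∀
      term : ∀ x → x ≢ w → ℤ.+ q x v * diff (C x) a b ≡ 0ℤ
      term x x≢w with x Finₚ.≟ v
      ... | yes refl = cong (λ y → ℤ.+ y * diff (C v) a b) (antisymmetric-loop antisymmetric v)
      ... | no x≢v   = trans (cong (λ y → ℤ.+ q x v * y) (rest≡0 x x≢w x≢v)) (ℤₚ.*-zeroʳ (ℤ.+ q x v))
      incoming : sum (λ u → ℤ.+ q u v * C u a) - sum (λ u → ℤ.+ q u v * C u b) ≡ ℤ.+ q w v * diff (C w) a b
      incoming = trans (sym (sum-difference (λ u → ℤ.+ q u v * C u a) (λ u → ℤ.+ q u v * C u b)))
        (trans (sum-cong-≗ λ u → factor (ℤ.+ q u v) (C u a) (C u b))
          (sum-single (λ u → ℤ.+ q u v * diff (C u) a b) w term))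

    signed-loop : signedArrows q v v ≡ 0ℤ
    signed-loop = ℤₚ.+-inverseʳ (ℤ.+ q v v)

    -- If only v and w tell a and b apart, balance at v leaves no arrow between them.
    no-arrows : ∀ {w a b} → w ≢ v → (∀ x → x ≢ w → x ≢ v → diff (C x) a b ≡ 0ℤ) →
      diff (C w) a b ≡ 1ℤ → q w v ≡ 0
    no-arrows {w} {a} {b} w≢v rest≡0 w≡1 = proj₁ (signedArrows≡0 antisymmetric w v
      (trans (lemma (signedArrows q w v) (diff (C v) a b))
        (trans (cong₂ (λ x y → signedArrows q w v * x + y * diff (C v) a b) (sym w≡1) (sym signed-loop))
          (balanced-pair w≢v rest≡0 v))))
      where
      lemma : ∀ x y → x ≡ x * 1ℤ + 0ℤ * y
      lemma = solve-∀

    mutated-flip : ∀ {w a b} → w ≢ v → (∀ x → x ≢ w → x ≢ v → diff (C x) a b ≡ 0ℤ) →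
      diff (C w) a b ≡ 1ℤ → diff (C′ v) a b ≡ - diff (C v) a b
    mutated-flip {w} {a} {b} w≢v rest≡0 w≡1 = trans (mutated-diff w≢v rest≡0)
      (trans (cong (λ x → - diff (C v) a b + ℤ.+ x * diff (C w) a b) (no-arrows w≢v rest≡0 w≡1))
        (ℤₚ.+-identityʳ _))

    turn : ∀ {a b} → Merged v C a b → diff (C′ v) a b ≡ 1ℤ
    turn (w , r) = trans (mutated-flip (Root⇒u≢w {C = C} r) (λ x → Tidy.others-vanish tidy r) (up r)) (cong -_ (down r))

    others-vanish′ : ∀ {w a b} → Root (C′ w) (C′ v) a b → ∀ x → x ≢ w → x ≢ v → diff (C x) a b ≡ 0ℤ
    others-vanish′ r x x≢w x≢v = trans (agree-diff x≢v _ _) (Tidy.others-vanish tidy′ r x≢w x≢v)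

    up′ : ∀ {w a b} → Root (C′ w) (C′ v) a b → diff (C w) a b ≡ 1ℤ
    up′ r = trans (agree-diff (Root⇒u≢w {C = C′} r) _ _) (up r)

    turn′ : ∀ {a b} → Merged v C′ a b → diff (C v) a b ≡ 1ℤ
    turn′ {a} {b} (w , r) = trans (sym (ℤₚ.neg-involutive (diff (C v) a b)))
      (cong -_ (trans (sym (mutated-flip (Root⇒u≢w {C = C′} r) (others-vanish′ r) (up′ r))) (down r)))

    isolate : ∀ {z} → (∀ x → signedArrows q z x ≡ 0ℤ) → Isolated q z
    isolate b≡0 x = signedArrows≡0 antisymmetric _ x (b≡0 x)

    -- If no vertex other than `v` tells `a` and `b` apart, then either `v` does not either, or
    -- balance at each vertex leaves no arrow joining it to `v`. The pair is then confined to the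
    -- empty set or to the isolated vertex `v`, contradicting the richness of the initial seed.
    separated : ∀ a b → a ≢ b → ∃ λ u → u ≢ v × diff (C u) a b ≢ 0ℤ
    separated a b a≢b with Finₚ.any? (λ u → ¬? (u Finₚ.≟ v) ×-dec ¬? (diff (C u) a b ℤₚ.≟ 0ℤ))
    ... | yes found = found
    ... | no none = ⊥-elim (refute (diff (C v) a b ℤₚ.≟ 0ℤ))
      where
      equal : ∀ u → u ≢ v → diff (C u) a b ≡ 0ℤ
      equal u u≢v with diff (C u) a b ℤₚ.≟ 0ℤ
      ... | yes eq = eq
      ... | no neq = contradiction (u , u≢v , neq) none
      refute : Dec (diff (C v) a b ≡ 0ℤ) → _
      refute (yes v≡0) = ¬confined-single {p = p} {s₀} rich {Z = Subset.⊥} {v}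
        (λ x∈ → contradiction x∈ ∉⊥) a≢b
        (confined₀ record { isolated = λ z∈ → contradiction z∈ ∉⊥ ; equal = λ {u} _ → all-equal u })
        where
        all-equal : ∀ u → diff (C u) a b ≡ 0ℤ
        all-equal u with u Finₚ.≟ v
        ... | yes refl = v≡0
        ... | no u≢v   = equal u u≢v
      refute (no v≢0) = ¬confined-single {p = p} {s₀} rich {Z = ⁅ v ⁆} {v} (λ x∈ → x∈) a≢b
        (confined₀ record
          { isolated = λ z∈ → subst (Isolated q) (sym (x∈⁅y⁆⇒x≡y v z∈)) (isolate isolated-v)
          ; equal    = λ u∉ → equal _ λ { refl → u∉ (x∈⁅x⁆ v) } })
        where
        isolated-v : ∀ x → signedArrows q v x ≡ 0ℤ
        isolated-v x with ℤₚ.i*j≡0⇒i≡0∨j≡0 (signedArrows q v x)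
          (trans (sym (sum-single (λ u → signedArrows q u x * diff (C u) a b) v λ u u≢v →
            trans (cong (signedArrows q u x *_) (equal u u≢v)) (ℤₚ.*-zeroʳ (signedArrows q u x))))
              (balanced-diff x a b))
        ... | inj₁ eq = eq
        ... | inj₂ eq = contradiction eq v≢0

    -- If the partners of `v` before and after are different, `w` does not tell `c` and `d` apart
    -- while `v` has difference 1. So the root through `a` and `b` has difference -1 at `c`, `d`,
    -- and they share a coordinate. If the partners coincide, `w` and `v` both have difference 1 at
    -- `c`, `d`. The pairs are then disjoint, `v` and `w` are isolated, and both pairs are confined
    -- to these two vertices.
    cross : ∀ {a b c d} → Merged v C a b → Merged v C′ c d → b ≡ c ⊎ a ≡ d
    cross {a} {b} {c} {d} m@(w , r) m′@(w′ , r′) with w Finₚ.≟ w′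
    ... | no w≢w′ = swap (root-difference<0 c d a b (subst (_< 0ℤ) (sym root≡) -<+))
      where
      w≢v = Root⇒u≢w {C = C} r
      root≡ : diff (root a b) c d ≡ -1ℤ
      root≡ = trans (root-shift r c d) (cong₂ _-_ (others-vanish′ r′ w w≢w′ w≢v) (turn′ m′))
      swap : c ≡ b ⊎ d ≡ a → b ≡ c ⊎ a ≡ d
      swap (inj₁ eq) = inj₁ (sym eq)
      swap (inj₂ eq) = inj₂ (sym eq)
    ... | yes refl = ⊥-elim (¬confined-double {p = p} {s₀} rich {v} {w} (Root.a≢b r) (Root.a≢b r′)
        (gap-injective a≢c a≢d b≢c b≢d)
        (confined₀ record { isolated = isolated ; equal = λ u∉ → Tidy.others-vanish tidy r (u∉ ∘ w∈) (u∉ ∘ v∈) })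
        (confined₀ record { isolated = isolated ; equal = λ u∉ → others-vanish′ r′ _ (u∉ ∘ w∈) (u∉ ∘ v∈) }))
      where
      w≢v = Root⇒u≢w {C = C} r
      disjoint = root-disjoint a b c d (Root.a≢b r) (Root.a≢b r′)
        (trans (root-shift r c d) (cong₂ _-_ (up′ r′) (turn′ m′)))
      a≢c = proj₁ disjoint
      a≢d = proj₁ (proj₂ disjoint)
      b≢c = proj₁ (proj₂ (proj₂ disjoint))
      b≢d = proj₂ (proj₂ (proj₂ disjoint))
      v∈ : ∀ {x} → x ≡ v → x ∈ ⁅ v ⁆ ∪ ⁅ w ⁆
      v∈ refl = p⊆p∪q ⁅ w ⁆ (x∈⁅x⁆ v)
      w∈ : ∀ {x} → x ≡ w → x ∈ ⁅ v ⁆ ∪ ⁅ w ⁆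
      w∈ refl = q⊆p∪q ⁅ v ⁆ ⁅ w ⁆ (x∈⁅x⁆ w)
      -- The signed arrows from w and v are equal by balance through a and b,
      -- and opposite by balance through c and d.
      balance₁ : ∀ x → signedArrows q w x * 1ℤ + signedArrows q v x * -1ℤ ≡ 0ℤ
      balance₁ x = trans (cong₂ (λ y z → signedArrows q w x * y + signedArrows q v x * z) (sym (up r)) (sym (down r)))
        (balanced-pair w≢v (λ x → Tidy.others-vanish tidy r) x)
      balance₂ : ∀ x → signedArrows q w x * 1ℤ + signedArrows q v x * 1ℤ ≡ 0ℤ
      balance₂ x = trans (cong₂ (λ y z → signedArrows q w x * y + signedArrows q v x * z) (sym (up′ r′)) (sym (turn′ m′)))
        (balanced-pair w≢v (others-vanish′ r′) x)
      cancel-2 : ∀ {i} → ℤ.+ 2 * i ≡ 0ℤ → i ≡ 0ℤ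
      cancel-2 {i} eq = ℤₚ.*-cancelˡ-≡ (ℤ.+ 2) i 0ℤ eq
      add : ∀ x y → ℤ.+ 2 * x ≡ (x * 1ℤ + y * -1ℤ) + (x * 1ℤ + y * 1ℤ)
      add = solve-∀
      subtract : ∀ x y → ℤ.+ 2 * y ≡ (x * 1ℤ + y * 1ℤ) - (x * 1ℤ + y * -1ℤ)
      subtract = solve-∀
      isolated : ∀ {z} → z ∈ ⁅ v ⁆ ∪ ⁅ w ⁆ → Isolated q z
      isolated z∈ with x∈p∪q⁻ ⁅ v ⁆ ⁅ w ⁆ z∈
      ... | inj₁ z∈v = subst (Isolated q) (sym (x∈⁅y⁆⇒x≡y v z∈v)) (isolate λ x → cancel-2
        (trans (subtract (signedArrows q w x) (signedArrows q v x)) (cong₂ _-_ (balance₂ x) (balance₁ x))))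
      ... | inj₂ z∈w = subst (Isolated q) (sym (x∈⁅y⁆⇒x≡y w z∈w)) (isolate λ x → cancel-2
        (trans (add (signedArrows q w x) (signedArrows q v x)) (cong₂ _+_ (balance₁ x) (balance₂ x))))

  mutation-exchange : Exchange v C C′
  mutation-exchange = record
    { agree = agree ; tidy = tidy ; tidy′ = tidy′ ; separated = separated
    ; turn = turn ; turn′ = turn′ ; cross = cross }

-- Weights and vertices at a puncture of the triangulation

ω-below : ∀ l (a : Fin k) → toℕ a ℕ.< l → ω l a ≡ 1ℤ
ω-below l a lt = cong (λ b → if b then 1ℤ else 0ℤ) (dec-true (toℕ a ℕₚ.<? l) lt)

ω-above : ∀ l (a : Fin k) → l ℕ.≤ toℕ a → ω l a ≡ 0ℤ
ω-above l a le = cong (λ b → if b then 1ℤ else 0ℤ) (dec-false (toℕ a ℕₚ.<? l) (ℕₚ.≤⇒≯ le))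

ω-antitone : ∀ l (a b : Fin k) → toℕ a ℕ.≤ toℕ b → ω l b ≤ ω l a
ω-antitone l a b le with ℕₚ.<-≤-connex (toℕ b) l | ℕₚ.<-≤-connex (toℕ a) l
... | inj₁ b<l | _        = ℤₚ.≤-reflexive (trans (ω-below l b b<l) (sym (ω-below l a (ℕₚ.≤-<-trans le b<l))))
... | inj₂ l≤b | inj₁ a<l = subst₂ _≤_ (sym (ω-above l b l≤b)) (sym (ω-below l a a<l)) (+≤+ z≤n)
... | inj₂ l≤b | inj₂ l≤a = ℤₚ.≤-reflexive (trans (ω-above l b l≤b) (sym (ω-above l a l≤a)))

prev : Fin 3 → Fin 3
prev 0F = 2F
prev 1F = 0F
prev 2F = 1F

next-prev : ∀ i → next (prev i) ≡ i
next-prev 0F = refl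
next-prev 1F = refl
next-prev 2F = refl

prev-≢ : ∀ i → prev i ≢ i
prev-≢ 0F ()
prev-≢ 1F ()
prev-≢ 2F ()

pairs-∈ : ∀ x y {d} → x ℕ.+ y ≡ d → (x , y) List.∈ pairs d
pairs-∈ x y refl = subst (List._∈ pairs (x ℕ.+ y)) (cong (x ,_) (ℕₚ.m+n∸m≡n x y))
  (Listₘ.∈-map⁺ _ (Listₘ.∈-upTo⁺ (s≤s (ℕₚ.m≤m+n x y))))

positivePairs-∈ : ∀ x y {d} → x ℕ.+ y ≡ d → (suc x , suc y) List.∈ positivePairs (suc (suc d))
positivePairs-∈ x y eq = Listₘ.∈-map⁺ _ (pairs-∈ x y eq)

module Surface (Δ : Triangulation) where
  open Triangulation Δ

  onSide-true : ∀ {t i e} → side t i ≡ just (e , true) → ∀ x y → onSide Δ t i x y ≡ onArc e x y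
  onSide-true eq x y rewrite eq = refl

  onSide-false : ∀ {t i e} → side t i ≡ just (e , false) → ∀ x y → onSide Δ t i x y ≡ onArc e y x
  onSide-false eq x y rewrite eq = refl

  source target : Fin arcs → Corner
  source e = sideOf e true
  target e = let (t , i) = sideOf e true in t , next i

  corner-source : ∀ {t i e} → side t i ≡ just (e , false) → corner (source e) ≡ corner (t , next i)
  corner-source {t} {i} {e} eq = Equivalence.from corner-glued
    (fwd (e , inj₁ (refl , cong (λ (t , i) → t , next i) (sym (Equivalence.to side-sideOf eq)))) ◅ Star.ε)

  corner-target : ∀ {t i e} → side t i ≡ just (e , false) → corner (target e) ≡ corner (t , i)
  corner-target {t} {i} {e} eq = Equivalence.from corner-glued
    (fwd (e , inj₂ (refl , sym (Equivalence.to side-sideOf eq))) ◅ Star.ε)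

  -- Boundary intervals end in boundary points, so both sides of a triangle at a puncture are arcs
  -- and carry mutable vertices.
  not-boundary : ∀ {t i q} → corner (t , i) ≡ inj₁ q → side t i ≢ nothing × side t (prev i) ≢ nothing
  not-boundary {t} {i} eq = starts , ends
    where
    starts : side t i ≢ nothing
    starts b with boundary-ends b
    ... | (_ , at-start) , _ = contradiction (trans (sym eq) at-start) λ ()
    ends : side t (prev i) ≢ nothing
    ends b with boundary-ends b
    ... | _ , (_ , at-end) = contradiction
      (trans (sym eq) (trans (cong (λ j → corner (t , j)) (sym (next-prev i))) at-end)) λ ()

  module Weights (k : ℕ) (p : Fin punctures) (a : Fin k) where

    W : Vertex Δ → ℤ
    W z = vertexWeight Δ k z p a

    τ : Corner → ℕ → ℤ
    τ c x = at Δ k (corner c) x p a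

    at-zero : ∀ q → at Δ k q 0 p a ≡ 0ℤ
    at-zero (inj₂ _) = refl
    at-zero (inj₁ q) with q Finₚ.≟ p
    ... | yes _ = refl
    ... | no _  = refl

    τ-zero : ∀ c → τ c 0 ≡ 0ℤ
    τ-zero c = at-zero (corner c)

    -- `vertexWeight` reads the ends of an arc from its `true` side. Seen from the `false` side the
    -- ends are interchanged, and so are the coordinates in `onSide`.
    W-onSide : ∀ t i x y → W (onSide Δ t i x y) ≡ τ (t , i) x + τ (t , next i) y
    W-onSide t i x y with side t i in eq
    ... | nothing          = refl
    ... | just (e , true)  = cong (λ (t , i) → τ (t , i) x + τ (t , next i) y) (Equivalence.to side-sideOf eq)
    ... | just (e , false) = trans
      (cong₂ (λ q r → at Δ k q y p a + at Δ k r x p a) (corner-source eq) (corner-target eq))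
      (ℤₚ.+-comm (τ (t , next i) y) (τ (t , i) x))

    -- One formula for inner vertices and vertices on sides, since a coordinate 0 contributes ω₀ =
    -- 0.
    W-place : ∀ t x y z → W (place Δ t (x , y , z)) ≡ τ (t , 0F) x + τ (t , 1F) y + τ (t , 2F) z
    W-place t x y zero = trans (W-onSide t 0F x y) (sym (trans (cong (λ z → τ (t , 0F) x + τ (t , 1F) y + z)
      (τ-zero (t , 2F))) (ℤₚ.+-identityʳ _)))
    W-place t zero y z@(suc _) = trans (W-onSide t 1F y z)
      (cong (_+ τ (t , 2F) z) (sym (trans (cong (_+ τ (t , 1F) y) (τ-zero (t , 0F))) (ℤₚ.+-identityˡ (τ (t , 1F) y)))))
    W-place t x@(suc _) zero z@(suc _) = trans (W-onSide t 2F z x)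
      (trans (ℤₚ.+-comm (τ (t , 2F) z) (τ (t , 0F) x))
      (cong (_+ τ (t , 2F) z) (sym (trans (cong (λ z → τ (t , 0F) x + z) (τ-zero (t , 1F))) (ℤₚ.+-identityʳ (τ (t , 0F) x))))))
    W-place t (suc _) (suc _) (suc _) = refl

    τ-boundary : ∀ {t i} → side t i ≡ nothing → ∀ x → τ (t , i) x ≡ 0ℤ × τ (t , next i) x ≡ 0ℤ
    τ-boundary b x with boundary-ends b
    ... | (_ , eq) , (_ , eq′) = cong (λ q → at Δ k q x p a) eq , cong (λ q → at Δ k q x p a) eq′

    W-boundary : ∀ {t i} → side t i ≡ nothing → ∀ x y → W (onSide Δ t i x y) ≡ 0ℤ
    W-boundary {t} {i} b x y = trans (W-onSide t i x y)
      (cong₂ _+_ (proj₁ (τ-boundary b x)) (proj₂ (τ-boundary b y)))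

  module _ (k : ℕ) (M : ModuliSpace) where

    onArc-mutable : ∀ e {x y} → (x , y) List.∈ positivePairs k → onArc e x y List.∈ mutableVertices Δ k M
    onArc-mutable e xy∈ = Listₘ.∈-++⁺ʳ (concatMap (innerVertices Δ k M) (allFin triangles))
      (Listₘ.∈-concatMap⁺ _ (List.lose (Listₘ.∈-allFin e) (Listₘ.∈-map⁺ _ xy∈)))

  onSide-mutable : ∀ {d} M {t i} → side t i ≢ nothing → ∀ x y → x ℕ.+ y ≡ d →
    onSide Δ t i (suc x) (suc y) List.∈ mutableVertices Δ (suc (suc d)) M
  onSide-mutable {d} M {t} {i} ¬b x y eq with side t i
  ... | nothing          = contradiction refl ¬b
  ... | just (e , true)  = onArc-mutable (suc (suc d)) M e (positivePairs-∈ x y eq)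
  ... | just (e , false) = onArc-mutable (suc (suc d)) M e (positivePairs-∈ y x (trans (ℕₚ.+-comm y x) eq))

  -- In a regular triangulation the two sides of an arc belong to different triangles, so different
  -- sides of one triangle are different arcs.
  onSide-injective : Regular Δ → ∀ {t i j x y x′ y′} → side t i ≢ nothing → side t j ≢ nothing →
    onSide Δ t i x y ≡ onSide Δ t j x′ y′ → i ≡ j × x ≡ x′ × y ≡ y′
  onSide-injective regular {t} {i} {j} ¬b ¬b′ eq with side t i in si | side t j in sj
  ... | nothing | _ = contradiction refl ¬b
  ... | just _ | nothing = contradiction refl ¬b′
  onSide-injective regular ¬b ¬b′ refl | just (e , true)  | just (_ , true)  =
    ,-injectiveʳ (trans (sym (Equivalence.to side-sideOf si)) (Equivalence.to side-sideOf sj)) , refl , refl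
  onSide-injective regular ¬b ¬b′ refl | just (e , false) | just (_ , false) =
    ,-injectiveʳ (trans (sym (Equivalence.to side-sideOf si)) (Equivalence.to side-sideOf sj)) , refl , refl
  onSide-injective regular ¬b ¬b′ refl | just (e , true)  | just (_ , false) =
    contradiction (trans (cong proj₁ (Equivalence.to side-sideOf si))
      (sym (cong proj₁ (Equivalence.to side-sideOf sj)))) (regular e)
  onSide-injective regular ¬b ¬b′ refl | just (e , false) | just (_ , true)  =
    contradiction (trans (cong proj₁ (Equivalence.to side-sideOf sj))
      (sym (cong proj₁ (Equivalence.to side-sideOf si)))) (regular e)

  module _ {d : ℕ} (M : ModuliSpace) (regular : Regular Δ) (p : Fin punctures) where

    private
      k₀ = suc (suc d)
      s₀ = initialPSeed Δ k₀ M

    -- At a corner of a triangle at `p`, one side starts and another ends. On each, the vertex of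
    -- level `l` has coordinate `l` at `p`. Its weight is ω_l, plus another fundamental weight if
    -- the far end is `p` too; as all of these are weakly decreasing, the drop of ω_l cannot be
    -- cancelled.
    initial-rich : Rich (π[ p ] s₀)
    initial-rich with corner-surjective (inj₁ p)
    ... | (t , i) , at-p = record { vertex = vertex ; injective = injective ; separates = separates }
      where
      ¬b  = proj₁ (not-boundary at-p)
      ¬b′ = proj₂ (not-boundary at-p)
      levels : ∀ {l} → 1 ℕ.≤ l → l ℕ.< k₀ → ∃₂ λ x y → l ≡ suc x × x ℕ.+ y ≡ d
      levels {suc x} _ (s≤s (s≤s x≤d)) = x , d ∸ x , refl , ℕₚ.m+[n∸m]≡n x≤d
      member : ∀ l → 1 ℕ.≤ l → l ℕ.< k₀ → ∀ b → ∃ λ z → z List.∈ mutableVertices Δ k₀ M × (∃ λ y →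
        z ≡ (if b then onSide Δ t i l (suc y) else onSide Δ t (prev i) (suc y) l))
      member l p q true  = let (x , y , l≡ , eq) = levels p q in
        onSide Δ t i (suc x) (suc y) , onSide-mutable M ¬b x y eq , y , cong
          (λ l → onSide Δ t i l (suc y)) (sym l≡)
      member l p q false = let (x , y , l≡ , eq) = levels p q in
        onSide Δ t (prev i) (suc y) (suc x) , onSide-mutable M ¬b′ y x (trans (ℕₚ.+-comm y x) eq) , y ,
        cong (λ l → onSide Δ t (prev i) (suc y) l) (sym l≡)
      vertex : ∀ l → 1 ℕ.≤ l → l ℕ.< k₀ → Bool → Fin _
      vertex l p q b = Any.index (proj₁ (proj₂ (member l p q b)))
      located : ∀ l p q b → lookup (mutableVertices Δ k₀ M) (vertex l p q b) ≡ proj₁ (member l p q b)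
      located l p q b = sym (Anyₚ.lookup-index (proj₁ (proj₂ (member l p q b))))
      form : ∀ l p q b → lookup (mutableVertices Δ k₀ M) (vertex l p q b) ≡
        (let y = proj₁ (proj₂ (proj₂ (member l p q b))) in
          if b then onSide Δ t i l (suc y) else onSide Δ t (prev i) (suc y) l)
      form l p q b = trans (located l p q b) (proj₂ (proj₂ (proj₂ (member l p q b))))
      injective : ∀ {l l′} p q p′ q′ {b b′} → vertex l p q b ≡ vertex l′ p′ q′ b′ → l ≡ l′ × b ≡ b′
      injective {l} {l′} p q p′ q′ {b} {b′} eq = compareForms b b′
        (trans (sym (form l p q b)) (trans (cong (lookup (mutableVertices Δ k₀ M)) eq) (form l′ p′ q′ b′)))
        where
        compareForms : ∀ b b′ {y y′} →
          (if b then onSide Δ t i l (suc y) else onSide Δ t (prev i) (suc y) l) ≡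
          (if b′ then onSide Δ t i l′ (suc y′) else onSide Δ t (prev i) (suc y′) l′) → l ≡ l′ × b ≡ b′
        compareForms true  true  e = proj₁ (proj₂ (onSide-injective regular ¬b ¬b e)) , refl
        compareForms false false e = proj₂ (proj₂ (onSide-injective regular ¬b′ ¬b′ e)) , refl
        compareForms true  false e = contradiction
          (sym (proj₁ (onSide-injective regular ¬b ¬b′ e))) (prev-≢ i)
        compareForms false true  e = contradiction (proj₁ (onSide-injective regular ¬b′ ¬b e)) (prev-≢ i)
      at-puncture : ∀ {q} → q ≡ inj₁ p → ∀ l a → at Δ k₀ q l p a ≡ ω l a
      at-puncture refl l a with p Finₚ.≟ p
      ... | yes _  = refl
      ... | no p≢p = contradiction refl p≢p
      at-antitone : ∀ q l a b → toℕ a ℕ.≤ toℕ b → at Δ k₀ q l p b ≤ at Δ k₀ q l p a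
      at-antitone (inj₂ _) l a b le = ℤₚ.≤-refl
      at-antitone (inj₁ q) l a b le with q Finₚ.≟ p
      ... | yes _ = ω-antitone l a b le
      ... | no _  = ℤₚ.≤-refl
      at-strict : ∀ {q} → q ≡ inj₁ p → ∀ l a b → toℕ a ℕ.< l → l ℕ.≤ toℕ b → at Δ k₀ q l p b < at Δ k₀ q l p a
      at-strict eq l a b a<l l≤b = subst₂ _<_ (sym (trans (at-puncture eq l b) (ω-above l b l≤b)))
        (sym (trans (at-puncture eq l a) (ω-below l a a<l))) (+<+ (s≤s z≤n))
      decreases : ∀ l y c a b → toℕ a ℕ.< l → l ℕ.≤ toℕ b →
        vertexWeight Δ k₀ (if c then onSide Δ t i l y else onSide Δ t (prev i) y l) p b <
        vertexWeight Δ k₀ (if c then onSide Δ t i l y else onSide Δ t (prev i) y l) p a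
      decreases l y true a b a<l l≤b = subst₂ _<_ (sym (Weights.W-onSide k₀ p b t i l y))
        (sym (Weights.W-onSide k₀ p a t i l y))
        (ℤₚ.+-mono-<-≤ (at-strict at-p l a b a<l l≤b)
          (at-antitone (corner (t , next i)) y a b (ℕₚ.<⇒≤ (ℕₚ.<-≤-trans a<l l≤b))))
      decreases l y false a b a<l l≤b = subst₂ _<_ (sym (Weights.W-onSide k₀ p b t (prev i) y l))
        (sym (Weights.W-onSide k₀ p a t (prev i) y l))
        (ℤₚ.+-mono-≤-< (at-antitone (corner (t , prev i)) y a b (ℕₚ.<⇒≤ (ℕₚ.<-≤-trans a<l l≤b)))
          (at-strict (trans (cong (λ j → corner (t , j)) (next-prev i)) at-p) l a b a<l l≤b))
      separates : ∀ l p′ q c a b → toℕ a ℕ.< l → l ℕ.≤ toℕ b → diff (π[ p ] s₀ (vertex l p′ q c)) a b ≢ 0ℤ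
      separates l p′ q c a b a<l l≤b eq = ℤₚ.<⇒≢
        (subst (λ z → vertexWeight Δ k₀ z p b < vertexWeight Δ k₀ z p a) (sym (form l p′ q c))
          (decreases l _ c a b a<l l≤b))
        (sym (ℤₚ.i-j≡0⇒i≡j _ _ eq))

-- Sums over lists and antidiagonals

listSum : (A → ℤ) → List A → ℤ
listSum f []       = 0ℤ
listSum f (x ∷ xs) = f x + listSum f xs

listSum-++ : (f : A → ℤ) → ∀ xs ys → listSum f (xs ++ ys) ≡ listSum f xs + listSum f ys
listSum-++ f []       ys = sym (ℤₚ.+-identityˡ _)
listSum-++ f (x ∷ xs) ys = trans (cong (f x +_) (listSum-++ f xs ys)) (sym (ℤₚ.+-assoc (f x) _ _))

listSum-map : (f : B → ℤ) (g : A → B) → ∀ xs → listSum f (map g xs) ≡ listSum (f ∘ g) xs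
listSum-map f g []       = refl
listSum-map f g (x ∷ xs) = cong (f (g x) +_) (listSum-map f g xs)

listSum-concatMap : (f : B → ℤ) (g : A → List B) → ∀ xs →
  listSum f (concatMap g xs) ≡ listSum (λ x → listSum f (g x)) xs
listSum-concatMap f g []       = refl
listSum-concatMap f g (x ∷ xs) =
  trans (listSum-++ f (g x) (concatMap g xs)) (cong (listSum f (g x) +_) (listSum-concatMap f g xs))

listSum-cong : {f g : A → ℤ} → (∀ x → f x ≡ g x) → ∀ xs → listSum f xs ≡ listSum g xs
listSum-cong eq []       = refl
listSum-cong eq (x ∷ xs) = cong₂ _+_ (eq x) (listSum-cong eq xs)

listSum-allFin : ∀ {n} (f : Fin n → ℤ) → listSum f (allFin n) ≡ sum f
listSum-allFin {n} f = go n λ i → i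
  where
  go : ∀ m (g : Fin m → Fin n) → listSum f (tabulate g) ≡ sum (f ∘ g)
  go zero    g = refl
  go (suc m) g = cong (f (g Fin.zero) +_) (go m (g ∘ Fin.suc))

-- The sum over x + y = d, in a recursive form without truncated subtraction.
antidiagonal : ℕ → (ℕ → ℕ → ℤ) → ℤ
antidiagonal zero    h = h 0 0
antidiagonal (suc d) h = h 0 (suc d) + antidiagonal d (λ x y → h (suc x) y)

antidiagonal-cong : ∀ d {g h : ℕ → ℕ → ℤ} → (∀ x y → x ℕ.+ y ≡ d → g x y ≡ h x y) →
  antidiagonal d g ≡ antidiagonal d h
antidiagonal-cong zero    eq = eq 0 0 refl
antidiagonal-cong (suc d) eq = cong₂ _+_ (eq 0 (suc d) refl)
  (antidiagonal-cong d λ x y e → eq (suc x) y (cong suc e))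

private
  +-interchange : ∀ a b c d → (a + b) + (c + d) ≡ (a + c) + (b + d)
  +-interchange = solve-∀

antidiagonal-+ : ∀ d (g h : ℕ → ℕ → ℤ) →
  antidiagonal d (λ x y → g x y + h x y) ≡ antidiagonal d g + antidiagonal d h
antidiagonal-+ zero    g h = refl
antidiagonal-+ (suc d) g h =
  trans (cong (g 0 (suc d) + h 0 (suc d) +_) (antidiagonal-+ d (λ x y → g (suc x) y) (λ x y → h (suc x) y)))
    (+-interchange (g 0 (suc d)) (h 0 (suc d)) _ _)

antidiagonal-* : ∀ d c (h : ℕ → ℕ → ℤ) → antidiagonal d (λ x y → c * h x y) ≡ c * antidiagonal d h
antidiagonal-* zero    c h = refl
antidiagonal-* (suc d) c h = trans (cong (c * h 0 (suc d) +_) (antidiagonal-* d c (λ x y → h (suc x) y)))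
  (sym (ℤₚ.*-distribˡ-+ c (h 0 (suc d)) _))

antidiagonal-difference : ∀ d (g h : ℕ → ℕ → ℤ) →
  antidiagonal d (λ x y → g x y - h x y) ≡ antidiagonal d g - antidiagonal d h
antidiagonal-difference zero    g h = refl
antidiagonal-difference (suc d) g h =
  trans (cong (g 0 (suc d) - h 0 (suc d) +_)
    (antidiagonal-difference d (λ x y → g (suc x) y) (λ x y → h (suc x) y)))
    (lemma (g 0 (suc d)) (h 0 (suc d)) _ _)
  where
  lemma : ∀ a b c d → (a - b) + (c - d) ≡ (a + c) - (b + d)
  lemma = solve-∀

antidiagonal-last : ∀ d (h : ℕ → ℕ → ℤ) →
  antidiagonal (suc d) h ≡ antidiagonal d (λ x y → h x (suc y)) + h (suc d) 0
antidiagonal-last zero    h = refl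
antidiagonal-last (suc d) h = trans (cong (h 0 (suc (suc d)) +_) (antidiagonal-last d (λ x y → h (suc x) y)))
  (sym (ℤₚ.+-assoc (h 0 (suc (suc d))) _ _))

antidiagonal-swap : ∀ d (h : ℕ → ℕ → ℤ) → antidiagonal d h ≡ antidiagonal d (λ x y → h y x)
antidiagonal-swap zero    h = refl
antidiagonal-swap (suc d) h = trans (ℤₚ.+-comm (h 0 (suc d)) _)
  (trans (cong (_+ h 0 (suc d)) (antidiagonal-swap d (λ x y → h (suc x) y)))
    (sym (antidiagonal-last d (λ x y → h y x))))

antidiagonal-telescope : ∀ d (h : ℕ → ℕ → ℤ) →
  antidiagonal d (λ x y → h x (suc y) - h (suc x) y) ≡ h 0 (suc d) - h (suc d) 0
antidiagonal-telescope zero    h = refl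
antidiagonal-telescope (suc d) h =
  trans (cong (h 0 (suc (suc d)) - h 1 (suc d) +_) (antidiagonal-telescope d (λ x y → h (suc x) y)))
    (lemma (h 0 (suc (suc d))) (h 1 (suc d)) (h (suc (suc d)) 0))
  where
  lemma : ∀ a b c → a - b + (b - c) ≡ a - c
  lemma = solve-∀

antidiagonal-assoc : ∀ d (g : ℕ → ℕ → ℕ → ℤ) →
  antidiagonal d (λ r c → antidiagonal r (λ a b → g a b c)) ≡ antidiagonal d
    (λ a r → antidiagonal r (λ b c → g a b c))
antidiagonal-assoc zero    g = refl
antidiagonal-assoc (suc d) g = begin
  g 0 0 (suc d) + antidiagonal d (λ r c → g 0 (suc r) c + antidiagonal r (λ a b → g (suc a) b c))
    ≡⟨ cong (g 0 0 (suc d) +_) (antidiagonal-+ d (λ r c → g 0 (suc r) c) _) ⟩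
  g 0 0 (suc d) + (antidiagonal d (λ r c → g 0 (suc r) c) + antidiagonal d (λ r c → antidiagonal r (λ a b → g (suc a) b c)))
    ≡⟨ ℤₚ.+-assoc (g 0 0 (suc d)) _ _ ⟨
  antidiagonal (suc d) (g 0) + antidiagonal d (λ r c → antidiagonal r (λ a b → g (suc a) b c))
    ≡⟨ cong (antidiagonal (suc d) (g 0) +_) (antidiagonal-assoc d (λ a → g (suc a))) ⟩
  antidiagonal (suc d) (g 0) + antidiagonal d (λ a r → antidiagonal r (λ b c → g (suc a) b c)) ∎
  where open ≡-Reasoning

-- Nested antidiagonals sum over the triangle a + b + c = d, which is invariant under rotation. This
-- allows telescoping in each of its three directions.
antidiagonal-cycle : ∀ d (g : ℕ → ℕ → ℕ → ℤ) →
  antidiagonal d (λ a r → antidiagonal r (λ b c → g a b c)) ≡ antidiagonal d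
    (λ b r → antidiagonal r (λ c a → g a b c))
antidiagonal-cycle d g = trans (antidiagonal-swap d (λ a r → antidiagonal r (λ b c → g a b c)))
  (antidiagonal-assoc d (λ b c a → g a b c))

-- The coefficient is constant along the line of fixed `i`, so the inner sum collapses to the two
-- ends of that line.
antidiagonal-telescope₂ : ∀ d (c : ℕ → ℤ) (h : ℕ → ℕ → ℕ → ℤ) →
  antidiagonal d (λ i r → antidiagonal r (λ j l → c i * (h i j (suc l) - h i (suc j) l))) ≡
  antidiagonal d (λ i r → c i * (h i 0 (suc r) - h i (suc r) 0))
antidiagonal-telescope₂ d c h = antidiagonal-cong d λ i r _ →
  trans (antidiagonal-* r (c i) (λ j l → h i j (suc l) - h i (suc j) l))
    (cong (c i *_) (antidiagonal-telescope r (h i)))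

pairs-sum : ∀ d (f : ℕ × ℕ → ℤ) → listSum f (pairs d) ≡ antidiagonal d (λ x y → f (x , y))
pairs-sum d f = trans (listSum-map f (λ a → a , d ∸ a) (upTo (suc d))) (go d (λ x y → f (x , y)))
  where
  go : ∀ d (h : ℕ → ℕ → ℤ) → listSum (λ a → h a (d ∸ a)) (upTo (suc d)) ≡ antidiagonal d h
  go zero    h = ℤₚ.+-identityʳ (h 0 0)
  go (suc d) h = cong (h 0 (suc d) +_)
    (trans (cong (listSum (λ a → h a (suc d ∸ a))) (sym (Listₚ.map-applyUpTo (λ x → x) suc (suc d))))
      (trans (listSum-map (λ a → h a (suc d ∸ a)) suc (upTo (suc d))) (go d (λ x y → h (suc x) y))))

complement : ∀ x y → x ℕ.+ y ≡ d → suc y ≡ suc d ∸ x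
complement x y eq =
  sym (trans (cong (_∸ x) (trans (cong suc (sym eq)) (sym (ℕₚ.+-suc x y)))) (ℕₚ.m+n∸m≡n x (suc y)))

positivePairs-sum : ∀ d (f : ℕ × ℕ → ℤ) →
  listSum f (positivePairs (suc (suc d))) ≡ antidiagonal d (λ x y → f (suc x , suc y))
positivePairs-sum d f = trans (listSum-map f _ (pairs d)) (pairs-sum d _)

triples-sum : ∀ d (f : ℕ × ℕ × ℕ → ℤ) →
  listSum f (triples d) ≡ antidiagonal d (λ a r → antidiagonal r (λ b c → f (a , b , c)))
triples-sum d f = trans (listSum-concatMap f (λ (a , r) → map (a ,_) (pairs r)) (pairs d))
  (trans (pairs-sum d (λ (a , r) → listSum f (map (a ,_) (pairs r))))
    (antidiagonal-cong d λ a r _ → trans (listSum-map f (a ,_) (pairs r)) (pairs-sum r (λ (b , c) → f (a , b , c)))))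

antidiagonal-zero : ∀ d → antidiagonal d (λ _ _ → 0ℤ) ≡ 0ℤ
antidiagonal-zero zero    = refl
antidiagonal-zero (suc d) = trans (ℤₚ.+-identityˡ _) (antidiagonal-zero d)

-- The sum over x < d. It serves the arrows of Q¹ that join neighbouring levels, of which there are
-- none if k = 2.
tailSum : ℕ → (ℕ → ℤ) → ℤ
tailSum zero    g = 0ℤ
tailSum (suc d) g = antidiagonal d (λ x _ → g x)

antidiagonal-head : ∀ d (g : ℕ → ℤ) → antidiagonal d (λ x _ → g x) ≡ g 0 + tailSum d (g ∘ suc)
antidiagonal-head zero    g = sym (ℤₚ.+-identityʳ (g 0))
antidiagonal-head (suc d) g = refl

tailSum-opposite : ∀ d {g h : ℕ → ℤ} → (∀ x → g x + h x ≡ 0ℤ) → tailSum d g + tailSum d h ≡ 0ℤ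
tailSum-opposite zero    eq = refl
tailSum-opposite (suc d) {g} {h} eq = trans (sym (antidiagonal-+ d (λ x _ → g x) (λ x _ → h x)))
  (trans (antidiagonal-cong d λ x _ _ → eq x) (antidiagonal-zero d))

positivePairs-tail : ∀ d (f : ℕ → ℤ) → listSum (λ (x , _) → f x) (positivePairs (suc d)) ≡ tailSum d (f ∘ suc)
positivePairs-tail zero    f = refl
positivePairs-tail (suc d) f = positivePairs-sum d (λ (x , _) → f x)

-- Balance of the glued quiver

next³ : ∀ i → next (next (next i)) ≡ i
next³ 0F = refl
next³ 1F = refl
next³ 2F = refl

sum-rotate : (f : Fin 3 → ℤ) → ∀ i → f i + (f (next i) + (f (next (next i)) + 0ℤ)) ≡ sum f
sum-rotate f 0F = refl
sum-rotate f 1F = lemma (f 1F) (f 2F) (f 0F)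
  where
  lemma : ∀ a b c → a + (b + (c + 0ℤ)) ≡ c + (a + (b + 0ℤ))
  lemma = solve-∀
sum-rotate f 2F = lemma (f 2F) (f 0F) (f 1F)
  where
  lemma : ∀ a b c → a + (b + (c + 0ℤ)) ≡ b + (c + (a + 0ℤ))
  lemma = solve-∀

module Balance (Δ : Triangulation) (d : ℕ) (p : Fin (Triangulation.punctures Δ)) (a : Fin (suc (suc d)))
  (z : Vertex Δ) where
  open Triangulation Δ
  open Surface Δ

  k₀ = suc (suc d)
  open Weights k₀ p a

  δ : Vertex Δ → ℤ
  δ x = if does (Defs._≟_ Δ x z) then 1ℤ else 0ℤ

  -- The contribution of an arrow to the balance at z.
  φ : Vertex Δ × Vertex Δ → ℤ
  φ (x , y) = δ y * W x - δ x * W y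

  ∂ : Corner → ℕ → ℤ
  ∂ c x = τ c (suc x) - τ c x

  -- The contribution of side i of t. That of a piece of the quiver telescopes
  -- to the contributions of the sides of its triangle.
  Ω : Fin triangles → Fin 3 → ℤ
  Ω t i = antidiagonal d λ x y → δ (onSide Δ t i (suc x) (suc y)) * (∂ (t , next i) y - ∂ (t , i) x)

  module _ (t : Fin triangles) where
    private
      pl : ℕ → ℕ → ℕ → Vertex Δ
      pl x y z = place Δ t (x , y , z)
      δ′ : ℕ → ℕ → ℕ → ℤ
      δ′ x y z = δ (pl x y z)
      α β γ : ℕ → ℤ
      α = ∂ (t , 0F)
      β = ∂ (t , 1F)
      γ = ∂ (t , 2F)
      S₁ S₂ S₃ : ℕ → ℕ → ℕ → ℤ
      S₁ i j l = α i * (δ′ (suc i) j (suc l) - δ′ (suc i) (suc j) l)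
      S₂ i j l = β j * (δ′ (suc i) (suc j) l - δ′ i (suc j) (suc l))
      S₃ i j l = γ l * (δ′ i (suc j) (suc l) - δ′ (suc i) j (suc l))

    -- Summation by parts: grouped by corners of `t`, the three arrows of a small triangle give the
    -- increment of τ at each corner times a difference of two indicators.
    triangle-contribution : ∀ i j l →
      φ (pl (suc i) (suc j) l , pl (suc i) j (suc l)) +
        (φ (pl (suc i) j (suc l) , pl i (suc j) (suc l)) +
          (φ (pl i (suc j) (suc l) , pl (suc i) (suc j) l) + 0ℤ))
      ≡ (S₁ i j l + S₂ i j l) + S₃ i j l
    triangle-contribution i j l
      rewrite W-place t (suc i) (suc j) l | W-place t (suc i) j (suc l) | W-place t i (suc j) (suc l) =
      lemma (δ′ (suc i) (suc j) l) (δ′ (suc i) j (suc l)) (δ′ i (suc j) (suc l))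
        (τ (t , 0F) i) (τ (t , 0F) (suc i)) (τ (t , 1F) j) (τ (t , 1F) (suc j)) (τ (t , 2F) l)
          (τ (t , 2F) (suc l))
      where
      lemma : ∀ X Y Z a a′ b b′ c c′ →
        (Y * (a′ + b′ + c) - X * (a′ + b + c′)) +
          ((Z * (a′ + b + c′) - Y * (a + b′ + c′)) + ((X * (a + b′ + c′) - Z * (a′ + b′ + c)) + 0ℤ))
        ≡ ((a′ - a) * (Y - X) + (b′ - b) * (X - Z)) + (c′ - c) * (Z - Y)
      lemma = solve-∀

    private
      In Out : Fin 3 → (ℕ → ℤ) → ℤ
      In  i c = antidiagonal d λ x y → δ (onSide Δ t i (suc x) (suc y)) * c y
      Out i c = antidiagonal d λ x y → δ (onSide Δ t i (suc x) (suc y)) * c x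

      Ω-split : ∀ i → Ω t i ≡ In i (∂ (t , next i)) - Out i (∂ (t , i))
      Ω-split i = trans (antidiagonal-cong d λ x y _ →
          lemma (δ (onSide Δ t i (suc x) (suc y))) (∂ (t , next i) y) (∂ (t , i) x))
        (antidiagonal-difference d (λ x y → δ (onSide Δ t i (suc x) (suc y)) * ∂ (t , next i) y)
          (λ x y → δ (onSide Δ t i (suc x) (suc y)) * ∂ (t , i) x))
        where
        lemma : ∀ x y z → x * (y - z) ≡ x * y - x * z
        lemma = solve-∀

      ends : ∀ c i j → antidiagonal d (λ x r → c x * (δ (onSide Δ t i (suc r) (suc x)) - δ (onSide Δ t j (suc x) (suc r))))
        ≡ In i c - Out j c
      ends c i j = trans (antidiagonal-cong d λ x y _ →
          lemma (c x) (δ (onSide Δ t i (suc y) (suc x))) (δ (onSide Δ t j (suc x) (suc y))))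
        (trans (antidiagonal-difference d (λ x y → δ (onSide Δ t i (suc y) (suc x)) * c x)
            (λ x y → δ (onSide Δ t j (suc x) (suc y)) * c x))
          (cong (_- Out j c) (antidiagonal-swap d (λ x y → δ (onSide Δ t i (suc y) (suc x)) * c x))))
        where
        lemma : ∀ x y z → x * (y - z) ≡ y * x - z * x
        lemma = solve-∀

      -- The part of a corner telescopes along the lines on which the coordinate at that corner is
      -- constant. These lines end on the two sides at the corner, one end giving an `In` and the
      -- other an `Out` half of the respective `Ω`.
      S₁-sum : antidiagonal d (λ i r → antidiagonal r (λ j l → S₁ i j l)) ≡ In 2F α - Out 0F α
      S₁-sum = trans (antidiagonal-telescope₂ d α (λ i j l → δ′ (suc i) j l)) (ends α 2F 0F)

      S₂-sum : antidiagonal d (λ i r → antidiagonal r (λ j l → S₂ i j l)) ≡ In 0F β - Out 1F β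
      S₂-sum = trans (antidiagonal-cycle d S₂)
        (trans (antidiagonal-telescope₂ d β (λ j l i → δ′ i (suc j) l)) (ends β 0F 1F))

      S₃-sum : antidiagonal d (λ i r → antidiagonal r (λ j l → S₃ i j l)) ≡ In 1F γ - Out 2F γ
      S₃-sum = trans (antidiagonal-cycle d S₃) (trans (antidiagonal-cycle d (λ j l i → S₃ i j l))
        (trans (antidiagonal-telescope₂ d γ (λ l i j → δ′ i j (suc l))) (ends γ 1F 2F)))

    Q-contribution : listSum φ (Q Δ k₀ t) ≡ Ω t 0F + (Ω t 1F + (Ω t 2F + 0ℤ))
    Q-contribution = begin
      listSum φ (Q Δ k₀ t)
        ≡⟨ listSum-concatMap φ arrowsAt (triples d) ⟩
      listSum (λ ijl → listSum φ (arrowsAt ijl)) (triples d)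
        ≡⟨ triples-sum d (λ ijl → listSum φ (arrowsAt ijl)) ⟩
      antidiagonal d (λ i r → antidiagonal r (λ j l → listSum φ (arrowsAt (i , j , l))))
        ≡⟨ antidiagonal-cong d (λ i r _ → trans (antidiagonal-cong r λ j l _ → triangle-contribution i j l)
             (trans (antidiagonal-+ r (λ j l → S₁ i j l + S₂ i j l) (S₃ i))
               (cong (_+ antidiagonal r (S₃ i)) (antidiagonal-+ r (S₁ i) (S₂ i))))) ⟩
      antidiagonal d (λ i r → (antidiagonal r (S₁ i) + antidiagonal r (S₂ i)) + antidiagonal r (S₃ i))
        ≡⟨ trans (antidiagonal-+ d (λ i r → antidiagonal r (S₁ i) + antidiagonal r (S₂ i)) (λ i r → antidiagonal r (S₃ i)))
             (cong (_+ antidiagonal d (λ i r → antidiagonal r (S₃ i)))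
               (antidiagonal-+ d (λ i r → antidiagonal r (S₁ i)) (λ i r → antidiagonal r (S₂ i)))) ⟩
      (antidiagonal d (λ i r → antidiagonal r (S₁ i)) + antidiagonal d (λ i r → antidiagonal r (S₂ i)))
        + antidiagonal d (λ i r → antidiagonal r (S₃ i))
        ≡⟨ cong₂ _+_ (cong₂ _+_ S₁-sum S₂-sum) S₃-sum ⟩
      ((In 2F α - Out 0F α) + (In 0F β - Out 1F β)) + (In 1F γ - Out 2F γ)
        ≡⟨ regroup (In 2F α) (Out 0F α) (In 0F β) (Out 1F β) (In 1F γ) (Out 2F γ) ⟩
      (In 0F β - Out 0F α) + ((In 1F γ - Out 1F β) + ((In 2F α - Out 2F γ) + 0ℤ))
        ≡⟨ cong₂ _+_ (Ω-split 0F) (cong₂ _+_ (Ω-split 1F) (cong (_+ 0ℤ) (Ω-split 2F))) ⟨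
      Ω t 0F + (Ω t 1F + (Ω t 2F + 0ℤ)) ∎
      where
      open ≡-Reasoning
      arrowsAt : ℕ × ℕ × ℕ → List (Vertex Δ × Vertex Δ)
      arrowsAt (i , j , l) = (pl (suc i) (suc j) l , pl (suc i) j (suc l)) ∷
        (pl (suc i) j (suc l) , pl i (suc j) (suc l)) ∷ (pl i (suc j) (suc l) , pl (suc i) (suc j) l) ∷ []
      regroup : ∀ a b c d e f → ((a - b) + (c - d)) + (e - f) ≡ (c - b) + ((e - d) + ((a - f) + 0ℤ))
      regroup = solve-∀

  Ω-boundary : ∀ {t i} → side t i ≡ nothing → Ω t i ≡ 0ℤ
  Ω-boundary {t} {i} b = trans (antidiagonal-cong d λ x y _ → trans
      (cong (δ (onSide Δ t i (suc x) (suc y)) *_) (cong₂ _-_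
        (cong₂ _-_ (proj₂ (τ-boundary b (suc y))) (proj₂ (τ-boundary b y)))
        (cong₂ _-_ (proj₁ (τ-boundary b (suc x))) (proj₁ (τ-boundary b x)))))
      (ℤₚ.*-zeroʳ (δ (onSide Δ t i (suc x) (suc y)))))
    (antidiagonal-zero d)

  module _ {t : Fin triangles} {i : Fin 3} (b : side t i ≡ nothing) where
    private
      L R : ℕ → Vertex Δ
      L x = onSide Δ t (next i) (k₀ ∸ x) x
      R x = onSide Δ t (next (next i)) x (k₀ ∸ x)

      T : ℕ → ℤ
      T = τ (t , next (next i))

      start-zero : ∀ x → τ (t , next (next (next i))) x ≡ 0ℤ
      start-zero x = trans (cong (λ j → τ (t , j) x) (next³ i)) (proj₁ (τ-boundary b x))

      W-L : ∀ x → W (L x) ≡ T x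
      W-L x = trans (W-onSide t (next i) (k₀ ∸ x) x)
        (trans (cong (_+ T x) (proj₂ (τ-boundary b (k₀ ∸ x)))) (ℤₚ.+-identityˡ _))

      W-R : ∀ x → W (R x) ≡ T x
      W-R x = trans (W-onSide t (next (next i)) x (k₀ ∸ x))
        (trans (cong (λ y → T x + y) (start-zero (k₀ ∸ x))) (ℤₚ.+-identityʳ _))

      E : ℕ → ℤ
      E x = δ (L (suc x)) - δ (R (suc x))

      Ω-L : Ω t (next i) ≡ antidiagonal d (λ x _ → δ (L (suc x)) * (T (suc x) - T x))
      Ω-L = trans (antidiagonal-cong d λ x y eq → cong₂ _*_
          (cong (λ n → δ (onSide Δ t (next i) n (suc y))) (complement y x (trans (ℕₚ.+-comm y x) eq)))
          (trans (cong₂ (λ u w → T (suc y) - T y - (u - w)) (proj₂ (τ-boundary b (suc x)))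
            (proj₂ (τ-boundary b x)))
            (ℤₚ.+-identityʳ _)))
        (antidiagonal-swap d (λ x y → δ (L (suc y)) * (T (suc y) - T y)))

      Ω-R : Ω t (next (next i)) ≡ antidiagonal d (λ x _ → - δ (R (suc x)) * (T (suc x) - T x))
      Ω-R = antidiagonal-cong d λ x y eq → trans (cong₂ _*_
          (cong (λ n → δ (onSide Δ t (next (next i)) (suc x) n)) (complement x y eq))
          (cong₂ (λ u w → u - w - (T (suc x) - T x)) (start-zero (suc y)) (start-zero y)))
        (lemma (δ (R (suc x))) (T (suc x) - T x))
        where
        lemma : ∀ x y → x * (0ℤ - 0ℤ - y) ≡ - x * y
        lemma = solve-∀

      first : ∀ x → φ (R (suc x) , L (suc x)) ≡ E x * T (suc x)
      first x rewrite W-L (suc x) | W-R (suc x) = lemma (δ (L (suc x))) (δ (R (suc x))) (T (suc x))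
        where
        lemma : ∀ l r c → l * c - r * c ≡ (l - r) * c
        lemma = solve-∀

      second : ∀ x → (φ (L (suc (suc x)) , R (suc x)) + (φ (R (suc x) , R (suc (suc x))) + 0ℤ)) + E (suc x) * T (suc x) ≡ 0ℤ
      second x rewrite W-L (suc (suc x)) | W-R (suc x) | W-R (suc (suc x)) =
        lemma (δ (L (suc (suc x)))) (δ (R (suc x))) (δ (R (suc (suc x)))) (T (suc x)) (T (suc (suc x)))
        where
        lemma : ∀ l r r′ c c′ → ((r * c′ - l * c) + ((r′ * c - r * c′) + 0ℤ)) + (l - r′) * c ≡ 0ℤ
        lemma = solve-∀

      third : φ (L 1 , base t) + (φ (base t , R 1) + 0ℤ) ≡ 0ℤ
      third rewrite W-L 1 | W-R 1 = lemma (δ (base t)) (δ (L 1)) (δ (R 1)) (T 1)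
        where
        lemma : ∀ m l r c → (m * c - l * 0ℤ) + ((r * 0ℤ - m * c) + 0ℤ) ≡ 0ℤ
        lemma = solve-∀

      list₁ list₂ : List (Vertex Δ × Vertex Δ)
      list₁ = map (λ (x , _) → R x , L x) (positivePairs k₀)
      list₂ = concatMap (λ (x , _) → (L (suc x) , R x) ∷ (R x , R (suc x)) ∷ []) (positivePairs (suc d))

      sum₁ : listSum φ list₁ ≡ antidiagonal d (λ x _ → E x * T (suc x))
      sum₁ = trans (listSum-map φ (λ (x , _) → R x , L x) (positivePairs k₀))
        (trans (positivePairs-sum d (λ (x , _) → φ (R x , L x))) (antidiagonal-cong d λ x _ _ → first x))

      sum₂ : listSum φ list₂ + tailSum d (λ x → E (suc x) * T (suc x)) ≡ 0ℤ
      sum₂ = trans (cong (_+ tailSum d (λ x → E (suc x) * T (suc x)))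
          (trans (listSum-concatMap φ (λ (x , _) → (L (suc x) , R x) ∷ (R x , R (suc x)) ∷ [])
            (positivePairs (suc d)))
            (positivePairs-tail d (λ x → φ (L (suc x) , R x) + (φ (R x , R (suc x)) + 0ℤ)))))
        (tailSum-opposite d second)

    -- The bottom corners are boundary points, so `L x` and `R x` both have weight `T x`. The arrows
    -- R → L sum `E x * T (suc x)` over all levels, those joining neighbouring levels subtract
    -- `E x * T x` for positive `x`, and those at `base t` cancel. As `T 0` is zero, the term for x
    -- = 0 may be inserted, which completes the increments of `T`.
    Q¹-contribution : listSum φ (Q¹ Δ k₀ t i) ≡ sum (Ω t)
    Q¹-contribution = begin
      listSum φ (list₁ ++ list₂ ++ (L 1 , base t) ∷ (base t , R 1) ∷ [])
        ≡⟨ trans (listSum-++ φ list₁ _) (cong (listSum φ list₁ +_) (listSum-++ φ list₂ _)) ⟩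
      listSum φ list₁ + (listSum φ list₂ + (φ (L 1 , base t) + (φ (base t , R 1) + 0ℤ)))
        ≡⟨ cong₂ _+_ sum₁ (cong (listSum φ list₂ +_) third) ⟩
      whole + (listSum φ list₂ + 0ℤ)
        ≡⟨ isolate whole (listSum φ list₂) rest (E 0) ⟩
      whole - (E 0 * 0ℤ + rest) + (listSum φ list₂ + rest)
        ≡⟨ cong₂ (λ x y → whole - (E 0 * x + rest) + y) (sym (τ-zero (t , next (next i)))) sum₂ ⟩
      whole - (E 0 * T 0 + rest) + 0ℤ
        ≡⟨ trans (ℤₚ.+-identityʳ _) (cong (λ x → whole - x) (sym (antidiagonal-head d (λ x → E x * T x)))) ⟩
      whole - antidiagonal d (λ x _ → E x * T x)
        ≡⟨ antidiagonal-difference d (λ x _ → E x * T (suc x)) (λ x _ → E x * T x) ⟨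
      antidiagonal d (λ x _ → E x * T (suc x) - E x * T x)
        ≡⟨ antidiagonal-cong d (λ x _ _ → factor (δ (L (suc x))) (δ (R (suc x))) (T (suc x)) (T x)) ⟩
      antidiagonal d (λ x _ → δ (L (suc x)) * (T (suc x) - T x) + - δ (R (suc x)) * (T (suc x) - T x))
        ≡⟨ antidiagonal-+ d (λ x _ → δ (L (suc x)) * (T (suc x) - T x)) (λ x _ → - δ (R (suc x)) * (T (suc x) - T x)) ⟩
      antidiagonal d (λ x _ → δ (L (suc x)) * (T (suc x) - T x)) + antidiagonal d
        (λ x _ → - δ (R (suc x)) * (T (suc x) - T x))
        ≡⟨ cong₂ _+_ Ω-L Ω-R ⟨
      Ω t (next i) + Ω t (next (next i))
        ≡⟨ pad (Ω t (next i)) (Ω t (next (next i))) ⟩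
      0ℤ + (Ω t (next i) + (Ω t (next (next i)) + 0ℤ))
        ≡⟨ cong (_+ (Ω t (next i) + (Ω t (next (next i)) + 0ℤ))) (Ω-boundary b) ⟨
      Ω t i + (Ω t (next i) + (Ω t (next (next i)) + 0ℤ))
        ≡⟨ sum-rotate (Ω t) i ⟩
      sum (Ω t) ∎
      where
      open ≡-Reasoning
      whole = antidiagonal d (λ x _ → E x * T (suc x))
      rest = tailSum d (λ x → E (suc x) * T (suc x))
      isolate : ∀ a b c e → a + (b + 0ℤ) ≡ a - (e * 0ℤ + c) + (b + c)
      isolate = solve-∀
      factor : ∀ l r c c′ → (l - r) * c - (l - r) * c′ ≡ l * (c - c′) + - r * (c - c′)
      factor = solve-∀
      pad : ∀ a b → a + b ≡ 0ℤ + (a + (b + 0ℤ))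
      pad = solve-∀

  bottomSide-boundary : ∀ {t i} → bottomSide Δ k₀ t ≡ just i → side t i ≡ nothing
  bottomSide-boundary {t} eq with side t 0F in s₀ | side t 1F in s₁ | side t 2F in s₂
  bottomSide-boundary refl | nothing | _       | _       = s₀
  bottomSide-boundary refl | just _  | nothing | _       = s₁
  bottomSide-boundary refl | just _  | just _  | nothing = s₂

  piece-contribution : ∀ M t → listSum φ (piece Δ k₀ M t) ≡ sum (Ω t)
  piece-contribution 𝒜 t = Q-contribution t
  piece-contribution 𝒜′ t with bottomSide Δ k₀ t in eq
  ... | nothing = Q-contribution t
  ... | just i  = Q¹-contribution (bottomSide-boundary eq)

  -- The two triangles at an arc contribute opposite amounts.
  arcΩ : Fin arcs → ℤ
  arcΩ e = antidiagonal d λ x y → δ (onArc e (suc x) (suc y)) * (∂ (target e) y - ∂ (source e) x)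

  ∂-cong : ∀ {c c′} → corner c ≡ corner c′ → ∀ x → ∂ c x ≡ ∂ c′ x
  ∂-cong eq x = cong (λ q → at Δ k₀ q (suc x) p a - at Δ k₀ q x p a) eq

  Ω-true : ∀ {t i e} → side t i ≡ just (e , true) → Ω t i ≡ arcΩ e
  Ω-true {t} {i} {e} eq = antidiagonal-cong d λ x y _ → cong₂ _*_
    (cong δ (onSide-true eq (suc x) (suc y)))
    (cong (λ (t , i) → ∂ (t , next i) y - ∂ (t , i) x) (sym (Equivalence.to side-sideOf eq)))

  Ω-false : ∀ {t i e} → side t i ≡ just (e , false) → Ω t i ≡ 0ℤ - arcΩ e
  Ω-false {t} {i} {e} eq = trans (antidiagonal-cong d λ x y _ → trans (cong₂ _*_
        (cong δ (onSide-false eq (suc x) (suc y)))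
        (cong₂ _-_ (∂-cong (sym (corner-source eq)) y) (∂-cong (sym (corner-target eq)) x)))
      (lemma (δ (onArc e (suc y) (suc x))) (∂ (source e) y) (∂ (target e) x)))
    (trans (antidiagonal-difference d (λ _ _ → 0ℤ)
      (λ x y → δ (onArc e (suc y) (suc x)) * (∂ (target e) x - ∂ (source e) y)))
      (cong₂ _-_ (antidiagonal-zero d)
        (antidiagonal-swap d (λ x y → δ (onArc e (suc y) (suc x)) * (∂ (target e) x - ∂ (source e) y)))))
    where
    lemma : ∀ x s t → x * (s - t) ≡ 0ℤ - x * (t - s)
    lemma = solve-∀

  -- With these coefficients the sum over sides of triangles becomes a sum over arcs by exchanging
  -- summations. Each arc has exactly one side of either direction, so its coefficient in `Ω-cancel`
  -- is 1 - 1.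
  incidence : Fin arcs → Bool → Fin triangles → Fin 3 → ℤ
  incidence e b t i = if does (≡-dec Finₚ._≟_ Finₚ._≟_ (sideOf e b) (t , i)) then 1ℤ else 0ℤ

  incidence-≡ : ∀ {e b t i} → sideOf e b ≡ (t , i) → incidence e b t i ≡ 1ℤ
  incidence-≡ {e} {b} {t} {i} eq = cong (λ x → if x then 1ℤ else 0ℤ)
    (dec-true (≡-dec Finₚ._≟_ Finₚ._≟_ (sideOf e b) (t , i)) eq)

  incidence-≢ : ∀ {e b t i} → sideOf e b ≢ (t , i) → incidence e b t i ≡ 0ℤ
  incidence-≢ {e} {b} {t} {i} neq = cong (λ x → if x then 1ℤ else 0ℤ)
    (dec-false (≡-dec Finₚ._≟_ Finₚ._≟_ (sideOf e b) (t , i)) neq)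

  incidence-side : ∀ {e b t i m} → side t i ≡ m → m ≢ just (e , b) → incidence e b t i ≡ 0ℤ
  incidence-side eq neq = incidence-≢ λ eq′ → neq (trans (sym eq) (Equivalence.from side-sideOf eq′))

  incidence-total : ∀ e b → sum (λ t → sum (λ i → incidence e b t i)) ≡ 1ℤ
  incidence-total e b = trans (sum-single (λ t → sum (incidence e b t)) (proj₁ (sideOf e b))
      λ t t≢ → sum-zero (incidence e b t) λ i → incidence-≢ λ eq → t≢ (sym (cong proj₁ eq)))
    (trans (sum-single (incidence e b (proj₁ (sideOf e b)))
      (proj₂ (sideOf e b)) λ i i≢ → incidence-≢ λ eq → i≢ (sym (cong proj₂ eq)))
      (incidence-≡ {e} {b} refl))

  Ω-arcs : ∀ t i → Ω t i ≡ sum (λ e → (incidence e true t i - incidence e false t i) * arcΩ e)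
  Ω-arcs t i = cases (side t i) refl
    where
    zero-term : ∀ e → incidence e true t i ≡ 0ℤ → incidence e false t i ≡ 0ℤ →
      (incidence e true t i - incidence e false t i) * arcΩ e ≡ 0ℤ
    zero-term e p q = cong₂ (λ x y → (x - y) * arcΩ e) p q
    cases : ∀ m → side t i ≡ m → Ω t i ≡ sum (λ e → (incidence e true t i - incidence e false t i) * arcΩ e)
    cases nothing eq = trans (Ω-boundary eq)
      (sym (sum-zero (λ e → (incidence e true t i - incidence e false t i) * arcΩ e) λ e →
      zero-term e (incidence-side eq λ ()) (incidence-side eq λ ())))
    cases (just (e , true)) eq = trans (Ω-true eq) (sym (trans
      (sum-single (λ e → (incidence e true t i - incidence e false t i) * arcΩ e) e λ e′ e′≢e →
        zero-term e′ (incidence-side eq λ { refl → e′≢e refl }) (incidence-side eq λ ()))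
      (trans (cong₂ (λ x y → (x - y) * arcΩ e) (incidence-≡ (Equivalence.to side-sideOf eq))
        (incidence-side eq λ ()))
        (ℤₚ.*-identityˡ (arcΩ e)))))
    cases (just (e , false)) eq = trans (Ω-false eq) (sym (trans
      (sum-single (λ e → (incidence e true t i - incidence e false t i) * arcΩ e) e λ e′ e′≢e →
        zero-term e′ (incidence-side eq λ ()) (incidence-side eq λ { refl → e′≢e refl }))
      (trans (cong₂ (λ x y → (x - y) * arcΩ e) (incidence-side eq λ ())
        (incidence-≡ (Equivalence.to side-sideOf eq)))
        (lemma (arcΩ e)))))
      where
      lemma : ∀ x → (0ℤ - 1ℤ) * x ≡ 0ℤ - x
      lemma = solve-∀

  Ω-cancel : sum (λ t → sum (Ω t)) ≡ 0ℤ
  Ω-cancel = begin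
    sum (λ t → sum (Ω t))
      ≡⟨ sum-cong-≗ (λ t → trans (sum-cong-≗ (Ω-arcs t)) (∑-comm (λ i e → term e t i))) ⟩
    sum (λ t → sum (λ e → sum (λ i → term e t i)))
      ≡⟨ ∑-comm (λ t e → sum (λ i → term e t i)) ⟩
    sum (λ e → sum (λ t → sum (λ i → term e t i)))
      ≡⟨ sum-zero _ per-arc ⟩
    0ℤ ∎
    where
    open ≡-Reasoning
    term : Fin arcs → Fin triangles → Fin 3 → ℤ
    term e t i = (incidence e true t i - incidence e false t i) * arcΩ e
    per-arc : ∀ e → sum (λ t → sum (λ i → term e t i)) ≡ 0ℤ
    per-arc e = begin
      sum (λ t → sum (λ i → term e t i))
        ≡⟨ sum-cong-≗ (λ t → trans (sym (*-distribʳ-sum (arcΩ e) (λ i → incidence e true t i - incidence e false t i)))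
             (cong (_* arcΩ e) (sum-difference (incidence e true t) (incidence e false t)))) ⟩
      sum (λ t → (sum (incidence e true t) - sum (incidence e false t)) * arcΩ e)
        ≡⟨ *-distribʳ-sum (arcΩ e) (λ t → sum (incidence e true t) - sum (incidence e false t)) ⟨
      sum (λ t → sum (incidence e true t) - sum (incidence e false t)) * arcΩ e
        ≡⟨ cong (_* arcΩ e) (trans (sum-difference (λ t → sum (incidence e true t)) (λ t → sum (incidence e false t)))
             (cong₂ _-_ (incidence-total e true) (incidence-total e false))) ⟩
      0ℤ ∎

  allArrows-balanced : ∀ M → listSum φ (allArrows Δ k₀ M) ≡ 0ℤ
  allArrows-balanced M = trans (listSum-concatMap φ (piece Δ k₀ M) (allFin triangles))
    (trans (listSum-cong (piece-contribution M) (allFin triangles))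
      (trans (listSum-allFin (λ t → sum (Ω t))) Ω-cancel))

-- The vertices of the initial quiver

pairs-sound : ∀ d → All (λ (x , y) → x ℕ.+ y ≡ d) (pairs d)
pairs-sound d = Allₚ.map⁺ (Allₚ.applyUpTo⁺₁ (λ x → x) (suc d) λ { (s≤s x≤d) → ℕₚ.m+[n∸m]≡n x≤d })

All-concatMap⁺ : {P : B → Set} (f : A → List B) → ∀ {xs} → All (λ x → All P (f x)) xs → All P (concatMap f xs)
All-concatMap⁺ f ps = Allₚ.concat⁺ (Allₚ.map⁺ ps)

triples-sound : ∀ d → All (λ (x , y , z) → x ℕ.+ (y ℕ.+ z) ≡ d) (triples d)
triples-sound d = All-concatMap⁺ (λ (x , r) → map (x ,_) (pairs r)) (All.map (λ {(x , r)} eq →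
  Allₚ.map⁺ (All.map (λ eq′ → trans (cong (x ℕ.+_) eq′) eq) (pairs-sound r))) (pairs-sound d))

triples-∈ : ∀ x y z {d} → x ℕ.+ (y ℕ.+ z) ≡ d → (x , y , z) List.∈ triples d
triples-∈ x y z eq = Listₘ.∈-concatMap⁺ (λ (x , r) → map (x ,_) (pairs r))
  (List.lose (pairs-∈ x (y ℕ.+ z) eq) (Listₘ.∈-map⁺ (x ,_) (pairs-∈ y z refl)))

positiveTriples-∈ : ∀ x y z {d} → suc x ℕ.+ (y ℕ.+ z) ≡ d →
  (suc x , suc y , suc z) List.∈ positiveTriples (suc (suc d))
positiveTriples-∈ x y z refl = Listₘ.∈-map⁺ _ (triples-∈ x y z refl)

Distinct : List A → Set
Distinct = AllPairs _≢_

concatMap-distinct : {R : A → A → Set} {f : A → List B} {xs : List A} → AllPairs R xs →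
  (∀ x → Distinct (f x)) → (∀ {x y} → R x y → ∀ {v} → v List.∈ f x → v List.∈ f y → ⊥) → Distinct
    (concatMap f xs)
concatMap-distinct {f = f} {xs} rs distinct disjoint = AllPairsₚ.concat⁺
  (Allₚ.map⁺ (All.universal distinct xs))
  (AllPairsₚ.map⁺ (AllPairs.map (λ r → All.tabulate λ v∈ → All.tabulate λ { w∈ refl → disjoint r v∈ w∈ }) rs))

pairs-distinct₁ : ∀ d → AllPairs (λ v w → proj₁ v ≢ proj₁ w) (pairs d)
pairs-distinct₁ d = AllPairsₚ.map⁺ (Uniqueₚ.upTo⁺ (suc d))

pairs-distinct : ∀ d → Distinct (pairs d)
pairs-distinct d = AllPairs.map (λ neq eq → neq (cong proj₁ eq)) (pairs-distinct₁ d)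

triples-distinct : ∀ d → Distinct (triples d)
triples-distinct d = concatMap-distinct {f = λ (x , r) → map (x ,_) (pairs r)} (pairs-distinct₁ d)
  (λ (x , r) → AllPairsₚ.map⁺ (AllPairs.map (λ neq eq → neq (cong proj₂ eq)) (pairs-distinct r)))
  λ {x} {y} neq v∈ w∈ → neq (trans (sym (first x v∈)) (first y w∈))
  where
  first : ∀ x {v} → v List.∈ map (proj₁ x ,_) (pairs (proj₂ x)) → proj₁ v ≡ proj₁ x
  first (x , r) v∈ = let (_ , _ , eq) = Listₘ.∈-map⁻ (x ,_) v∈ in cong proj₁ eq

positivePairs-distinct : ∀ d → Distinct (positivePairs d)
positivePairs-distinct zero          = []
positivePairs-distinct (suc zero)    = []
positivePairs-distinct (suc (suc d)) = AllPairsₚ.map⁺ (AllPairs.map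
  (λ neq eq → neq (cong₂ _,_ (ℕₚ.suc-injective (cong proj₁ eq)) (ℕₚ.suc-injective (cong proj₂ eq)))) (pairs-distinct d))

positiveTriples-distinct : ∀ d → Distinct (positiveTriples d)
positiveTriples-distinct zero                = []
positiveTriples-distinct (suc zero)          = []
positiveTriples-distinct (suc (suc zero))    = []
positiveTriples-distinct (suc (suc (suc d))) = AllPairsₚ.map⁺ (AllPairs.map
  (λ neq eq → neq (cong₂ _,_ (ℕₚ.suc-injective (cong proj₁ eq)) (cong₂ _,_
    (ℕₚ.suc-injective (cong (proj₁ ∘ proj₂) eq)) (ℕₚ.suc-injective (cong (proj₂ ∘ proj₂) eq)))))
      (triples-distinct d))

lookup-injective : {xs : List A} → Distinct xs → ∀ {i j} → lookup xs i ≡ lookup xs j → i ≡ j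
lookup-injective distinct {i} {j} eq with Finₚ.<-cmp i j
... | tri< i<j _ _  = contradiction eq (AllPairs-lookup⁻ distinct i<j)
... | tri≈ _ i≡j _  = i≡j
... | tri> _ _ j<i  = contradiction (sym eq) (AllPairs-lookup⁻ distinct j<i)

length-filter : {P : A → Set} (P? : Decidable P) → ∀ xs →
  ℤ.+ length (filter P? xs) ≡ listSum (λ x → if does (P? x) then 1ℤ else 0ℤ) xs
length-filter P? []       = refl
length-filter P? (x ∷ xs) with does (P? x)
... | true  = cong (1ℤ +_) (length-filter P? xs)
... | false = trans (length-filter P? xs) (sym (ℤₚ.+-identityˡ _))

module Vertices (Δ : Triangulation) (k : ℕ) (M : ModuliSpace) where
  open Triangulation Δ

  inner-list : ∀ t → innerVertices Δ k M t ≡ [] ⊎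
    innerVertices Δ k M t ≡ map (λ (a , b , c) → inner t a b c) (positiveTriples k)
  inner-list t = go M refl
    where
    go : ∀ N → M ≡ N → innerVertices Δ k M t ≡ [] ⊎
      innerVertices Δ k M t ≡ map (λ (a , b , c) → inner t a b c) (positiveTriples k)
    go 𝒜  refl = inj₂ refl
    go 𝒜′ refl with bottomSide Δ k t
    ... | nothing = inj₂ refl
    ... | just _  = inj₁ refl

  inner-full : ∀ t → M ≡ 𝒜 ⊎ bottomSide Δ k t ≡ nothing →
    innerVertices Δ k M t ≡ map (λ (a , b , c) → inner t a b c) (positiveTriples k)
  inner-full t (inj₁ refl) = refl
  inner-full t (inj₂ none) = go M refl
    where
    go : ∀ N → M ≡ N → innerVertices Δ k M t ≡ map (λ (a , b , c) → inner t a b c) (positiveTriples k)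
    go 𝒜  refl = refl
    go 𝒜′ refl rewrite none = refl

  innerVertices-distinct : ∀ t → Distinct (innerVertices Δ k M t)
  innerVertices-distinct t with inner-list t
  ... | inj₁ eq = subst Distinct (sym eq) []
  ... | inj₂ eq = subst Distinct (sym eq)
    (AllPairsₚ.map⁺ (AllPairs.map (λ { neq refl → neq refl }) (positiveTriples-distinct k)))

  innerVertices-inner : ∀ t {v} → v List.∈ innerVertices Δ k M t → ∃₂ λ x y → ∃ λ z → v ≡ inner t x y z
  innerVertices-inner t {v} v∈ with inner-list t
  ... | inj₁ eq = contradiction (subst (v List.∈_) eq v∈) λ ()
  ... | inj₂ eq with Listₘ.∈-map⁻ _ (subst (v List.∈_) eq v∈)
  ...   | (x , y , z) , _ , eq′ = x , y , z , eq′

  -- Vertices of a P-seed are positions in this list. Without repetitions, a sum over positions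
  -- counts each vertex of the glued quiver once, as `represented-sum` requires.
  mutableVertices-distinct : Distinct (mutableVertices Δ k M)
  mutableVertices-distinct = AllPairsₚ.++⁺
    (concatMap-distinct (Uniqueₚ.allFin⁺ triangles) innerVertices-distinct
      λ {t} {t′} t≢t′ v∈ w∈ → inner-disjoint t≢t′ (innerVertices-inner t v∈) (innerVertices-inner t′ w∈))
    (concatMap-distinct {f = arcVertices} (Uniqueₚ.allFin⁺ arcs)
      (λ e → AllPairsₚ.map⁺ (AllPairs.map (λ { neq refl → neq refl }) (positivePairs-distinct k)))
      λ {e} {e′} e≢e′ v∈ w∈ → arc-disjoint e≢e′ (arcVertices-arc e v∈) (arcVertices-arc e′ w∈))
    (All.tabulate λ v∈ → All.tabulate λ w∈ → different
      (List.find (Listₘ.∈-concatMap⁻ (innerVertices Δ k M) v∈))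
      (List.find (Listₘ.∈-concatMap⁻ arcVertices w∈)))
    where
    arcVertices : Fin arcs → List (Vertex Δ)
    arcVertices e = map (λ (x , y) → onArc e x y) (positivePairs k)
    arcVertices-arc : ∀ e {v} → v List.∈ arcVertices e → ∃₂ λ x y → v ≡ onArc e x y
    arcVertices-arc e v∈ = let ((x , y) , _ , eq) = Listₘ.∈-map⁻ _ v∈ in x , y , eq
    inner-disjoint : ∀ {t t′} → t ≢ t′ → ∀ {v} → (∃₂ λ x y → ∃ λ z → v ≡ inner t x y z) →
      (∃₂ λ x y → ∃ λ z → v ≡ inner t′ x y z) → ⊥
    inner-disjoint t≢t′ (_ , _ , _ , refl) (_ , _ , _ , refl) = t≢t′ refl
    arc-disjoint : ∀ {e e′} → e ≢ e′ → ∀ {v} → (∃₂ λ x y → v ≡ onArc e x y) →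
      (∃₂ λ x y → v ≡ onArc e′ x y) → ⊥
    arc-disjoint e≢e′ (_ , _ , refl) (_ , _ , refl) = e≢e′ refl
    different : ∀ {v w} → (∃ λ t → t List.∈ allFin triangles × v List.∈ innerVertices Δ k M t) →
      (∃ λ e → e List.∈ allFin arcs × w List.∈ arcVertices e) → v ≢ w
    different (t , _ , v∈) (e , _ , w∈) refl with innerVertices-inner t v∈ | arcVertices-arc e w∈
    ... | _ , _ , _ , refl | _ , _ , ()

-- Balance of the initial P-seed

module InitialBalance (Δ : Triangulation) (d : ℕ) (M : ModuliSpace) (p : Fin (Triangulation.punctures Δ))
  (a : Fin (suc (suc d))) where
  open Triangulation Δ
  open Surface Δ

  private
    k₀ = suc (suc d)
    s₀ = initialPSeed Δ k₀ M
    vertices = mutableVertices Δ k₀ M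
    V : Fin (length vertices) → Vertex Δ
    V = lookup vertices

  open Weights k₀ p a
  open Vertices Δ k₀ M

  -- Frozen vertices have weight zero.
  Represented : Vertex Δ → Set
  Represented x = x List.∈ vertices ⊎ W x ≡ 0ℤ

  onSide-represented : ∀ t i x y → x ℕ.+ y ≡ d → Represented (onSide Δ t i (suc x) (suc y))
  onSide-represented t i x y eq = cases (side t i) refl
    where
    cases : ∀ m → side t i ≡ m → Represented (onSide Δ t i (suc x) (suc y))
    cases nothing  b = inj₂ (W-boundary b (suc x) (suc y))
    cases (just _) s = inj₁ (onSide-mutable M (λ b → contradiction (trans (sym s) b) λ ()) x y eq)

  inner-represented : ∀ t → M ≡ 𝒜 ⊎ bottomSide Δ k₀ t ≡ nothing → ∀ x y z → suc x ℕ.+ (y ℕ.+ z) ≡ d →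
    Represented (inner t (suc x) (suc y) (suc z))
  inner-represented t full x y z eq = inj₁ (Listₘ.∈-++⁺ˡ (Listₘ.∈-concatMap⁺ (innerVertices Δ k₀ M)
    (List.lose (Listₘ.∈-allFin t) (subst (inner t (suc x) (suc y) (suc z) List.∈_) (sym (inner-full t full))
      (Listₘ.∈-map⁺ _ (positiveTriples-∈ x y z eq))))))

  Ends : Vertex Δ × Vertex Δ → Set
  Ends (x , y) = Represented x × Represented y

  Q-represented : ∀ t → M ≡ 𝒜 ⊎ bottomSide Δ k₀ t ≡ nothing → All Ends (Q Δ k₀ t)
  Q-represented t full = Allₚ.concat⁺
    (Allₚ.map⁺ (All.map (λ {ijl} → small-represented ijl) (triples-sound d)))
    where
    X Y Z : ℕ → ℕ → ℕ → Vertex Δ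
    X i j l = place Δ t (suc i , suc j , l)
    Y i j l = place Δ t (suc i , j , suc l)
    Z i j l = place Δ t (i , suc j , suc l)
    X-represented : ∀ i j l → i ℕ.+ (j ℕ.+ l) ≡ d → Represented (X i j l)
    X-represented i j zero    eq = onSide-represented t 0F i j
      (trans (cong (i ℕ.+_) (sym (ℕₚ.+-identityʳ j))) eq)
    X-represented i j (suc l) eq = inner-represented t full i j l
      (trans (trans (sym (ℕₚ.+-suc i (j ℕ.+ l))) (cong (i ℕ.+_) (sym (ℕₚ.+-suc j l)))) eq)
    Y-represented : ∀ i j l → i ℕ.+ (j ℕ.+ l) ≡ d → Represented (Y i j l)
    Y-represented i zero    l eq = onSide-represented t 2F l i (trans (ℕₚ.+-comm l i) eq)
    Y-represented i (suc j) l eq = inner-represented t full i j l (trans (sym (ℕₚ.+-suc i (j ℕ.+ l))) eq)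
    Z-represented : ∀ i j l → i ℕ.+ (j ℕ.+ l) ≡ d → Represented (Z i j l)
    Z-represented zero    j l eq = onSide-represented t 1F j l eq
    Z-represented (suc i) j l eq = inner-represented t full i j l eq
    small-represented : ∀ ijl → (let (i , j , l) = ijl in i ℕ.+ (j ℕ.+ l) ≡ d) →
      All Ends (let (i , j , l) = ijl in (X i j l , Y i j l) ∷ (Y i j l , Z i j l) ∷ (Z i j l , X i j l) ∷ [])
    small-represented (i , j , l) eq =
      (X-represented i j l eq , Y-represented i j l eq) ∷ (Y-represented i j l eq , Z-represented i j l eq) ∷
      (Z-represented i j l eq , X-represented i j l eq) ∷ []

  Q¹-represented : ∀ t i → All Ends (Q¹ Δ k₀ t i)
  Q¹-represented t i = Allₚ.++⁺
    (Allₚ.map⁺ (Allₚ.map⁺ (All.map (λ {(x , y)} eq → R-represented x y eq , L-represented x y eq) (pairs-sound d))))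
    (Allₚ.++⁺ (Allₚ.concat⁺ (Allₚ.map⁺ (second d refl)))
      ((L-represented 0 d refl , inj₂ refl) ∷ (inj₂ refl , R-represented 0 d refl) ∷ []))
    where
    L R : ℕ → Vertex Δ
    L x = onSide Δ t (next i) (k₀ ∸ x) x
    R x = onSide Δ t (next (next i)) x (k₀ ∸ x)
    L-represented : ∀ x y → x ℕ.+ y ≡ d → Represented (L (suc x))
    L-represented x y eq = subst (λ n → Represented (onSide Δ t (next i) n (suc x))) (complement x y eq)
      (onSide-represented t (next i) y x (trans (ℕₚ.+-comm y x) eq))
    R-represented : ∀ x y → x ℕ.+ y ≡ d → Represented (R (suc x))
    R-represented x y eq = subst (λ n → Represented (onSide Δ t (next (next i)) (suc x) n))
      (complement x y eq)
      (onSide-represented t (next (next i)) x y eq)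
    -- The bound is separated from `d` so that the empty case k = 2 can be split off.
    second : ∀ e → e ≡ d → All (λ (x , _) → All Ends ((L (suc x) , R x) ∷ (R x , R (suc x)) ∷ [])) (positivePairs (suc e))
    second zero    _   = []
    second (suc e) e≡d = Allₚ.map⁺ (All.map (λ {(x , y)} eq →
      let here′ = trans (ℕₚ.+-suc x y) (trans (cong suc eq) e≡d)
          next′ = trans (cong suc eq) e≡d in
      (L-represented (suc x) y next′ , R-represented x (suc y) here′) ∷
      (R-represented x (suc y) here′ , R-represented (suc x) y next′) ∷ []) (pairs-sound e))

  allArrows-represented : All Ends (allArrows Δ k₀ M)
  allArrows-represented = Allₚ.concat⁺ (Allₚ.map⁺ (All.universal (λ t → go M refl t) (allFin triangles)))
    where
    go : ∀ N → M ≡ N → ∀ t → All Ends (piece Δ k₀ M t)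
    go 𝒜  refl t = Q-represented t (inj₁ refl)
    go 𝒜′ refl t with bottomSide Δ k₀ t in eq
    ... | nothing = Q-represented t (inj₂ eq)
    ... | just i  = Q¹-represented t i

  indicator : Vertex Δ → Vertex Δ → ℤ
  indicator x y = if does (Defs._≟_ Δ x y) then 1ℤ else 0ℤ

  indicator-≢ : ∀ {x y} → x ≢ y → indicator x y ≡ 0ℤ
  indicator-≢ {x} {y} neq = cong (λ b → if b then 1ℤ else 0ℤ) (dec-false (Defs._≟_ Δ x y) neq)

  indicator-≡ : ∀ {x y} → x ≡ y → indicator x y ≡ 1ℤ
  indicator-≡ {x} {y} eq = cong (λ b → if b then 1ℤ else 0ℤ) (dec-true (Defs._≟_ Δ x y) eq)

  represented-sum : ∀ {x} → Represented x → sum (λ u → indicator x (V u) * W (V u)) ≡ W x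
  represented-sum {x} (inj₂ W≡0) = trans (sum-zero _ zero-term) (sym W≡0)
    where
    zero-term : ∀ u → indicator x (V u) * W (V u) ≡ 0ℤ
    zero-term u with Defs._≟_ Δ x (V u)
    ... | yes eq = trans (ℤₚ.*-identityˡ (W (V u))) (trans (cong W (sym eq)) W≡0)
    ... | no _   = refl
  represented-sum {x} (inj₁ x∈) = trans (sum-single (λ u → indicator x (V u) * W (V u)) u₀ others)
    (trans (cong₂ _*_ (indicator-≡ located) (cong W (sym located))) (ℤₚ.*-identityˡ (W x)))
    where
    u₀ = Any.index x∈
    located : x ≡ V u₀
    located = Anyₚ.lookup-index x∈
    others : ∀ u → u ≢ u₀ → indicator x (V u) * W (V u) ≡ 0ℤ
    others u u≢ = cong (_* W (V u)) (indicator-≢ λ eq →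
      u≢ (lookup-injective mutableVertices-distinct (trans (sym eq) located)))

  multiplicity-sum : ∀ x y → ℤ.+ multiplicity Δ k₀ M x y ≡
    listSum (λ (f , g) → indicator f x * indicator g y) (allArrows Δ k₀ M)
  multiplicity-sum x y = trans
    (length-filter (λ f → ≡-dec (Defs._≟_ Δ) (Defs._≟_ Δ) f (x , y)) (allArrows Δ k₀ M))
    (listSum-cong pair (allArrows Δ k₀ M))
    where
    pair : ∀ f → (if does (≡-dec (Defs._≟_ Δ) (Defs._≟_ Δ) f (x , y)) then 1ℤ else 0ℤ) ≡
      indicator (proj₁ f) x * indicator (proj₂ f) y
    pair (f , g) = cases (Defs._≟_ Δ f x) (Defs._≟_ Δ g y)
      where
      both = ≡-dec (Defs._≟_ Δ) (Defs._≟_ Δ) (f , g) (x , y)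
      cases : Dec (f ≡ x) → Dec (g ≡ y) → (if does both then 1ℤ else 0ℤ) ≡ indicator f x * indicator g y
      cases (yes p) (yes q) = trans (cong (λ b → if b then 1ℤ else 0ℤ) (dec-true both (cong₂ _,_ p q)))
        (sym (cong₂ _*_ (indicator-≡ p) (indicator-≡ q)))
      cases (no ¬p) _ = trans (cong (λ b → if b then 1ℤ else 0ℤ) (dec-false both (¬p ∘ cong proj₁)))
        (sym (cong (_* indicator g y) (indicator-≢ ¬p)))
      cases (yes _) (no ¬q) = trans (cong (λ b → if b then 1ℤ else 0ℤ) (dec-false both (¬q ∘ cong proj₂)))
        (sym (trans (cong (indicator f x *_) (indicator-≢ ¬q)) (ℤₚ.*-zeroʳ (indicator f x))))

  module _ (z : Vertex Δ) where
    open Balance Δ d p a z using (φ; allArrows-balanced)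

    -- Both sides are additive in the list of arrows. For a single arrow the sum over vertices picks
    -- out the weights of its ends, which is correct also for a frozen end, as its weight is zero.
    arrows-sum : ∀ fs → All Ends fs →
      sum (λ u → (listSum (λ (f , g) → indicator f (V u) * indicator g z) fs -
        listSum (λ (f , g) → indicator f z * indicator g (V u)) fs) * W (V u)) ≡ listSum φ fs
    arrows-sum [] [] = sum-zero (λ u → 0ℤ * W (V u)) λ _ → refl
    arrows-sum ((f , g) ∷ fs) ((rf , rg) ∷ rs) = begin
      sum (λ u → (ι f u * δg + ins u - (δf * ι g u + outs u)) * W (V u))
        ≡⟨ sum-cong-≗ (λ u → expand (ι f u) δg (ins u) δf (ι g u) (outs u) (W (V u))) ⟩
      sum (λ u → (δg * (ι f u * W (V u)) - δf * (ι g u * W (V u))) + (ins u - outs u) * W (V u))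
        ≡⟨ ∑-distrib-+ (λ u → δg * (ι f u * W (V u)) - δf * (ι g u * W (V u))) (λ u → (ins u - outs u) * W (V u)) ⟩
      sum (λ u → δg * (ι f u * W (V u)) - δf * (ι g u * W (V u))) + sum (λ u → (ins u - outs u) * W (V u))
        ≡⟨ cong₂ _+_ (trans (sum-difference (λ u → δg * (ι f u * W (V u))) (λ u → δf * (ι g u * W (V u))))
             (cong₂ _-_ (scaled δg f rf) (scaled δf g rg))) (arrows-sum fs rs) ⟩
      (δg * W f - δf * W g) + listSum φ fs ∎
      where
      open ≡-Reasoning
      ι : Vertex Δ → Fin (length vertices) → ℤ
      ι x u = indicator x (V u)
      δf δg : ℤ
      δf = indicator f z
      δg = indicator g z
      ins outs : Fin (length vertices) → ℤ
      ins u = listSum (λ (f , g) → indicator f (V u) * indicator g z) fs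
      outs u = listSum (λ (f , g) → indicator f z * indicator g (V u)) fs
      expand : ∀ x e a e′ y b w → (x * e + a - (e′ * y + b)) * w ≡ (e * (x * w) - e′ * (y * w)) + (a - b) * w
      expand = solve-∀
      scaled : ∀ c x → Represented x → sum (λ u → c * (ι x u * W (V u))) ≡ c * W x
      scaled c x r = trans (sym (*-distribˡ-sum c (λ u → ι x u * W (V u)))) (cong (c *_) (represented-sum r))

    multiplicities-balanced : sum (λ u →
      (ℤ.+ multiplicity Δ k₀ M (V u) z - ℤ.+ multiplicity Δ k₀ M z (V u)) * W (V u)) ≡ 0ℤ
    multiplicities-balanced = trans
      (sum-cong-≗ λ u → cong (_* W (V u)) (cong₂ _-_ (multiplicity-sum (V u) z) (multiplicity-sum z (V u))))
      (trans (arrows-sum (allArrows Δ k₀ M) allArrows-represented) (allArrows-balanced M))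

  initial-balance : ∀ w → sum (λ u → signedArrows (arrows s₀) u w * π[ p ] s₀ u a) ≡ 0ℤ
  initial-balance w = trans
    (sum-cong-≗ λ u → cong (_* W (V u))
      (+-∸-difference (multiplicity Δ k₀ M (V u) (V w)) (multiplicity Δ k₀ M (V w) (V u))))
    (multiplicities-balanced (V w))

∸-antisymmetric : ∀ x y → x ∸ y ≡ 0 ⊎ y ∸ x ≡ 0
∸-antisymmetric x y with ℕₚ.≤-total x y
... | inj₁ x≤y = inj₁ (ℕₚ.m≤n⇒m∸n≡0 x≤y)
... | inj₂ y≤x = inj₂ (ℕₚ.m≤n⇒m∸n≡0 y≤x)

initial-valid : (Δ : Triangulation) (d : ℕ) (M : ModuliSpace) (p : Fin (Triangulation.punctures Δ)) →
  Valid p (initialPSeed Δ (suc (suc d)) M)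
initial-valid Δ d M p = record
  { antisymmetric = λ u w → ∸-antisymmetric (multiplicity Δ _ M (lookup vertices u) (lookup vertices w)) _
  ; balanced      = λ w a → InitialBalance.initial-balance Δ d M p a w
  }
  where
  vertices = mutableVertices Δ (suc (suc d)) M

admissible⇒regular : ∀ M {Δ} → Admissible M Δ → Regular Δ
admissible⇒regular 𝒜  regular       = regular
admissible⇒regular 𝒜′ (regular , _) = regular

lemma6p10 : (k : ℕ) → 2 ℕ.≤ k →
    (M : ModuliSpace) (Δ : Triangulation) → Admissible M Δ →
    ∀ {s s′} → MutationAdjacent (initialPSeed Δ k M) s s′ →
    (p : Fin (Triangulation.punctures Δ)) →
    ∃₂ λ D D′ →
    IsDospOf (π[ p ] s) D × IsDospOf (π[ p ] s′) D′ ×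
    (D ≡ D′ ⊎ DospMutation D D′)
lemma6p10 (suc (suc d)) (s≤s (s≤s z≤n)) M Δ admissible (reachable , reachable′ , v , refl) p =
  exchange-dosps (mutation-exchange (initial-valid Δ d M p)
    (Surface.initial-rich Δ M (admissible⇒regular M admissible) p) reachable v (reachable-good reachable′))
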